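{- Let $p,q,r$ be positive real numbers with $p+q+r=1$, and let $p_{i,j}(n)$ be the probability that the Markov chain described in the context, started at $(0,0)$ at time $0$, is at $(i,j)$ at time $n$. Assume $p=q$. Then the three-variate generating function $\sum_{i,j,n\ge0}p_{i,j}(n)x^iy^jt^n$ is algebraic, and can be expressed explicitly in terms of the unique power series $Z\equiv Z(t)$ satisfying $Z=1+4pqrt^3Z^3$. In particular, the generating function of walks ending at the origin is algebraic of degree $6$: $$P_{0,0}=\sum_{n \ge 0} p_{0,0}(3n) t^{3n} = \frac r p \left ( \frac {\sqrt{1-pZ(1+Z)+p^2Z^2}}{1-2pZ}-1\right)= \frac r p \left (\frac {\sqrt{\Delta_-(p/t)}}{1-2pZ}-1\right) ,$$ where $\Delta_-(\bar x)= 1-tZ(1+Z)\bar x + t^2Z^2 \bar x^2$. More generally, the series $Q(px,0)= P_{0,0}+ r' P_1(px)$ is given by $$\left(t-x(1-p)+prx^2t^2\right)Q(px,0)= \frac r {2p} \left(\frac { (2tZ-x)\sqrt{\Delta_-(p/t)}\sqrt{\Delta_+(x)}}{Z(1-2pZ)}-2t+x(1-p) \right),$$ where $\Delta_+(x)= 1-4pqrt^2Z^2x$. The expression of $P_{0,0}$ is recovered from that of $Q(px,0)$ by setting $x=0$.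
   Context: The Markov chain on the quadrant $\{(i,j):i,j\ge0\}$: from $(i,j)$ with $i,j>0$, it goes to $(i-1,j)$ with probability $p$, to $(i,j-1)$ with probability $q$, to $(i+1,j+1)$ with probability $r$. From $(i,0)$ with $i>0$, it goes to $(i-1,0)$ with probability $p'=\frac p{p+r}$ and to $(i+1,1)$ with probability $r'=\frac r{p+r}$. From $(0,j)$ with $j>0$, it goes to $(0,j-1)$ with probability $q''=\frac q{q+r}$ and to $(1,j+1)$ with probability $r''=\frac r{q+r}$. From $(0,0)$ it goes to $(1,1)$ with probability $1$. Notation: $P_{0,0}=\sum_{n\ge0}p_{0,0}(n)t^n$, $P_1(x)=\sum_{n,i>0}p_{i,0}(n)x^it^n$. All series are formal power series in $t$; $\Delta_-(p/t)$ means $1-pZ(1+Z)+p^2Z^2$; $\sqrt{\Delta_-(p/t)}$ is the power series in $t$ with constant term $1-p$, and $\sqrt{\Delta_+(x)}$ the one with constant term $1$. A power series in some variables is algebraic if it satisfies a nontrivial polynomial equation with coefficients polynomials (over $\mathbb{R}$) in these variables; the degree of a series in $t$ is its degree over the field $\mathbb{R}(t)$ of rational functions in $t$. -}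

module Defs where

open import Level using (Level; Lift; _⊔_)
open import Algebra.Bundles using (RawRing; CommutativeRing)
open import Algebra.Apartness.Bundles using (HeytingField; HeytingCommutativeRing)
import Algebra.Definitions
import Algebra.Definitions.RawSemiring
open import Data.Bool.Base using (if_then_else_)
open import Data.Fin.Base using (toℕ)
open import Data.List.Base using (List; []; _∷_; foldr)
open import Data.List.Relation.Unary.All using (All)
open import Data.List.Relation.Unary.Any using (Any)
open import Data.Nat.Base as ℕ using (ℕ; zero; suc; _∸_; NonZero)
import Data.Nat.DivMod as ℕ
import Data.Nat.Divisibility as ℕ
import Data.Nat.Properties as ℕ
open import Data.Product.Base using (_×_; _,_; ∃; proj₁)
open import Data.Product.Properties using (≡-dec)
open import Data.Sum.Base using (_⊎_)
open import Data.Vec.Base using (Vec; []; _∷_; last; toList)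
open import Relation.Binary.Core using (Rel)
open import Relation.Binary.Structures using (IsStrictPartialOrder)
open import Relation.Nullary.Decidable using (does)

private variable
  a ℓ : Level

-- Constructive axioms for the real numbers: a Cauchy complete Archimedean
-- ordered field.  Classically ℝ is the only such field up to isomorphism.
-- Trichotomy is not assumed; _#_ is the relation x < y or y < x.

record RealField c ℓ₁ ℓ₂ ℓ₃ : Set (Level.suc (c ⊔ ℓ₁ ⊔ ℓ₂ ⊔ ℓ₃)) where
  infix 4 _<_
  field
    heytingField : HeytingField c ℓ₁ ℓ₂

  open HeytingField heytingField public

  rawRing : RawRing c ℓ₁
  rawRing = CommutativeRing.rawRing
    (HeytingCommutativeRing.commutativeRing heytingCommutativeRing)

  open Algebra.Definitions.RawSemiring (RawRing.rawSemiring rawRing) public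
    using (_^_) renaming (_×_ to _·_)

  field
    _<_                  : Rel Carrier ℓ₃
    isStrictPartialOrder : IsStrictPartialOrder _≈_ _<_
    #⇒<⊎>                : ∀ {x y} → x # y → x < y ⊎ y < x
    <⇒#                  : ∀ {x y} → x < y → x # y
    +-monoʳ-<            : ∀ x {y z} → y < z → x + y < x + z
    *-pos                : ∀ {x y} → 0# < x → 0# < y → 0# < x * y
    archimedean          : ∀ x → ∃ λ n → x < n · 1#
    complete             : ∀ (u : ℕ → Carrier) →
      (∀ k → ∃ λ N → ∀ m n → N ℕ.≤ m → N ℕ.≤ n →
        suc k · (u m - u n) < 1#) →
      ∃ λ l → ∀ k → ∃ λ N → ∀ n → N ℕ.≤ n →
        suc k · (u n - l) < 1# × suc k · (l - u n) < 1#

  private module < = IsStrictPartialOrder isStrictPartialOrder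

  +-pos : ∀ {x y} → 0# < x → 0# < y → 0# < x + y
  +-pos {x} x>0 y>0 =
    <.trans x>0 (<.<-respˡ-≈ (+-identityʳ x) (+-monoʳ-< x y>0))

  infixl 7 _÷_⟨_⟩
  _÷_⟨_⟩ : ∀ (x y : Carrier) → 0# < y → Carrier
  x ÷ y ⟨ y>0 ⟩ = x * proj₁ (#⇒invertible (#-sym (<⇒# y>0)))

module RingNotation (A : RawRing a ℓ) where
  open RawRing A public
  open Algebra.Definitions.RawSemiring rawSemiring public
    using (_^_; sum) renaming (_×_ to _·_)
  open Algebra.Definitions _≈_ public using (Invertible)

  infixl 6 _-_
  _-_ : Carrier → Carrier → Carrier
  x - y = x + (- y)

-- A⟦X⟧: f n is the coefficient of Xⁿ.

series : RawRing a ℓ → RawRing a ℓ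
series A = record
  { Carrier = ℕ → Carrier
  ; _≈_     = λ f g → ∀ n → f n ≈ g n
  ; _+_     = λ f g n → f n + g n
  ; _*_     = λ f g n → sum {suc n} (λ k → f (toℕ k) * g (n ∸ toℕ k))
  ; -_      = λ f n → - f n
  ; 0#      = λ _ → 0#
  ; 1#      = λ { zero → 1# ; (suc _) → 0# }
  }
  where open RingNotation A

module _ (A : RawRing a ℓ) where
  open RingNotation A

  const : Carrier → ℕ → Carrier
  const c zero    = c
  const c (suc _) = 0#

  var : ℕ → Carrier
  var zero          = 0#
  var (suc zero)    = 1#
  var (suc (suc _)) = 0#

  -- f(X) ↦ f(cX)
  rescale : Carrier → (ℕ → Carrier) → ℕ → Carrier
  rescale c f n = c ^ n * f n

  -- f(X) ↦ f(Xᵏ)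
  dilate : ∀ k .{{_ : NonZero k}} → (ℕ → Carrier) → ℕ → Carrier
  dilate k f n = if does (k ℕ.∣? n) then f (n ℕ./ k) else 0#

  IsSqrtWithConstantTerm : Carrier → (Δ S : ℕ → Carrier) → Set ℓ
  IsSqrtWithConstantTerm c Δ S = RawRing._≈_ (series A) (RawRing._*_ (series A) S S) Δ × S 0 ≈ c

-- Polynomials in n variables, as lists of coefficients (lowest degree first)
-- with respect to the first variable.  Trailing zeros are allowed.

Poly : Set a → ℕ → Set a
Poly A zero    = A
Poly A (suc n) = List (Poly A n)

module Polynomials {c ℓ₁ ℓ₂ ℓ₃} (ℝ : RealField c ℓ₁ ℓ₂ ℓ₃) where
  open RealField ℝ

  Nonzero : ∀ n → Poly Carrier n → Set (c ⊔ ℓ₂)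
  Nonzero zero    x = Lift (c ⊔ ℓ₂) (x # 0#)
  Nonzero (suc n) P = Any (Nonzero n) P

  Zero : ∀ n → Poly Carrier n → Set (c ⊔ ℓ₁)
  Zero zero    x = Lift (c ⊔ ℓ₁) (x ≈ 0#)
  Zero (suc n) P = All (Zero n) P

  module _ (S : RawRing a ℓ) (ι : Carrier → RawRing.Carrier S) where
    private module S = RawRing S

    eval : ∀ {n} → Poly Carrier n → Vec S.Carrier n → S.Carrier
    eval P []       = ι P
    eval P (v ∷ vs) = foldr (λ Q s → eval Q vs S.+ v S.* s) S.0# P

    IsAlgebraicOver : ∀ {n} → Vec S.Carrier n → S.Carrier → Set (c ⊔ ℓ₂ ⊔ ℓ)
    IsAlgebraicOver {n} vs f =
      ∃ λ P → Nonzero (suc n) P × eval P (f ∷ vs) S.≈ S.0#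

  -- f ∈ ℝ⟦t⟧ has degree d over ℝ(t): it is a root of a polynomial of degree
  -- exactly d, and of no nonzero polynomial of degree less than d.
  -- Denominators of coefficients in ℝ(t) are cleared, so that the
  -- coefficients are taken in ℝ[t].
  HasDegree : ℕ → (ℕ → Carrier) → Set (c ⊔ ℓ₁ ⊔ ℓ₂)
  HasDegree d f =
    (∃ λ (P : Vec (Poly Carrier 1) (suc d)) → Nonzero 1 (last P) × Root (toList P)) ×
    (∀ (P : Vec (Poly Carrier 1) d) → Root (toList P) → Zero 2 (toList P))
    where
    Root : Poly Carrier 2 → Set ℓ₁
    Root P = RawRing._≈_ (series rawRing)
      (eval (series rawRing) (const rawRing) P (f ∷ var rawRing ∷ []))
      (RawRing.0# (series rawRing))

module Walk
  {c ℓ₁ ℓ₂ ℓ₃} (ℝ : RealField c ℓ₁ ℓ₂ ℓ₃)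
  (p q r : RealField.Carrier ℝ)
  (p>0 : RealField._<_ ℝ (RealField.0# ℝ) p)
  (q>0 : RealField._<_ ℝ (RealField.0# ℝ) q)
  (r>0 : RealField._<_ ℝ (RealField.0# ℝ) r)
  where

  private module R = RealField ℝ
  open R using (rawRing; _÷_⟨_⟩; +-pos)
  open Polynomials ℝ

  p+r>0 : R.0# R.< p R.+ r
  p+r>0 = +-pos p>0 r>0

  q+r>0 : R.0# R.< q R.+ r
  q+r>0 = +-pos q>0 r>0

  p′ r′ q″ r″ : R.Carrier
  p′ = p ÷ (p R.+ r) ⟨ p+r>0 ⟩
  r′ = r ÷ (p R.+ r) ⟨ p+r>0 ⟩
  q″ = q ÷ (q R.+ r) ⟨ q+r>0 ⟩
  r″ = r ÷ (q R.+ r) ⟨ q+r>0 ⟩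

  State : Set
  State = ℕ × ℕ

  steps : State → List (R.Carrier × State)
  steps (zero  , zero ) = (R.1# , 1 , 1) ∷ []
  steps (suc i , zero ) = (p′ , i , 0) ∷ (r′ , suc (suc i) , 1) ∷ []
  steps (zero  , suc j) = (q″ , 0 , j) ∷ (r″ , 1 , suc (suc j)) ∷ []
  steps (suc i , suc j) =
    (p , i , suc j) ∷ (q , suc i , j) ∷ (r , suc (suc i) , suc (suc j)) ∷ []

  -- n-step transition probabilities, by conditioning on the first step.
  transition : ℕ → State → State → R.Carrier
  transition zero    s u = if does (≡-dec ℕ._≟_ ℕ._≟_ s u) then R.1# else R.0#
  transition (suc n) s u =
    foldr (λ (w , s′) acc → w R.* transition n s′ u R.+ acc) R.0# (steps s)

  prob : ℕ → ℕ → ℕ → R.Carrier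
  prob n i j = transition n (0 , 0) (i , j)

  -- ℝ⟦t⟧, ℝ⟦x⟧⟦t⟧ and ℝ⟦x⟧⟦y⟧⟦t⟧; the outermost index is the exponent of t,
  -- the innermost one that of x.
  ℝ⟦t⟧ ℝ⟦x,t⟧ ℝ⟦x,y,t⟧ : RawRing c ℓ₁
  ℝ⟦t⟧     = series rawRing
  ℝ⟦x,t⟧   = series (series rawRing)
  ℝ⟦x,y,t⟧ = series (series (series rawRing))

  module T where
    open RingNotation ℝ⟦t⟧ public

    ι : R.Carrier → Carrier
    ι = const rawRing

    t : Carrier
    t = var rawRing

    IsZ : Carrier → Set ℓ₁
    IsZ Z = Z ≈ 1# + 4 · (ι p * ι q * ι r * t ^ 3 * Z ^ 3)

    Δ₋[p/t] : Carrier → Carrier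
    Δ₋[p/t] Z = 1# - ι p * Z * (1# + Z) + ι p ^ 2 * Z ^ 2

    Is√Δ₋[p/t] : Carrier → Carrier → Set ℓ₁
    Is√Δ₋[p/t] Z = IsSqrtWithConstantTerm rawRing (R.1# R.- p) (Δ₋[p/t] Z)

    1-2pZ : Carrier → Carrier
    1-2pZ Z = 1# - 2 · (ι p * Z)

    P₀₀ : Carrier
    P₀₀ n = prob n 0 0

    -- Σ p₀₀(3n) t³ⁿ
    P₀₀-multiplesOf3 : Carrier
    P₀₀-multiplesOf3 = dilate rawRing 3 (λ n → prob (3 ℕ.* n) 0 0)

    -- D⁻¹ stands for the inverse of 1 - 2pZ.
    originFormula : (√Δ₋ D⁻¹ : Carrier) → Carrier
    originFormula √Δ₋ D⁻¹ = ι (r ÷ p ⟨ p>0 ⟩) * (√Δ₋ * D⁻¹ - 1#)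

  module XT where
    open RingNotation ℝ⟦x,t⟧ public

    ι : R.Carrier → Carrier
    ι s = const (series rawRing) (const rawRing s)

    x t : Carrier
    x = const (series rawRing) (var rawRing)
    t = var (series rawRing)

    fromT : T.Carrier → Carrier
    fromT f n = const rawRing (f n)

    atX=0 : Carrier → T.Carrier
    atX=0 f n = f n 0

    -- f(x,t) ↦ f(sx,t)
    rescaleX : R.Carrier → Carrier → Carrier
    rescaleX s f n = rescale rawRing s (f n)

    Δ₊ : T.Carrier → Carrier
    Δ₊ Z = 1# - 4 · (ι p * ι q * ι r * t ^ 2 * fromT Z ^ 2 * x)

    Is√Δ₊ : T.Carrier → Carrier → Set ℓ₁
    Is√Δ₊ Z = IsSqrtWithConstantTerm (series rawRing) (RawRing.1# (series rawRing)) (Δ₊ Z)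

    P₁ : Carrier
    P₁ n zero    = R.0#
    P₁ n (suc i) = prob n (suc i) 0

    Q[px,0] : Carrier
    Q[px,0] = fromT T.P₀₀ + ι r′ * rescaleX p P₁

    axisFactor : Carrier
    axisFactor = t - x * (1# - ι p) + ι p * ι r * x ^ 2 * t ^ 2

    Z[1-2pZ] : T.Carrier → Carrier
    Z[1-2pZ] Z = fromT Z * fromT (T.1-2pZ Z)

    -- E⁻¹ stands for the inverse of Z(1 - 2pZ).
    axisFormula : (Z √Δ₋ : T.Carrier) (√Δ₊ E⁻¹ : Carrier) → Carrier
    axisFormula Z √Δ₋ √Δ₊ E⁻¹ =
      ι (r ÷ (p R.+ p) ⟨ +-pos p>0 p>0 ⟩) *
        ((2 · (t * fromT Z) - x) * fromT √Δ₋ * √Δ₊ * E⁻¹ - 2 · t + x * (1# - ι p))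

  module XYT where
    open RingNotation ℝ⟦x,y,t⟧ public

    ι : R.Carrier → Carrier
    ι s = const (series (series rawRing)) (const (series rawRing) (const rawRing s))

    x y t : Carrier
    x = const (series (series rawRing)) (const (series rawRing) (var rawRing))
    y = const (series (series rawRing)) (var (series rawRing))
    t = var (series (series rawRing))

    fromT : T.Carrier → Carrier
    fromT f n = const (series rawRing) (const rawRing (f n))

    -- f(x,t) ↦ f(x,t) and f(x,t) ↦ f(y,t)
    inX inY : XT.Carrier → Carrier
    inX f n   = const (series rawRing) (f n)
    inY f n j = const rawRing (f n j)

    -- Σ pᵢⱼ(n) xⁱ yʲ tⁿ
    P : Carrier
    P n j i = prob n i j

    IsAlgebraic : Carrier → Set (c ⊔ ℓ₁ ⊔ ℓ₂)
    IsAlgebraic = IsAlgebraicOver ℝ⟦x,y,t⟧ ι (x ∷ y ∷ t ∷ [])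

    -- f is a rational expression, with real coefficients, in x, y, t, Z,
    -- √Δ₋(p/t), √Δ₊(x/p) and √Δ₊(y/q).
    IsExpressibleIn : (Z √Δ₋ : T.Carrier) (√Δ₊ : XT.Carrier) → Carrier → Set (c ⊔ ℓ₁ ⊔ ℓ₂)
    IsExpressibleIn Z √Δ₋ √Δ₊ f =
      ∃ λ (N : Poly R.Carrier 7) → ∃ λ (D : Poly R.Carrier 7) →
        (∃ λ n → ∃ λ j → ∃ λ i → value D n j i R.# R.0#) ×
        value D * f ≈ value N
      where
      value : Poly R.Carrier 7 → Carrier
      value A = eval ℝ⟦x,y,t⟧ ι A
        ( x ∷ y ∷ t ∷ fromT Z ∷ fromT √Δ₋
        ∷ inX (XT.rescaleX (R.1# ÷ p ⟨ p>0 ⟩) √Δ₊)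
        ∷ inY (XT.rescaleX (R.1# ÷ q ⟨ q>0 ⟩) √Δ₊)
        ∷ [])

{-# OPTIONS --safe #-}
module Submission where

-- With K = xy − t (px + py + r x²y²) and F(x) = P₀₀ + r′ P₁(x), the functional equation of the walk is
--   K (rP + p F(x) + p F(y)) = r xy + p x (y − t) F(x) + p y (x − t) F(y).
-- It makes K divide y θ(x) + x θ(y) for θ = 2pα F − ω, and therefore, with h = p P₀₀ + r, also the difference of the
-- values at x and at y of Β(x) = (θ(x)² − h² (4p²t² − 4ptx − 4prt²x³)) / x². A multiple of K in which x and y are
-- separated vanishes, so Β is free of x and θ² is a cubic polynomial in x. As θ vanishes at some x = 2pt + O(t²), this
-- polynomial has a double root, which expresses θ through Z and √Δ₊. At the root x = O(t) of α one has θ² = ω²; this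
-- is an equation for h, that is, for P₀₀.
--
-- For the degree put ζ = 1/Z and Y = p P₀₀ + r, so that Y² (ζ − 2p)² = r² δ(ζ) and ζ² − ζ³ = 4p²r t³. Let f(ζ) and
-- g(ζ) be the even and odd parts in Y of a relation of degree less than 6 over ℝ(t³). Then f² (ζ − 2p)² = r² g² δ(ζ)
-- identically in ζ, and δ(0) < 0 makes f and g vanish at ζ = 0, doubly in fact; as they also vanish at ζ = 1, the
-- coefficients of the relation are divisible by t³. Because P₀₀ is a series in t³, relations over ℝ(t) split into
-- relations over ℝ(t³).

open import Defs
open import Algebra.Apartness.Bundles using (HeytingCommutativeRing)
import Algebra.Apartness.Properties.HeytingCommutativeRing
open import Algebra.Bundles using (RawRing; CommutativeRing)
open import Algebra.Morphism.Construct.Composition using () renaming (isRingHomomorphism to compose)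
open import Algebra.Morphism.Construct.Identity using () renaming (isRingHomomorphism to identity)
open import Algebra.Morphism.Structures using (module RingMorphisms)
open RingMorphisms using (IsRingHomomorphism)
import Algebra.Properties.CommutativeSemigroup
import Algebra.Properties.Ring
import Algebra.Properties.Semiring.Mult.TCOptimised
import Algebra.Solver.Ring
open import Algebra.Solver.Ring.AlmostCommutativeRing using (fromCommutativeRing; _-Raw-AlmostCommutative⟶_)
open import Data.Bool.Base using (T; if_then_else_)
open import Data.Empty using (⊥; ⊥-elim)
open import Data.Fin.Base using (Fin; zero; suc)
open import Data.Fin.Patterns
open import Data.Integer.Base as ℤ using (ℤ; +_; -[1+_])
import Data.Integer.Properties as ℤ
open import Data.List.Base as List using (List; []; _∷_; foldr; length)
open import Data.List.Relation.Unary.All as All using (All; []; _∷_)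
open import Data.List.Relation.Unary.Any using (here; there)
open import Data.Maybe.Base using (just; is-just; map)
open import Data.Nat.Base as ℕ using (ℕ; zero; suc; _∸_; s≤s; z≤n)
import Data.Nat.DivMod as ℕ
import Data.Nat.Divisibility as ℕ
open import Data.Nat.Induction using (<-rec)
import Data.Nat.Properties as ℕ
open import Data.Nat.Solver using (module +-*-Solver)
open import Data.Product using (_×_; _,_; proj₁; proj₂; ∃; ∃!; swap; Σ)
open import Data.Product.Properties using (≡-dec)
open import Data.Sum.Base using (_⊎_; inj₁; inj₂)
open import Data.Vec.Base as Vec using (Vec; []; _∷_; lookup; toList; last)
open import Data.Vec.N-ary using (N-ary; _$ⁿ_)
import Data.Vec.Properties as Vec
open import Data.Vec.Relation.Binary.Pointwise.Inductive as Pointwise using (Pointwise; []; _∷_)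
open import Function.Base using (_∘_; id)
open import Level as Level using (Level; Lift; lift; _⊔_)
open import Relation.Binary.PropositionalEquality as ≡ using (_≡_; _≢_)
import Relation.Binary.Reasoning.Setoid
open import Relation.Binary.Structures using (IsStrictPartialOrder)
open import Relation.Nullary.Decidable using (dec⇒maybe; Dec; yes; no; does)
open import Relation.Nullary.Negation using (¬_; contradiction)

-- The rational function subtracted in Β is 4pt h² J with J(x) = pt/x² - 1/x - rtx. It is an
-- invariant of the kernel, as x² y² (J(x) - J(y)) = (x - y) K, and it cancels the poles of θ²/x²,
-- because θ = h (2pt - x) + O(x²). The square of c = h ζ (2ptZ - x) √(1 - 4prt²Z²x) has the same
-- terms in 1 and x³ as θ²; agreement in x is the equation of Z, and the term in x² predicts the
-- value of Β. No root of θ has to be constructed: θ and c share the part h (2pt - x), so their sum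
-- has a simple root x = 2pt + O(t²), while (θ - c)(θ + c)/x² is free of x. This forces θ = c.
-- Equality of reals is not decidable from the axioms, so whatever must not vanish is exhibited, by
-- a constant term or by a value at a chosen point. For the same reason the degree does not rest on
-- irreducibility: the positivity of (ζ - 2p)² and - δ(ζ) at ζ = 0 takes the place of the fact that
-- δ is not a square.

private variable
  c ℓ c′ ℓ′ : Level

-- Consequences of polynomial hypotheses in a commutative ring

module LinearCombination {c ℓ} (R : CommutativeRing c ℓ) where
  open CommutativeRing R
  open Algebra.Properties.Ring ring
  open Algebra.Properties.Semiring.Mult.TCOptimised semiring
    using (1+×; ×-homo-+; ×1-homo-*) renaming (_×_ to _×′_)
  open Relation.Binary.Reasoning.Setoid setoid

  -- With this variant of the multiple, the value at 1 is `1#` itself and not `1# + 0#`; the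
  -- constants 0 and 1 of the solver thus denote `0#` and `1#` by computation.
  fromℤ : ℤ → Carrier
  fromℤ (+ n)    = n ×′ 1#
  fromℤ -[1+ n ] = - (suc n ×′ 1#)

  private
    cancelSuc : ∀ a b → a - b ≈ (1# + a) - (1# + b)
    cancelSuc a b = begin
      a - b                    ≈⟨ +-congʳ (+-identityˡ a) ⟨
      0# + a - b               ≈⟨ +-congʳ (+-congʳ (-‿inverseʳ 1#)) ⟨
      1# - 1# + a - b          ≈⟨ +-congʳ (+-assoc 1# (- 1#) a) ⟩
      1# + (- 1# + a) - b      ≈⟨ +-congʳ (+-congˡ (+-comm (- 1#) a)) ⟩
      1# + (a - 1#) - b        ≈⟨ +-congʳ (+-assoc 1# a (- 1#)) ⟨
      1# + a - 1# - b          ≈⟨ +-assoc (1# + a) (- 1#) (- b) ⟩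
      1# + a + (- 1# - b)      ≈⟨ +-congˡ (-‿+-comm 1# b) ⟩
      (1# + a) - (1# + b)      ∎

    fromℤ-⊖ : ∀ m n → fromℤ (m ℤ.⊖ n) ≈ m ×′ 1# - n ×′ 1#
    fromℤ-⊖ zero zero = sym (-‿inverseʳ 0#)
    fromℤ-⊖ zero (suc n) = sym (+-identityˡ _)
    fromℤ-⊖ (suc m) zero = sym (trans (+-congˡ -0#≈0#) (+-identityʳ _))
    fromℤ-⊖ (suc m) (suc n) = begin
      fromℤ (suc m ℤ.⊖ suc n)            ≡⟨ ≡.cong fromℤ (ℤ.[1+m]⊖[1+n]≡m⊖n m n) ⟩
      fromℤ (m ℤ.⊖ n)                    ≈⟨ fromℤ-⊖ m n ⟩
      m ×′ 1# - n ×′ 1#                  ≈⟨ cancelSuc _ _ ⟩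
      (1# + m ×′ 1#) - (1# + n ×′ 1#)    ≈⟨ +-cong (1+× m 1#) (-‿cong (1+× n 1#)) ⟨
      suc m ×′ 1# - suc n ×′ 1#          ∎

    fromℤ-neg : ∀ i → fromℤ (ℤ.- i) ≈ - fromℤ i
    fromℤ-neg (+ zero) = sym -0#≈0#
    fromℤ-neg (+ suc n) = refl
    fromℤ-neg -[1+ n ] = sym (-‿involutive _)

    fromℤ-+ : ∀ i j → fromℤ (i ℤ.+ j) ≈ fromℤ i + fromℤ j
    fromℤ-+ (+ m) (+ n) = ×-homo-+ 1# m n
    fromℤ-+ (+ m) -[1+ n ] = fromℤ-⊖ m (suc n)
    fromℤ-+ -[1+ m ] (+ n) = trans (fromℤ-⊖ n (suc m)) (+-comm _ _)
    fromℤ-+ -[1+ m ] -[1+ n ] = begin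
      - (suc (suc (m ℕ.+ n)) ×′ 1#)        ≡⟨ ≡.cong (λ k → - (suc k ×′ 1#)) (≡.sym (ℕ.+-suc m n)) ⟩
      - ((suc m ℕ.+ suc n) ×′ 1#)          ≈⟨ -‿cong (×-homo-+ 1# (suc m) (suc n)) ⟩
      - (suc m ×′ 1# + suc n ×′ 1#)        ≈⟨ -‿+-comm _ _ ⟨
      - (suc m ×′ 1#) - suc n ×′ 1#        ∎

    fromℤ-* : ∀ i j → fromℤ (i ℤ.* j) ≈ fromℤ i * fromℤ j
    fromℤ-* (+ m) (+ n) = trans (reflexive (≡.cong fromℤ (≡.sym (ℤ.pos-* m n)))) (×1-homo-* m n)
    fromℤ-* (+ m) -[1+ n ] = begin
      fromℤ (+ m ℤ.* -[1+ n ])             ≡⟨ ≡.cong fromℤ (ℤ.neg-distribʳ-* (+ m) (+ suc n)) ⟨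
      fromℤ (ℤ.- (+ m ℤ.* + suc n))        ≈⟨ fromℤ-neg (+ m ℤ.* + suc n) ⟩
      - fromℤ (+ m ℤ.* + suc n)            ≈⟨ -‿cong (fromℤ-* (+ m) (+ suc n)) ⟩
      - (m ×′ 1# * suc n ×′ 1#)            ≈⟨ -‿distribʳ-* _ _ ⟩
      m ×′ 1# * - (suc n ×′ 1#)            ∎
    fromℤ-* -[1+ m ] (+ n) = begin
      fromℤ (-[1+ m ] ℤ.* + n)             ≡⟨ ≡.cong fromℤ (ℤ.neg-distribˡ-* (+ suc m) (+ n)) ⟨
      fromℤ (ℤ.- (+ suc m ℤ.* + n))        ≈⟨ fromℤ-neg (+ suc m ℤ.* + n) ⟩
      - fromℤ (+ suc m ℤ.* + n)            ≈⟨ -‿cong (fromℤ-* (+ suc m) (+ n)) ⟩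
      - (suc m ×′ 1# * n ×′ 1#)            ≈⟨ -‿distribˡ-* _ _ ⟩
      - (suc m ×′ 1#) * n ×′ 1#            ∎
    fromℤ-* -[1+ m ] -[1+ n ] = begin
      (suc m ℕ.* suc n) ×′ 1#              ≈⟨ ×1-homo-* (suc m) (suc n) ⟩
      suc m ×′ 1# * suc n ×′ 1#            ≈⟨ -‿involutive _ ⟨
      - - (suc m ×′ 1# * suc n ×′ 1#)      ≈⟨ -‿cong (-‿distribʳ-* _ _) ⟩
      - (suc m ×′ 1# * - (suc n ×′ 1#))    ≈⟨ -‿distribˡ-* _ _ ⟩
      - (suc m ×′ 1#) * - (suc n ×′ 1#)    ∎

    morphism : CommutativeRing.rawRing ℤ.+-*-commutativeRing -Raw-AlmostCommutative⟶ fromCommutativeRing R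
    morphism = record
      { ⟦_⟧ = fromℤ ; +-homo = fromℤ-+ ; *-homo = fromℤ-* ; -‿homo = fromℤ-neg
      ; 0-homo = refl ; 1-homo = refl }

    module Solver = Algebra.Solver.Ring (CommutativeRing.rawRing ℤ.+-*-commutativeRing)
      (fromCommutativeRing R) morphism
      (λ i j → map (λ i≡j → reflexive (≡.cong fromℤ i≡j)) (dec⇒maybe (i ℤ.≟ j)))
    open Solver using (Polynomial; con; _:+_; _:*_; _:-_; :-_; ⟦_⟧; ⟦_⟧N; normalise; correct; _≟N_; ⟦_⟧N-cong)

  -- The polynomials of the solver as a raw ring. Formulas generic in a raw ring can be instantiated
  -- here to state an identity, and their values are by computation the same formulas in `R`.
  Syntax : ℕ → RawRing _ _
  Syntax n = record
    { Carrier = Polynomial n ; _≈_ = _≡_ ; _+_ = _:+_ ; _*_ = _:*_ ; -_ = :-_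
    ; 0# = con (+ 0) ; 1# = con (+ 1) }

  Equation : ℕ → Set
  Equation n = Polynomial n × Polynomial n

  infix 4 _⊢_
  infix 5 _:=_
  infix 6 _×[_]

  _:=_ : ∀ {n} → Polynomial n → Polynomial n → Equation n
  _:=_ = _,_

  _×[_] : ∀ {n} → Polynomial n → Equation n → Polynomial n × Equation n
  _×[_] = _,_

  _⊢_ : ∀ {n} → List (Polynomial n × Equation n) → Equation n → List (Polynomial n × Equation n) × Equation n
  _⊢_ = _,_

  Holds : ∀ {n} → Vec Carrier n → Equation n → Set ℓ
  Holds ρ (e₁ , e₂) = ⟦ e₁ ⟧ ρ ≈ ⟦ e₂ ⟧ ρ

  private
    combination : ∀ {n} → List (Polynomial n × Equation n) → Polynomial n
    combination [] = con (+ 0)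
    combination ((k , e₁ , e₂) ∷ hs) = k :* (e₁ :- e₂) :+ combination hs

    combination≈0 : ∀ {n} (ρ : Vec Carrier n) hs → All (λ h → Holds ρ (proj₂ h)) hs →
                    ⟦ combination hs ⟧ ρ ≈ 0#
    combination≈0 ρ [] [] = refl
    combination≈0 ρ ((k , e₁ , e₂) ∷ hs) (e₁≈e₂ ∷ ps) = begin
      ⟦ k ⟧ ρ * (⟦ e₁ ⟧ ρ - ⟦ e₂ ⟧ ρ) + ⟦ combination hs ⟧ ρ ≈⟨ +-cong (*-congˡ (x≈y⇒x∙y⁻¹≈ε e₁≈e₂)) (combination≈0 ρ hs ps) ⟩
      ⟦ k ⟧ ρ * 0# + 0#                                       ≈⟨ +-identityʳ _ ⟩
      ⟦ k ⟧ ρ * 0#                                            ≈⟨ zeroʳ _ ⟩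
      0#                                                      ∎

    equal : ∀ {n} (e₁ e₂ : Polynomial n) → T (is-just (normalise e₁ ≟N normalise e₂)) →
            ∀ ρ → ⟦ e₁ ⟧ ρ ≈ ⟦ e₂ ⟧ ρ
    equal e₁ e₂ eq ρ with normalise e₁ ≟N normalise e₂
    ... | just e₁≈e₂ = trans (sym (correct e₁ ρ)) (trans (⟦ e₁≈e₂ ⟧N-cong ρ) (correct e₂ ρ))

  -- k ×[ l := r ] is the hypothesis l ≈ r with weight k. The conclusion holds once the difference of its sides equals the
  -- weighted sum of the differences of the hypotheses, which normalisation over ℤ decides.
  infer : ∀ n (f : N-ary n (Polynomial n) (List (Polynomial n × Equation n) × Equation n)) →
          let hs , e₁ , e₂ = f $ⁿ Vec.map Solver.var (Vec.allFin n) in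
          {T (is-just (normalise (e₁ :- e₂) ≟N normalise (combination hs)))} →
          ∀ ρ → All (λ h → Holds ρ (proj₂ h)) hs → Holds ρ (e₁ , e₂)
  infer n f {eq} ρ ps with f $ⁿ Vec.map Solver.var (Vec.allFin n)
  ... | hs , e₁ , e₂ = x∙y⁻¹≈ε⇒x≈y _ _ (trans (equal (e₁ :- e₂) (combination hs) eq ρ) (combination≈0 ρ hs ps))

module _ (A : RawRing c ℓ) (B : RawRing c′ ℓ′) where
  private
    module A = RawRing A
    module B = RawRing B

  ringHomomorphism : {h : A.Carrier → B.Carrier} →
    (∀ {x y} → x A.≈ y → h x B.≈ h y) →
    (∀ x y → h (x A.+ y) B.≈ h x B.+ h y) →
    (∀ x y → h (x A.* y) B.≈ h x B.* h y) →
    (∀ x → h (A.- x) B.≈ B.- h x) →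
    h A.0# B.≈ B.0# → h A.1# B.≈ B.1# → IsRingHomomorphism A B h
  ringHomomorphism cong +-homo *-homo -‿homo 0#-homo 1#-homo = record
    { isSemiringHomomorphism = record
      { isNearSemiringHomomorphism = record
        { +-isMonoidHomomorphism = record
          { isMagmaHomomorphism = record { isRelHomomorphism = record { cong = cong } ; homo = +-homo }
          ; ε-homo = 0#-homo }
        ; *-homo = *-homo }
      ; 1#-homo = 1#-homo }
    ; -‿homo = -‿homo }

-- Formal power series

module SeriesRing (A : CommutativeRing c ℓ) where
  open CommutativeRing A
  open Algebra.Properties.Ring ring using (-0#≈0#)
  open Relation.Binary.Reasoning.Setoid setoid
  private module S = RawRing (series rawRing)

  tail : S.Carrier → S.Carrier
  tail f n = f (suc n)

  private
    interchange : ∀ a b c d → (a + b) + (c + d) ≈ (a + c) + (b + d)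
    interchange = Algebra.Properties.CommutativeSemigroup.interchange +-commutativeSemigroup

  -- `(f S.* g) (suc n)` computes to `f 0 * g (suc n) + (tail f S.* g) n`. The ring laws are
  -- therefore proved one coefficient at a time, by induction on `n` with the first factor
  -- generalised.
  conv-cong : ∀ n {f f′ g g′} → (∀ k → f k ≈ f′ k) → (∀ k → g k ≈ g′ k) → (f S.* g) n ≈ (f′ S.* g′) n
  conv-cong zero p q = +-congʳ (*-cong (p 0) (q 0))
  conv-cong (suc n) p q = +-cong (*-cong (p 0) (q (suc n))) (conv-cong n (p ∘ suc) q)

  conv-zeroˡ : ∀ n {f} g → (∀ k → k ℕ.≤ n → f k ≈ 0#) → (f S.* g) n ≈ 0#
  conv-zeroˡ zero g p = trans (+-identityʳ _) (trans (*-congʳ (p 0 z≤n)) (zeroˡ _))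
  conv-zeroˡ (suc n) g p =
    trans (+-cong (trans (*-congʳ (p 0 z≤n)) (zeroˡ _)) (conv-zeroˡ n g λ k k≤n → p (suc k) (s≤s k≤n)))
          (+-identityˡ 0#)

  conv-distribʳ : ∀ n f g h → ((f S.+ g) S.* h) n ≈ (f S.* h) n + (g S.* h) n
  conv-distribʳ zero f g h = begin
    (f 0 + g 0) * h 0 + 0#                    ≈⟨ +-cong (distribʳ _ _ _) (sym (+-identityʳ 0#)) ⟩
    (f 0 * h 0 + g 0 * h 0) + (0# + 0#)       ≈⟨ interchange _ _ _ _ ⟩
    (f 0 * h 0 + 0#) + (g 0 * h 0 + 0#)       ∎
  conv-distribʳ (suc n) f g h =
    trans (+-cong (distribʳ _ _ _) (conv-distribʳ n (tail f) (tail g) h)) (interchange _ _ _ _)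

  -- The recursion of the product on its second factor; set against the definitional one on the
  -- first factor, it yields commutativity.
  conv-suc : ∀ n f g → (f S.* g) (suc n) ≈ f (suc n) * g 0 + (f S.* tail g) n
  conv-suc zero f g = begin
    f 0 * g 1 + (f 1 * g 0 + 0#)  ≈⟨ +-congˡ (+-identityʳ _) ⟩
    f 0 * g 1 + f 1 * g 0         ≈⟨ +-comm _ _ ⟩
    f 1 * g 0 + f 0 * g 1         ≈⟨ +-congˡ (+-identityʳ _) ⟨
    f 1 * g 0 + (f 0 * g 1 + 0#)  ∎
  conv-suc (suc n) f g = begin
    f 0 * g (suc (suc n)) + (tail f S.* g) (suc n)                            ≈⟨ +-congˡ (conv-suc n (tail f) g) ⟩
    f 0 * g (suc (suc n)) + (f (suc (suc n)) * g 0 + (tail f S.* tail g) n)   ≈⟨ +-assoc _ _ _ ⟨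
    f 0 * g (suc (suc n)) + f (suc (suc n)) * g 0 + (tail f S.* tail g) n     ≈⟨ +-congʳ (+-comm _ _) ⟩
    f (suc (suc n)) * g 0 + f 0 * g (suc (suc n)) + (tail f S.* tail g) n     ≈⟨ +-assoc _ _ _ ⟩
    f (suc (suc n)) * g 0 + (f S.* tail g) (suc n)                            ∎

  conv-comm : ∀ n f g → (f S.* g) n ≈ (g S.* f) n
  conv-comm zero f g = +-congʳ (*-comm _ _)
  conv-comm (suc n) f g =
    trans (+-cong (*-comm _ _) (conv-comm n (tail f) g)) (sym (conv-suc n g f))

  conv-scale : ∀ n a f g → ((λ k → a * f k) S.* g) n ≈ a * (f S.* g) n
  conv-scale zero a f g = trans (+-cong (*-assoc _ _ _) (sym (zeroʳ a))) (sym (distribˡ _ _ _))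
  conv-scale (suc n) a f g = trans (+-cong (*-assoc _ _ _) (conv-scale n a (tail f) g)) (sym (distribˡ _ _ _))

  conv-assoc : ∀ n f g h → ((f S.* g) S.* h) n ≈ (f S.* (g S.* h)) n
  conv-assoc zero f g h = +-congʳ (begin
    (f 0 * g 0 + 0#) * h 0  ≈⟨ *-congʳ (+-identityʳ _) ⟩
    f 0 * g 0 * h 0         ≈⟨ *-assoc _ _ _ ⟩
    f 0 * (g 0 * h 0)       ≈⟨ *-congˡ (+-identityʳ _) ⟨
    f 0 * (g 0 * h 0 + 0#)  ∎)
  conv-assoc (suc n) f g h = begin
    (f 0 * g 0 + 0#) * h (suc n) + (tail (f S.* g) S.* h) n
      ≈⟨ +-cong (trans (*-congʳ (+-identityʳ _)) (*-assoc _ _ _))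
           (conv-distribʳ n (λ k → f 0 * g (suc k)) (tail f S.* g) h) ⟩
    f 0 * (g 0 * h (suc n)) + (((λ k → f 0 * g (suc k)) S.* h) n + ((tail f S.* g) S.* h) n)
      ≈⟨ +-congˡ (+-cong (conv-scale n (f 0) (tail g) h) (conv-assoc n (tail f) g h)) ⟩
    f 0 * (g 0 * h (suc n)) + (f 0 * (tail g S.* h) n + (tail f S.* (g S.* h)) n)
      ≈⟨ +-assoc _ _ _ ⟨
    f 0 * (g 0 * h (suc n)) + f 0 * (tail g S.* h) n + (tail f S.* (g S.* h)) n
      ≈⟨ +-congʳ (distribˡ _ _ _) ⟨
    f 0 * (g S.* h) (suc n) + (tail f S.* (g S.* h)) n ∎

  conv-identityˡ : ∀ n g → (S.1# S.* g) n ≈ g n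
  conv-identityˡ zero g = trans (+-identityʳ _) (*-identityˡ _)
  conv-identityˡ (suc n) g =
    trans (+-cong (*-identityˡ _) (conv-zeroˡ n g λ _ _ → refl)) (+-identityʳ _)

  seriesRing : CommutativeRing c ℓ
  seriesRing = record
    { Carrier = S.Carrier ; _≈_ = S._≈_ ; _+_ = S._+_ ; _*_ = S._*_ ; -_ = S.-_ ; 0# = S.0# ; 1# = S.1#
    ; isCommutativeRing = record
      { isRing = record
        { +-isAbelianGroup = record
          { isGroup = record
            { isMonoid = record
              { isSemigroup = record
                { isMagma = record
                  { isEquivalence = record
                    { refl = λ _ → refl
                    ; sym = λ p n → sym (p n)
                    ; trans = λ p q n → trans (p n) (q n) }
                  ; ∙-cong = λ p q n → +-cong (p n) (q n) }
                ; assoc = λ f g h n → +-assoc (f n) (g n) (h n) }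
              ; identity = (λ f n → +-identityˡ (f n)) , λ f n → +-identityʳ (f n) }
            ; inverse = (λ f n → -‿inverseˡ (f n)) , λ f n → -‿inverseʳ (f n)
            ; ⁻¹-cong = λ p n → -‿cong (p n) }
          ; comm = λ f g n → +-comm (f n) (g n) }
        ; *-cong = λ p q n → conv-cong n p q
        ; *-assoc = λ f g h n → conv-assoc n f g h
        ; *-identity = (λ f n → conv-identityˡ n f) ,
                       λ f n → trans (conv-comm n f S.1#) (conv-identityˡ n f)
        ; distrib = (λ f g h n → trans (conv-comm n f (g S.+ h))
                      (trans (conv-distribʳ n g h f) (+-cong (conv-comm n g f) (conv-comm n h f)))) ,
                    λ f g h n → conv-distribʳ n g h f }
      ; *-comm = λ f g n → conv-comm n f g } }

  const-* : ∀ a f n → (const rawRing a S.* f) n ≈ a * f n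
  const-* a f zero = +-identityʳ _
  const-* a f (suc n) = trans (+-congˡ (conv-zeroˡ n f λ _ _ → refl)) (+-identityʳ _)

  var-*-zero : ∀ f → (var rawRing S.* f) 0 ≈ 0#
  var-*-zero f = trans (+-identityʳ _) (zeroˡ _)

  var-*-suc : ∀ f n → (var rawRing S.* f) (suc n) ≈ f n
  var-*-suc f n = trans (+-congʳ (zeroˡ _)) (trans (+-identityˡ _)
    (trans (conv-cong n {g = f} var-tail (λ _ → refl)) (conv-identityˡ n f)))
    where
    var-tail : ∀ k → tail (var rawRing) k ≈ S.1# k
    var-tail zero = refl
    var-tail (suc _) = refl

  const+var* : ∀ f → f S.≈ const rawRing (f 0) S.+ var rawRing S.* tail f
  const+var* f zero = sym (trans (+-congˡ (var-*-zero (tail f))) (+-identityʳ _))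
  const+var* f (suc n) = sym (trans (+-identityˡ _) (var-*-suc (tail f) n))

  *-zero-coeff : ∀ f g → (f S.* g) 0 ≈ f 0 * g 0
  *-zero-coeff f g = +-identityʳ _

  -- The source of all cancellation of series: where a product vanishes, so does the lowest
  -- coefficient of one factor times the constant term of the other.
  conv-lowest : ∀ n {f} g → (∀ k → k ℕ.< n → f k ≈ 0#) → (f S.* g) n ≈ f n * g 0
  conv-lowest zero {f} g p = *-zero-coeff f g
  conv-lowest (suc n) {f} g p = trans (+-congʳ (trans (*-congʳ (p 0 ℕ.z<s)) (zeroˡ _)))
    (trans (+-identityˡ _) (conv-lowest n g λ k k<n → p (suc k) (s≤s k<n)))

  private module SR = CommutativeRing seriesRing

  constantTerm-homo : IsRingHomomorphism SR.rawRing rawRing (λ f → f 0)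
  constantTerm-homo = ringHomomorphism SR.rawRing rawRing
    (λ p → p 0) (λ _ _ → refl) *-zero-coeff (λ _ → refl) refl refl

  const-homo : IsRingHomomorphism rawRing SR.rawRing (const rawRing)
  const-homo = ringHomomorphism rawRing SR.rawRing
    (λ { p zero → p ; p (suc _) → refl })
    (λ { _ _ zero → refl ; _ _ (suc _) → sym (+-identityʳ 0#) })
    (λ { a b zero → sym (+-identityʳ _)
       ; a b (suc n) → sym (trans (const-* a (const rawRing b) (suc n)) (zeroʳ a)) })
    (λ { _ zero → refl ; _ (suc _) → sym -0#≈0# })
    (λ { zero → refl ; (suc _) → refl })
    (λ { zero → refl ; (suc _) → refl })

  rescale-homo : ∀ a → IsRingHomomorphism SR.rawRing SR.rawRing (rescale rawRing a)
  rescale-homo a = ringHomomorphism SR.rawRing SR.rawRing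
    (λ p n → *-congˡ (p n)) (λ f g n → distribˡ _ (f n) (g n)) (λ f g n → mult n f g)
    (λ f n → sym (Algebra.Properties.Ring.-‿distribʳ-* ring _ (f n)))
    (λ n → zeroʳ _) (λ { zero → *-identityˡ 1# ; (suc n) → zeroʳ _ })
    where
    mult : ∀ n f g → rescale rawRing a (f S.* g) n ≈ (rescale rawRing a f S.* rescale rawRing a g) n
    mult zero f g = trans (*-identityˡ _) (+-congʳ (sym (*-cong (*-identityˡ _) (*-identityˡ _))))
    mult (suc n) f g = begin
      a * aⁿ * (f 0 * g (suc n) + (tail f S.* g) n)
        ≈⟨ distribˡ _ _ _ ⟩
      a * aⁿ * (f 0 * g (suc n)) + a * aⁿ * (tail f S.* g) n
        ≈⟨ +-cong (move (a * aⁿ) (f 0) (g (suc n))) (trans (*-assoc a aⁿ _) (*-congˡ (mult n (tail f) g))) ⟩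
      1# * f 0 * (a * aⁿ * g (suc n)) + a * (rescale rawRing a (tail f) S.* rescale rawRing a g) n
        ≈⟨ +-congˡ (conv-scale n a (rescale rawRing a (tail f)) (rescale rawRing a g)) ⟨
      1# * f 0 * (a * aⁿ * g (suc n)) + ((λ k → a * rescale rawRing a (tail f) k) S.* rescale rawRing a g) n
        ≈⟨ +-congˡ (conv-cong n {g = rescale rawRing a g} (λ k → sym (*-assoc a (a ^ k) (f (suc k)))) (λ _ → refl)) ⟩
      1# * f 0 * (a * aⁿ * g (suc n)) + (tail (rescale rawRing a f) S.* rescale rawRing a g) n ∎
      where
      open RingNotation rawRing using (_^_)
      aⁿ = a ^ n
      move : ∀ x y z → x * (y * z) ≈ 1# * y * (x * z)
      move x y z = trans (sym (*-assoc x y z)) (trans (*-congʳ (trans (*-comm x y)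
        (*-congʳ (sym (*-identityˡ y))))) (*-assoc (1# * y) x z))

module RingLemmas {c ℓ} (R : CommutativeRing c ℓ) where
  open LinearCombination R
  module _ {n : ℕ} where
    open RingNotation (Syntax n) public

  unit-cancel = infer 3 λ a u b → (- b) ×[ a * u := 1# ] ∷ u ×[ b * a := 0# ] ∷ [] ⊢ b := 0#

  inverse-identity = infer 6 λ f g f₀ u x f′ →
    g ×[ f := f₀ + x * f′ ] ∷ f₀ ×[ g := u + x * (0# + g * (- (u * f′) + g * 0#)) ] ∷
    (1# - x * (f′ * g)) ×[ f₀ * u := 1# ] ∷ []
    ⊢ f * g := 1#

  sqrt-identity = infer 8 λ f s x f′ Δ Δ₀ Δ′ v →
    (f + s + x * f′) ×[ f := s + x * f′ ] ∷ 1# ×[ s * s := Δ₀ ] ∷ (- 1#) ×[ Δ := Δ₀ + x * Δ′ ] ∷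
    x * (s + s) ×[ f′ := v * Δ′ + x * (0# + f′ * (0# + f′ * (- v + f′ * 0#))) ] ∷ x * (Δ′ - x * (f′ * f′)) ×[ (s + s) * v := 1# ] ∷ []
    ⊢ f * f := Δ

  unit-cancel-both = infer 4 λ a u b c → (c - b) ×[ a * u := 1# ] ∷ u ×[ a * b := a * c ] ∷ [] ⊢ b := c

  cancel-inverse = infer 5 λ a b aⁿ bⁿ f →
    bⁿ * (aⁿ * f) ×[ a * b := 1# ] ∷ [] ⊢ b * bⁿ * (a * aⁿ * f) := bⁿ * (aⁿ * f)

  add-horner = infer 7 λ a+b P+Q a b v P Q →
    1# ×[ a+b := a + b ] ∷ v ×[ P+Q := P + Q ] ∷ [] ⊢ a+b + v * P+Q := (a + v * P) + (b + v * Q)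

  scale-horner = infer 6 λ ab aQ a b v Q →
    1# ×[ ab := a * b ] ∷ v ×[ aQ := a * Q ] ∷ [] ⊢ ab + v * aQ := a * (b + v * Q)

  sum-linear = infer 7 λ Σ v w a b F G →
    1# ×[ Σ := w * F + G ] ∷ [] ⊢ v * (w * a + b) + Σ := w * (v * a + F) + (v * b + G)

  quotient-unique = infer 7 λ a b x x′ y y′ u →
    u ×[ a * y := x ] ∷ (- u) ×[ b * y′ := x′ ] ∷ u ×[ x := x′ ] ∷ (- (b * u)) ×[ y := y′ ] ∷ (b - a) ×[ y * u := 1# ] ∷ []
    ⊢ a := b

  swap-first-two = infer 6 λ a b c a′ b′ c′ →
    1# ×[ a := a′ ] ∷ 1# ×[ b := b′ ] ∷ 1# ×[ c := c′ ] ∷ [] ⊢ a + (b + (c + 0#)) := b′ + (a′ + (c′ + 0#))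

  difference-of-squares = infer 3 λ f g Δ →
    1# ×[ f * f := Δ ] ∷ (- 1#) ×[ g * g := Δ ] ∷ [] ⊢ (f - g) * (f + g) := 0#

module MapSeries (A : CommutativeRing c ℓ) (B : CommutativeRing c′ ℓ′) where
  private
    module A = CommutativeRing A
    module B = CommutativeRing B
    SA = series A.rawRing
    SB = series B.rawRing

  module _ {h : A.Carrier → B.Carrier} (h-homo : IsRingHomomorphism A.rawRing B.rawRing h) where
    open IsRingHomomorphism h-homo

    map-homo : IsRingHomomorphism SA SB (λ f n → h (f n))
    map-homo = ringHomomorphism SA SB
      (λ p n → ⟦⟧-cong (p n)) (λ f g n → +-homo (f n) (g n)) (λ f g n → mult n f g)
      (λ f n → -‿homo (f n)) (λ n → 0#-homo) (λ { zero → 1#-homo ; (suc _) → 0#-homo })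
      where
      mult : ∀ n f g → h (RawRing._*_ SA f g n) B.≈ RawRing._*_ SB (h ∘ f) (h ∘ g) n
      mult zero f g = B.trans (+-homo _ _) (B.+-cong (*-homo _ _) 0#-homo)
      mult (suc n) f g = B.trans (+-homo _ _) (B.+-cong (*-homo _ _) (mult n (f ∘ suc) g))

    map-const : ∀ a n → h (const A.rawRing a n) B.≈ const B.rawRing (h a) n
    map-const a zero = B.refl
    map-const a (suc n) = 0#-homo

    map-var : ∀ n → h (var A.rawRing n) B.≈ var B.rawRing n
    map-var zero = 0#-homo
    map-var (suc zero) = 1#-homo
    map-var (suc (suc n)) = 0#-homo

module SeriesEquations (A : CommutativeRing c ℓ) where
  open CommutativeRing A
  open SeriesRing A
  open Algebra.Properties.Ring ring
  private
    module S where
      open CommutativeRing seriesRing public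
    X = var rawRing
    C = const rawRing

  Agree : ℕ → S.Carrier → S.Carrier → Set ℓ
  Agree n f g = ∀ k → k ℕ.< n → f k ≈ g k

  conv-agree : ∀ n {f f′ g g′} → Agree (suc n) f f′ → Agree (suc n) g g′ → Agree (suc n) (f S.* g) (f′ S.* g′)
  conv-agree n p q k k<n = go k (λ j j≤k → p j (s≤s (ℕ.≤-trans j≤k (ℕ.≤-pred k<n)))) (λ j j≤k → q j (s≤s (ℕ.≤-trans j≤k (ℕ.≤-pred k<n))))
    where
    go : ∀ n {f f′ g g′} → (∀ k → k ℕ.≤ n → f k ≈ f′ k) → (∀ k → k ℕ.≤ n → g k ≈ g′ k) →
         (f S.* g) n ≈ (f′ S.* g′) n
    go zero p q = +-congʳ (*-cong (p 0 z≤n) (q 0 z≤n))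
    go (suc n) p q = +-cong (*-cong (p 0 z≤n) (q (suc n) ℕ.≤-refl))
      (go n (λ k k≤n → p (suc k) (s≤s k≤n)) (λ k k≤n → q k (ℕ.m≤n⇒m≤1+n k≤n)))

  horner : List S.Carrier → S.Carrier → S.Carrier
  horner [] f = S.0#
  horner (a ∷ as) f = a S.+ f S.* horner as f

  horner-agree : ∀ as n {f g} → Agree (suc n) f g → Agree (suc n) (horner as f) (horner as g)
  horner-agree [] n p k k≤n = refl
  horner-agree (a ∷ as) n {f} {g} p k k≤n =
    +-congˡ (conv-agree n {f} {g} p (horner-agree as n p) k k≤n)

  -- f = a + X Ψ(f) determines the coefficients of f one after the other.
  module Fixpoint (a : S.Carrier) (Ψ : List S.Carrier) where
    private
      Φ : S.Carrier → S.Carrier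
      Φ f = a S.+ X S.* horner Ψ f

      contractive : ∀ n {f g} → Agree n f g → Φ f n ≈ Φ g n
      contractive zero {f} {g} p = +-congˡ (trans (var-*-zero (horner Ψ f)) (sym (var-*-zero (horner Ψ g))))
      contractive (suc n) {f} {g} p = +-congˡ
        (trans (var-*-suc (horner Ψ f) n) (trans (horner-agree Ψ n p n ℕ.≤-refl) (sym (var-*-suc (horner Ψ g) n))))

      iterate : ℕ → S.Carrier
      iterate zero = S.0#
      iterate (suc n) = Φ (iterate n)

      stable : ∀ m m′ k → k ℕ.< m → k ℕ.< m′ → iterate m k ≈ iterate m′ k
      stable (suc m) (suc m′) k k<m k<m′ = contractive k λ j j<k →
        stable m m′ j (ℕ.<-≤-trans j<k (ℕ.≤-pred k<m)) (ℕ.<-≤-trans j<k (ℕ.≤-pred k<m′))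

    -- Coefficient `n` no longer changes from the iterate `suc n` on, so the diagonal is the limit.
    fix : S.Carrier
    fix n = iterate (suc n) n

    fix-unfold : fix S.≈ Φ fix
    fix-unfold n = contractive n {iterate n} {fix} λ k k<n → stable n (suc k) k k<n ℕ.≤-refl

    fix-unique : ∀ {f g} → f S.≈ Φ f → g S.≈ Φ g → f S.≈ g
    fix-unique {f} {g} f≈ g≈ n = agree (suc n) n ℕ.≤-refl
      where
      agree : ∀ n → Agree n f g
      agree (suc n) k k<1+n = trans (f≈ k)
        (trans (contractive k {f} {g} λ j j<k → agree n j (ℕ.<-≤-trans j<k (ℕ.≤-pred k<1+n))) (sym (g≈ k)))

  module Inverse (f : S.Carrier) {u} (u-inverse : f 0 * u ≈ 1#) where
    -- The inverse g satisfies g = u - X (u · tail f) g.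
    open Fixpoint (C u) (S.0# ∷ S.- (C u S.* tail f) ∷ [])

    inverse : S.Carrier
    inverse = fix

    *-inverse : f S.* inverse S.≈ S.1#
    *-inverse = RingLemmas.inverse-identity seriesRing
      (f ∷ inverse ∷ C (f 0) ∷ C u ∷ X ∷ tail f ∷ [])
      (const+var* f ∷ fix-unfold ∷ S.trans (S.sym (*-homo (f 0) u)) (S.trans (⟦⟧-cong u-inverse) 1#-homo) ∷ [])
      where
      open IsRingHomomorphism const-homo

  -- Regularity replaces being nonzero: by `*-cancel-zero` it lifts from a constant term to a series
  -- without any decision about coefficients.
  Cancellable : Carrier → Set _
  Cancellable a = ∀ b → b * a ≈ 0# → b ≈ 0#

  unit⇒cancellable : ∀ {a u} → a * u ≈ 1# → Cancellable a
  unit⇒cancellable {a} {u} au≈1 b ba≈0 = RingLemmas.unit-cancel A (a ∷ u ∷ b ∷ []) (au≈1 ∷ ba≈0 ∷ [])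

  *-cancel-zero : ∀ {f g} → Cancellable (g 0) → f S.* g S.≈ S.0# → f S.≈ S.0#
  *-cancel-zero {f} {g} g₀ fg≈0 n = vanish (suc n) n ℕ.≤-refl
    where
    vanish : ∀ n k → k ℕ.< n → f k ≈ 0#
    vanish (suc n) k k<1+n = g₀ (f k) (trans
      (sym (conv-lowest k g λ j j<k → vanish n j (ℕ.<-≤-trans j<k (ℕ.≤-pred k<1+n)))) (fg≈0 k))

  module SquareRoot (Δ : S.Carrier) {s v} (s² : s * s ≈ Δ 0) (v-inverse : (s + s) * v ≈ 1#) where
    -- For a root s + X g the equation (s + X g)² = Δ reads 2sg + X g² = tail Δ, that is g = v ·
    -- tail Δ - X v g².
    open Fixpoint (C v S.* tail Δ) (S.0# ∷ S.0# ∷ S.- C v ∷ [])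

    sqrt : S.Carrier
    sqrt zero = s
    sqrt (suc n) = fix n

    sqrt-isSqrt : IsSqrtWithConstantTerm rawRing s Δ sqrt
    sqrt-isSqrt = RingLemmas.sqrt-identity seriesRing
      (sqrt ∷ C s ∷ X ∷ fix ∷ Δ ∷ C (Δ 0) ∷ tail Δ ∷ C v ∷ [])
      (const+var* sqrt ∷ S.trans (S.sym (*-homo s s)) (⟦⟧-cong s²) ∷ const+var* Δ ∷ fix-unfold ∷
       S.trans (S.*-congʳ {C v} (S.sym (+-homo s s))) (S.trans (S.sym (*-homo (s + s) v)) (S.trans (⟦⟧-cong v-inverse) 1#-homo)) ∷ [])
      , refl
      where
      open IsRingHomomorphism const-homo

  -- From f² = g² = Δ one gets (f - g)(f + g) = 0, and f + g has the invertible constant term 2s;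
  -- the constant term thus fixes the sign.
  sqrt-unique : ∀ {Δ s v f g} → (s + s) * v ≈ 1# →
    IsSqrtWithConstantTerm rawRing s Δ f → IsSqrtWithConstantTerm rawRing s Δ g → f S.≈ g
  sqrt-unique {Δ} {s} {v} {f} {g} v-inverse (f² , f₀) (g² , g₀) n = x∙y⁻¹≈ε⇒x≈y (f n) (g n)
    (*-cancel-zero {f S.- g} {f S.+ g} (unit⇒cancellable {u = v} (trans (*-congʳ (+-cong f₀ g₀)) v-inverse))
      (RingLemmas.difference-of-squares seriesRing (f ∷ g ∷ Δ ∷ []) (f² ∷ g² ∷ [])) n)

  sqrt-exists-unique : ∀ Δ {s v} → s * s ≈ Δ 0 → (s + s) * v ≈ 1# →
    ∃! S._≈_ (IsSqrtWithConstantTerm rawRing s Δ)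
  sqrt-exists-unique Δ s² v-inverse = sqrt , sqrt-isSqrt , sqrt-unique v-inverse sqrt-isSqrt
    where open SquareRoot Δ s² v-inverse

-- Signs and apartness of real numbers

module RealFacts {c ℓ₁ ℓ₂ ℓ₃} (ℝ : RealField c ℓ₁ ℓ₂ ℓ₃) where
  private
    module R = RealField ℝ
  realRing : CommutativeRing c ℓ₁
  realRing = HeytingCommutativeRing.commutativeRing R.heytingCommutativeRing

  open CommutativeRing realRing
  open Algebra.Properties.Ring ring
  open RealField ℝ using (_<_; _#_; <⇒#; #⇒<⊎>; +-monoʳ-<; *-pos; +-pos; _÷_⟨_⟩; #-sym; tight; #-cotrans; #⇒invertible)
  open Algebra.Apartness.Properties.HeytingCommutativeRing R.heytingCommutativeRing
  open SeriesEquations realRing using (Cancellable; unit⇒cancellable)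
  private module < = IsStrictPartialOrder R.isStrictPartialOrder

  -- Apartness is tight, so an equation may be proved by refuting apartness; this recovers the case
  -- distinction on x = 0 when the goal is an equation.
  stable : ∀ {x y} → ¬ (x # y) → x ≈ y
  stable {x} {y} = proj₁ (tight x y)

  >0-resp : ∀ {x y} → x ≈ y → 0# < x → 0# < y
  >0-resp = <.<-respʳ-≈

  >0⇒# : ∀ {x} → 0# < x → x # 0#
  >0⇒# x>0 = #-sym (<⇒# x>0)

  #⇒unit : ∀ {x} → x # 0# → ∃ λ u → x * u ≈ 1#
  #⇒unit {x} x#0 = let u , _ , xu = #⇒invertible x#0 in u , trans (*-congʳ (sym (x-0≈x x))) xu

  unit⇒# : ∀ {x u} → x * u ≈ 1# → x # 0#
  unit⇒# {x} {u} xu≈1 = invertibleʳ⇒# (u , trans (*-congʳ (x-0≈x x)) xu≈1)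

  #⇒cancellable : ∀ {x} → x # 0# → Cancellable x
  #⇒cancellable x#0 = unit⇒cancellable (proj₂ (#⇒unit x#0))

  ÷-*-cancel : ∀ x {y} (y>0 : 0# < y) → (x ÷ y ⟨ y>0 ⟩) * y ≈ x
  ÷-*-cancel x {y} y>0 = trans (*-assoc x _ y)
    (trans (*-congˡ (trans (*-congˡ (sym (x-0≈x y))) (proj₁ (proj₂ (#⇒invertible (>0⇒# y>0))))))
      (*-identityʳ x))

  *-#-left : ∀ {x y} → x * y # 0# → x # 0#
  *-#-left {x} {y} xy#0 = let u , xyu = #⇒unit xy#0 in unit⇒# (trans (sym (*-assoc x y u)) xyu)

  *-#-right : ∀ {x y} → x * y # 0# → y # 0#
  *-#-right {x} {y} xy#0 = *-#-left (#-congʳ (*-comm x y) xy#0)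

  -- Cotransitivity applied to x + y, y and 0. A definite summand is selected, because `Nonzero`
  -- asks for a definite coefficient.
  +-#-split : ∀ {x y} → x + y # 0# → x # 0# ⊎ y # 0#
  +-#-split {x} {y} x+y#0 with #-cotrans x+y#0 y
  ... | inj₂ y#0 = inj₂ y#0
  ... | inj₁ x+y#y = let u , _ , p = #⇒invertible x+y#y in
    inj₁ (unit⇒# (trans (*-congʳ (sym (trans (+-assoc x y (- y)) (trans (+-congˡ (-‿inverseʳ y)) (+-identityʳ x))))) p))

  private
    neg-pos : ∀ {x} → x < 0# → 0# < - x
    neg-pos {x} x<0 = <.<-respʳ-≈ (+-identityʳ (- x)) (<.<-respˡ-≈ (-‿inverseˡ x) (+-monoʳ-< (- x) x<0))

  square-pos : ∀ {x} → x # 0# → 0# < x * x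
  square-pos {x} x#0 with #⇒<⊎> x#0
  ... | inj₂ 0<x = *-pos 0<x 0<x
  ... | inj₁ x<0 = <.<-respʳ-≈
    (trans (sym (-‿distribˡ-* x (- x))) (trans (-‿cong (sym (-‿distribʳ-* x x))) (-‿involutive (x * x))))
    (*-pos (neg-pos x<0) (neg-pos x<0))

  -- `+-pos` needs both summands positive. Hence y = 0 is derived under the assumption that x is
  -- apart from 0, which leaves a single positive summand to refute that assumption.
  positive-form : ∀ {a b} x y → 0# < a → 0# < b → x * x * a + y * y * b ≈ 0# → x ≈ 0# × y ≈ 0#
  positive-form {a} {b} x y a>0 b>0 form≈0 = x≈0 , y≈0
    where
    y≈0-if : x # 0# → y ≈ 0#
    y≈0-if x#0 = stable λ y#0 → <.irrefl (sym form≈0) (+-pos (*-pos (square-pos x#0) a>0) (*-pos (square-pos y#0) b>0))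

    x≈0 : x ≈ 0#
    x≈0 = stable λ x#0 → <.irrefl
      (trans (sym form≈0) (trans (+-congˡ (trans (*-congʳ (trans (*-congʳ (y≈0-if x#0)) (zeroˡ y))) (zeroˡ b))) (+-identityʳ _)))
      (*-pos (square-pos x#0) a>0)

    y≈0 : y ≈ 0#
    y≈0 = stable λ y#0 → <.irrefl
      (trans (sym form≈0) (trans (+-congʳ (trans (*-congʳ (trans (*-congʳ x≈0) (zeroˡ x))) (zeroˡ a))) (+-identityˡ _)))
      (*-pos (square-pos y#0) b>0)

-- Polynomial expressions and polynomials in several variables

infix 8 ⊝_
infixl 7 _⊗_
infixl 6 _⊕_

-- With constants from ⊥ an expression makes sense in every ring and commutes with all
-- homomorphisms; with real constants it can be turned into a `Poly`.
data Expr {c} (C : Set c) (n : ℕ) : Set c where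
  κ        : C → Expr C n
  ν        : Fin n → Expr C n
  _⊕_ _⊗_  : Expr C n → Expr C n → Expr C n
  ⊝_       : Expr C n → Expr C n
  𝟘 𝟙      : Expr C n

exprRing : ∀ {c} (C : Set c) → ℕ → RawRing c c
exprRing C n = record
  { Carrier = Expr C n ; _≈_ = λ e e′ → Lift _ ⊥ ; _+_ = _⊕_ ; _*_ = _⊗_ ; -_ = ⊝_ ; 0# = 𝟘 ; 1# = 𝟙 }

module Evaluation {C : Set c′} (S : RawRing c ℓ) (ι : C → RawRing.Carrier S) where
  open RawRing S

  ⟦_⟧ : ∀ {n} → Expr C n → Vec Carrier n → Carrier
  ⟦ κ a ⟧ ρ = ι a
  ⟦ ν i ⟧ ρ = lookup ρ i
  ⟦ e ⊕ f ⟧ ρ = ⟦ e ⟧ ρ + ⟦ f ⟧ ρ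
  ⟦ e ⊗ f ⟧ ρ = ⟦ e ⟧ ρ * ⟦ f ⟧ ρ
  ⟦ ⊝ e ⟧ ρ = - ⟦ e ⟧ ρ
  ⟦ 𝟘 ⟧ ρ = 0#
  ⟦ 𝟙 ⟧ ρ = 1#

module PolynomialArithmetic {c ℓ₁ ℓ₂ ℓ₃} (ℝ : RealField c ℓ₁ ℓ₂ ℓ₃) where
  open RealFacts ℝ
  open RealField ℝ using (_#_)
  open Polynomials ℝ
  private
    module R = CommutativeRing realRing
    C = R.Carrier

  constP : ∀ n → C → Poly C n
  constP zero a = a
  constP (suc n) a = constP n a ∷ []

  varP : ∀ {n} → Fin n → Poly C n
  varP {suc n} zero = constP n R.0# ∷ constP n R.1# ∷ []
  varP {suc n} (suc i) = varP i ∷ []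

  addP : ∀ n → Poly C n → Poly C n → Poly C n
  addP zero a b = a R.+ b
  addP (suc n) [] Q = Q
  addP (suc n) (a ∷ P) [] = a ∷ P
  addP (suc n) (a ∷ P) (b ∷ Q) = addP n a b ∷ addP (suc n) P Q

  negP : ∀ n → Poly C n → Poly C n
  negP zero a = R.- a
  negP (suc n) P = List.map (negP n) P

  mulP : ∀ n → Poly C n → Poly C n → Poly C n
  mulP zero a b = a R.* b
  mulP (suc n) [] Q = []
  mulP (suc n) (a ∷ P) Q = addP (suc n) (List.map (mulP n a) Q) (constP n R.0# ∷ mulP (suc n) P Q)

  polyRing : ℕ → RawRing c c
  polyRing n = record
    { Carrier = Poly C n ; _≈_ = _≡_ ; _+_ = addP n ; _*_ = mulP n ; -_ = negP n
    ; 0# = constP n R.0# ; 1# = constP n R.1# }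

  substitute : ∀ {m n} → Expr C m → Vec (Poly C n) m → Poly C n
  substitute {n = n} = Evaluation.⟦_⟧ (polyRing n) (constP n)

  toPoly : ∀ {n} → Expr C n → Poly C n
  toPoly e = substitute e (Vec.tabulate varP)

  module _ (S : CommutativeRing c′ ℓ) {ι : C → CommutativeRing.Carrier S}
           (ι-homo : IsRingHomomorphism R.rawRing (CommutativeRing.rawRing S) ι) where
    open CommutativeRing S
    open IsRingHomomorphism ι-homo hiding (⟦⟧-cong)
    open Evaluation rawRing ι
    open Algebra.Properties.Ring ring using (-0#≈0#; -‿+-comm; -‿distribʳ-*)
    private
      ev : ∀ n → Poly C n → Vec Carrier n → Carrier
      ev n P = eval rawRing ι {n} P

    eval-const : ∀ n a (ρ : Vec Carrier n) → ev n (constP n a) ρ ≈ ι a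
    eval-const zero a [] = refl
    eval-const (suc n) a (v ∷ ρ) = trans (+-cong (eval-const n a ρ) (zeroʳ v)) (+-identityʳ _)

    eval-0 : ∀ n (ρ : Vec Carrier n) → ev n (constP n R.0#) ρ ≈ 0#
    eval-0 n ρ = trans (eval-const n R.0# ρ) 0#-homo

    eval-var : ∀ {n} i (ρ : Vec Carrier n) → ev n (varP i) ρ ≈ lookup ρ i
    eval-var {suc n} zero (v ∷ ρ) = trans (+-cong (eval-0 n ρ)
      (*-congˡ (trans (+-cong (trans (eval-const n R.1# ρ) 1#-homo) (zeroʳ v)) (+-identityʳ _))))
      (trans (+-identityˡ _) (*-identityʳ v))
    eval-var {suc n} (suc i) (v ∷ ρ) = trans (+-cong (eval-var i ρ) (zeroʳ v)) (+-identityʳ _)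

    eval-add : ∀ n P Q (ρ : Vec Carrier n) → ev n (addP n P Q) ρ ≈ ev n P ρ + ev n Q ρ
    eval-add zero a b [] = +-homo a b
    eval-add (suc n) [] Q (v ∷ ρ) = sym (+-identityˡ _)
    eval-add (suc n) (a ∷ P) [] (v ∷ ρ) = sym (+-identityʳ _)
    eval-add (suc n) (a ∷ P) (b ∷ Q) (v ∷ ρ) = add-horner
      (_ ∷ _ ∷ ev n a ρ ∷ ev n b ρ ∷ v ∷ ev (suc n) P (v ∷ ρ) ∷ ev (suc n) Q (v ∷ ρ) ∷ [])
      (eval-add n a b ρ ∷ eval-add (suc n) P Q (v ∷ ρ) ∷ [])
      where
      open RingLemmas S using (add-horner)

    eval-neg : ∀ n P (ρ : Vec Carrier n) → ev n (negP n P) ρ ≈ - ev n P ρ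
    eval-neg zero a [] = -‿homo a
    eval-neg (suc n) [] (v ∷ ρ) = sym -0#≈0#
    eval-neg (suc n) (a ∷ P) (v ∷ ρ) = trans (+-cong (eval-neg n a ρ)
      (trans (*-congˡ (eval-neg (suc n) P (v ∷ ρ))) (sym (-‿distribʳ-* v _)))) (-‿+-comm _ _)

    mutual
      eval-scale : ∀ n a Q v (ρ : Vec Carrier n) →
        ev (suc n) (List.map (mulP n a) Q) (v ∷ ρ) ≈ ev n a ρ * ev (suc n) Q (v ∷ ρ)
      eval-scale n a [] v ρ = sym (zeroʳ _)
      eval-scale n a (b ∷ Q) v ρ = scale-horner
        (_ ∷ _ ∷ ev n a ρ ∷ ev n b ρ ∷ v ∷ ev (suc n) Q (v ∷ ρ) ∷ [])
        (eval-mul n a b ρ ∷ eval-scale n a Q v ρ ∷ [])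
        where open RingLemmas S using (scale-horner)

      eval-mul : ∀ n P Q (ρ : Vec Carrier n) → ev n (mulP n P Q) ρ ≈ ev n P ρ * ev n Q ρ
      eval-mul zero a b [] = *-homo a b
      eval-mul (suc n) [] Q (v ∷ ρ) = sym (zeroˡ _)
      eval-mul (suc n) (a ∷ P) Q (v ∷ ρ) = trans
        (eval-add (suc n) (List.map (mulP n a) Q) (constP n R.0# ∷ mulP (suc n) P Q) (v ∷ ρ))
        (trans (+-cong (eval-scale n a Q v ρ)
          (trans (+-cong (eval-0 n ρ) (*-congˡ (eval-mul (suc n) P Q (v ∷ ρ))))
            (trans (+-identityˡ _) (sym (*-assoc v _ _)))))
          (sym (distribʳ _ _ _)))

    eval-substitute : ∀ {m n} (e : Expr C m) (Ps : Vec (Poly C n) m) ρ →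
      ev n (substitute e Ps) ρ ≈ ⟦ e ⟧ (Vec.map (λ P → ev n P ρ) Ps)
    eval-substitute {n = n} (κ a) Ps ρ = eval-const n a ρ
    eval-substitute {n = n} (ν i) Ps ρ = reflexive (≡.sym (Vec.lookup-map i (λ P → ev n P ρ) Ps))
    eval-substitute {n = n} (e ⊕ f) Ps ρ = trans (eval-add n (substitute e Ps) (substitute f Ps) ρ)
      (+-cong (eval-substitute e Ps ρ) (eval-substitute f Ps ρ))
    eval-substitute {n = n} (e ⊗ f) Ps ρ = trans (eval-mul n (substitute e Ps) (substitute f Ps) ρ)
      (*-cong (eval-substitute e Ps ρ) (eval-substitute f Ps ρ))
    eval-substitute {n = n} (⊝ e) Ps ρ = trans (eval-neg n (substitute e Ps) ρ) (-‿cong (eval-substitute e Ps ρ))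
    eval-substitute {n = n} 𝟘 Ps ρ = eval-0 n ρ
    eval-substitute {n = n} 𝟙 Ps ρ = trans (eval-const n R.1# ρ) 1#-homo

    expr-cong : ∀ {m} (e : Expr C m) {ρ ρ′ : Vec Carrier m} → (∀ i → lookup ρ i ≈ lookup ρ′ i) → ⟦ e ⟧ ρ ≈ ⟦ e ⟧ ρ′
    expr-cong (κ a) ρ≈ = refl
    expr-cong (ν i) ρ≈ = ρ≈ i
    expr-cong (e ⊕ f) ρ≈ = +-cong (expr-cong e ρ≈) (expr-cong f ρ≈)
    expr-cong (e ⊗ f) ρ≈ = *-cong (expr-cong e ρ≈) (expr-cong f ρ≈)
    expr-cong (⊝ e) ρ≈ = -‿cong (expr-cong e ρ≈)
    expr-cong 𝟘 ρ≈ = refl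
    expr-cong 𝟙 ρ≈ = refl

    eval-toPoly : ∀ {n} (e : Expr C n) ρ → ev n (toPoly e) ρ ≈ ⟦ e ⟧ ρ
    eval-toPoly {n} e ρ = trans (eval-substitute e (Vec.tabulate varP) ρ) (expr-cong e λ i →
      trans (reflexive (≡.trans (Vec.lookup-map i (λ P → ev n P ρ) (Vec.tabulate varP))
        (≡.cong (λ P → ev n P ρ) (Vec.lookup∘tabulate varP i)))) (eval-var i ρ))

  -- The value is prescribed in every commutative ring over ℝ, because the same polynomial is
  -- evaluated among the series, where it has to vanish, and at a real point, where it must not.
  Represents : ∀ {n} → Expr C n → Poly C n → Set _
  Represents {n} e P = (S : CommutativeRing c ℓ₁) {ι : C → CommutativeRing.Carrier S}
    (ι-homo : IsRingHomomorphism R.rawRing (CommutativeRing.rawRing S) ι) (ρ : Vec (CommutativeRing.Carrier S) n) →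
    CommutativeRing._≈_ S (eval (CommutativeRing.rawRing S) ι P ρ) (Evaluation.⟦_⟧ (CommutativeRing.rawRing S) ι e ρ)

  opaque
    -- Sealed: afterwards a polynomial is known through its values alone, not through its
    -- coefficient lists.
    represent : ∀ {n} (e : Expr C n) → ∃ (Represents e)
    represent e = toPoly e , λ S ι-homo ρ → eval-toPoly S ι-homo e ρ

  evalℝ : ∀ n → Poly C n → Vec C n → C
  evalℝ n P = eval R.rawRing id {n} P

  eval#⇒nonzero : ∀ n P (ρ : Vec C n) → evalℝ n P ρ # R.0# → Nonzero n P
  eval#⇒nonzero zero a [] a#0 = lift a#0
  eval#⇒nonzero (suc n) [] (v ∷ ρ) 0#0 = ⊥-elim (proj₂ (RealField.tight ℝ R.0# R.0#) R.refl 0#0)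
  eval#⇒nonzero (suc n) (a ∷ P) (v ∷ ρ) p with +-#-split p
  ... | inj₁ a#0 = here (eval#⇒nonzero n a ρ a#0)
  ... | inj₂ vP#0 = there (eval#⇒nonzero (suc n) P (v ∷ ρ) (*-#-right vP#0))

-- The walk

module WalkFacts {c ℓ₁ ℓ₂ ℓ₃} (ℝ : RealField c ℓ₁ ℓ₂ ℓ₃) (p q r : RealField.Carrier ℝ)
  (p>0 : RealField._<_ ℝ (RealField.0# ℝ) p)
  (q>0 : RealField._<_ ℝ (RealField.0# ℝ) q)
  (r>0 : RealField._<_ ℝ (RealField.0# ℝ) r) where

  open RealFacts ℝ
  open CommutativeRing realRing
  open Walk ℝ p q r p>0 q>0 r>0
  open Relation.Binary.Reasoning.Setoid setoid
  open +-*-Solver using (solve; con; _:+_; _:*_; _:=_)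

  private
    _⊙_ : List (Carrier × State) → (State → Carrier) → Carrier
    l ⊙ f = foldr (λ (w , s) acc → w * f s + acc) 0# l

    ⊙-cong : ∀ l {f g : State → Carrier} → (∀ s → f s ≈ g s) → l ⊙ f ≈ l ⊙ g
    ⊙-cong [] f≈g = refl
    ⊙-cong ((w , s) ∷ l) f≈g = +-cong (*-congˡ (f≈g s)) (⊙-cong l f≈g)

    ⊙-zero : ∀ l → l ⊙ (λ _ → 0#) ≈ 0#
    ⊙-zero [] = refl
    ⊙-zero ((w , s) ∷ l) = trans (+-cong (zeroʳ w) (⊙-zero l)) (+-identityˡ 0#)

    ⊙-linear : ∀ l w f g → l ⊙ (λ s → w * f s + g s) ≈ w * (l ⊙ f) + l ⊙ g
    ⊙-linear [] w f g = sym (trans (+-identityʳ _) (zeroʳ w))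
    ⊙-linear ((v , s) ∷ l) w f g = RingLemmas.sum-linear realRing
      (_ ∷ v ∷ w ∷ f s ∷ g s ∷ l ⊙ f ∷ l ⊙ g ∷ []) (⊙-linear l w f g ∷ [])

    ⊙-swap : ∀ l m (F : State → State → Carrier) →
      l ⊙ (λ s → m ⊙ F s) ≈ m ⊙ (λ u → l ⊙ (λ s → F s u))
    ⊙-swap [] m F = sym (⊙-zero m)
    ⊙-swap ((w , s) ∷ l) m F = trans (+-congˡ (⊙-swap l m F)) (sym (⊙-linear m w (F s) (λ u → l ⊙ (λ s → F s u))))

    δ : ℕ → ℕ → Carrier
    δ zero zero = 1#
    δ zero (suc _) = 0#
    δ (suc _) zero = 0#
    δ (suc i) (suc j) = δ i j

    δ-refl : ∀ i → δ i i ≡ 1#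
    δ-refl zero = ≡.refl
    δ-refl (suc i) = δ-refl i

    δ-distinct : ∀ {i j} → i ≢ j → δ i j ≡ 0#
    δ-distinct {zero} {zero} i≢j = contradiction ≡.refl i≢j
    δ-distinct {zero} {suc j} i≢j = ≡.refl
    δ-distinct {suc i} {zero} i≢j = ≡.refl
    δ-distinct {suc i} {suc j} i≢j = δ-distinct (i≢j ∘ ≡.cong suc)

    kronecker : State → State → Carrier
    kronecker (i , j) (i′ , j′) = δ i i′ * δ j j′

    transition-zero : ∀ s u → transition 0 s u ≈ kronecker s u
    transition-zero s@(i , j) u@(i′ , j′) with ≡-dec ℕ._≟_ ℕ._≟_ s u
    ... | yes ≡.refl = sym (trans (*-cong (reflexive (δ-refl i)) (reflexive (δ-refl j))) (*-identityˡ 1#))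
    ... | no s≢u with i ℕ.≟ i′
    ...   | no i≢i′ = sym (trans (*-congʳ (reflexive (δ-distinct i≢i′))) (zeroˡ _))
    ...   | yes ≡.refl = sym (trans (*-congˡ (reflexive (δ-distinct (s≢u ∘ ≡.cong (i ,_))))) (zeroʳ _))

    δ-shift : ∀ (w : State → Carrier) i j i′ j′ → w (i , j) * (δ i i′ * δ j j′) ≈ w (i′ , j′) * (δ i i′ * δ j j′)
    δ-shift w i j i′ j′ with i ℕ.≟ i′ | j ℕ.≟ j′
    ... | yes ≡.refl | yes ≡.refl = refl
    ... | no i≢i′ | _ = trans (vanish _) (sym (vanish _))
      where vanish : ∀ a → a * (δ i i′ * δ j j′) ≈ 0#
            vanish a = trans (*-congˡ (trans (*-congʳ (reflexive (δ-distinct i≢i′))) (zeroˡ _))) (zeroʳ a)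
    ... | yes _ | no j≢j′ = trans (vanish _) (sym (vanish _))
      where vanish : ∀ a → a * (δ i i′ * δ j j′) ≈ 0#
            vanish a = trans (*-congˡ (trans (*-congˡ (reflexive (δ-distinct j≢j′))) (zeroʳ _))) (zeroʳ a)

  -- A step west or south is indexed by its target, which shares with the source the one coordinate
  -- that decides the weight; a step north-east is indexed by its source.
  westWeight southWeight northEastWeight : State → Carrier
  westWeight (i , zero) = p′
  westWeight (i , suc j) = p
  southWeight (zero , j) = q″
  southWeight (suc i , j) = q
  northEastWeight (zero , zero) = 1#
  northEastWeight (suc i , zero) = r′
  northEastWeight (zero , suc j) = r″
  northEastWeight (suc i , suc j) = r

  west south northEast : (State → Carrier) → State → Carrier
  west f (i , j) = westWeight (i , j) * f (suc i , j)
  south f (i , j) = southWeight (i , j) * f (i , suc j)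
  northEast f (suc i , suc j) = northEastWeight (i , j) * f (i , j)
  northEast f (zero , _) = 0#
  northEast f (suc _ , zero) = 0#

  private
    predecessors : State → List (Carrier × State)
    predecessors (i , j) = (westWeight (i , j) , suc i , j) ∷ (southWeight (i , j) , i , suc j) ∷ diagonal i j
      where
      diagonal : ℕ → ℕ → List (Carrier × State)
      diagonal (suc i) (suc j) = (northEastWeight (i , j) , i , j) ∷ []
      diagonal zero _ = []
      diagonal (suc _) zero = []

    predecessors-⊙ : ∀ f u → predecessors u ⊙ f ≈ west f u + (south f u + northEast f u)
    predecessors-⊙ f (zero , j) = refl
    predecessors-⊙ f (suc i , zero) = refl
    predecessors-⊙ f (suc i , suc j) = +-congˡ (+-congˡ (+-identityʳ _))

    westward southward northEastward : State → (State → Carrier) → Carrier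
    westward (zero , j) g = 0#
    westward (suc i , j) g = westWeight (i , j) * g (i , j)
    southward (i , zero) g = 0#
    southward (i , suc j) g = southWeight (i , j) * g (i , j)
    northEastward (i , j) g = northEastWeight (i , j) * g (suc i , suc j)

    steps-⊙ : ∀ s g → steps s ⊙ g ≈ westward s g + (southward s g + northEastward s g)
    steps-⊙ (zero , zero) g = trans (+-identityʳ _) (sym (trans (+-identityˡ _) (+-identityˡ _)))
    steps-⊙ (suc i , zero) g = +-congˡ (trans (+-identityʳ _) (sym (+-identityˡ _)))
    steps-⊙ (zero , suc j) g = trans (+-congˡ (+-identityʳ _)) (sym (+-identityˡ _))
    steps-⊙ (suc i , suc j) g = +-congˡ (+-congˡ (+-identityʳ _))

    one-step : ∀ s u → steps s ⊙ (λ s′ → kronecker s′ u) ≈ predecessors u ⊙ kronecker s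
    one-step s u = trans (steps-⊙ s _) (trans (+-cong (W s u) (+-cong (S s u) (NE s u))) (sym (predecessors-⊙ (kronecker s) u)))
      where
      W : ∀ s u → westward s (λ s′ → kronecker s′ u) ≈ west (kronecker s) u
      W (zero , j) (i′ , j′) = sym (trans (*-congˡ (zeroˡ _)) (zeroʳ _))
      W (suc i , j) (i′ , j′) = δ-shift westWeight i j i′ j′

      S : ∀ s u → southward s (λ s′ → kronecker s′ u) ≈ south (kronecker s) u
      S (i , zero) (i′ , j′) = sym (trans (*-congˡ (zeroʳ _)) (zeroʳ _))
      S (i , suc j) (i′ , j′) = δ-shift southWeight i j i′ j′

      NE : ∀ s u → northEastward s (λ s′ → kronecker s′ u) ≈ northEast (kronecker s) u
      NE (i , j) (zero , j′) = trans (*-congˡ (zeroˡ _)) (zeroʳ _)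
      NE (i , j) (suc i′ , zero) = trans (*-congˡ (zeroʳ _)) (zeroʳ _)
      NE (i , j) (suc i′ , suc j′) = δ-shift northEastWeight i j i′ j′

    -- `transition` conditions on the first step, whereas the functional equation needs the last
    -- one. The operators acting on the initial and on the final state commute by `⊙-swap`, so
    -- everything reduces to a single step, which is `one-step`.
    last-step : ∀ n s u → transition (suc n) s u ≈ predecessors u ⊙ transition n s
    last-step zero s u = trans (⊙-cong (steps s) λ s′ → transition-zero s′ u)
      (trans (one-step s u) (⊙-cong (predecessors u) λ v → sym (transition-zero s v)))
    last-step (suc n) s u = trans (⊙-cong (steps s) λ s′ → last-step n s′ u)
      (⊙-swap (steps s) (predecessors u) (transition n))

  transition-forward : ∀ n s u → transition (suc n) s u ≈
    west (transition n s) u + (south (transition n s) u + northEast (transition n s) u)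
  transition-forward n s u = trans (last-step n s u) (predecessors-⊙ (transition n s) u)

  p′-spec : p′ * (p + r) ≈ p
  p′-spec = ÷-*-cancel p p+r>0

  r′-spec : r′ * (p + r) ≈ r
  r′-spec = ÷-*-cancel r p+r>0

  module Symmetric (p≈q : p ≈ q) where
    -- The inverse in a quotient is chosen from the positivity proof of the divisor, so congruence
    -- has to come from the defining equation of the quotient.
    quotient-cong : ∀ {x y} (y>0 : RealField._<_ ℝ 0# y) {x′ y′} (y′>0 : RealField._<_ ℝ 0# y′) → x ≈ x′ → y ≈ y′ →
      RealField._÷_⟨_⟩ ℝ x y y>0 ≈ RealField._÷_⟨_⟩ ℝ x′ y′ y′>0
    quotient-cong {x} {y} y>0 {x′} {y′} y′>0 x≈x′ y≈y′ = RingLemmas.quotient-unique realRing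
      (_ ∷ _ ∷ x ∷ x′ ∷ y ∷ y′ ∷ _ ∷ [])
      (÷-*-cancel x y>0 ∷ ÷-*-cancel x′ y′>0 ∷ x≈x′ ∷ y≈y′ ∷ proj₂ (#⇒unit (>0⇒# y>0)) ∷ [])

    p′≈q″ : p′ ≈ q″
    p′≈q″ = quotient-cong p+r>0 q+r>0 p≈q (+-congʳ p≈q)

    r′≈r″ : r′ ≈ r″
    r′≈r″ = quotient-cong p+r>0 q+r>0 refl (+-congʳ p≈q)

    transition-swap : ∀ n s u → transition n s u ≈ transition n (swap s) (swap u)
    transition-swap zero s u = trans (transition-zero s u)
      (trans (*-comm _ _) (sym (transition-zero (swap s) (swap u))))
    transition-swap (suc n) (zero , zero) u = +-congʳ (*-congˡ (transition-swap n _ u))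
    transition-swap (suc n) (suc i , zero) u = +-cong (*-cong p′≈q″ (transition-swap n _ u))
      (+-congʳ (*-cong r′≈r″ (transition-swap n _ u)))
    transition-swap (suc n) (zero , suc j) u = +-cong (*-cong (sym p′≈q″) (transition-swap n _ u))
      (+-congʳ (*-cong (sym r′≈r″) (transition-swap n _ u)))
    transition-swap (suc n) (suc i , suc j) u = RingLemmas.swap-first-two realRing (_ ∷ _ ∷ _ ∷ _ ∷ _ ∷ _ ∷ [])
      (*-cong p≈q (transition-swap n (i , suc j) u) ∷ *-cong (sym p≈q) (transition-swap n (suc i , j) u) ∷
       *-congˡ {r} (transition-swap n (suc (suc i) , suc (suc j)) u) ∷ [])

    prob-swap : ∀ n i j → prob n i j ≈ prob n j i
    prob-swap n i j = transition-swap n (0 , 0) (i , j)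

  private
    level : ℕ → State → ℕ
    level n (i , j) = n ℕ.+ 2 ℕ.* (i ℕ.+ j)

    -- Every step changes i + j by 2 modulo 3.
    return-support : ∀ n s → ¬ 3 ℕ.∣ level n s → transition n s (0 , 0) ≈ 0#
    return-support zero (zero , zero) ¬3∣ = contradiction (3 ℕ.∣0) ¬3∣
    return-support zero (suc i , j) ¬3∣ = trans (transition-zero (suc i , j) (0 , 0)) (zeroˡ _)
    return-support zero (zero , suc j) ¬3∣ = trans (transition-zero (0 , suc j) (0 , 0)) (zeroʳ _)
    return-support (suc n) s@(i , j) ¬3∣ = trans (steps-⊙ s _)
      (trans (+-cong (W s ¬3∣) (trans (+-cong (S s ¬3∣) NE) (+-identityˡ 0#))) (+-identityˡ 0#))
      where
      vanish : ∀ a s′ → ¬ 3 ℕ.∣ level n s′ → a * transition n s′ (0 , 0) ≈ 0#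
      vanish a s′ ¬3∣′ = trans (*-congˡ (return-support n s′ ¬3∣′)) (zeroʳ a)

      W : ∀ s → ¬ 3 ℕ.∣ level (suc n) s → westward s (λ s′ → transition n s′ (0 , 0)) ≈ 0#
      W (zero , j) _ = refl
      W (suc i , j) ¬3∣ = vanish _ (i , j) λ 3∣ → ¬3∣ (≡.subst (3 ℕ.∣_)
        (solve 3 (λ n i j → con 3 :+ (n :+ con 2 :* (i :+ j)) := con 1 :+ n :+ con 2 :* ((con 1 :+ i) :+ j)) ≡.refl n i j)
        (ℕ.∣m∣n⇒∣m+n ℕ.∣-refl 3∣))

      S : ∀ s → ¬ 3 ℕ.∣ level (suc n) s → southward s (λ s′ → transition n s′ (0 , 0)) ≈ 0#
      S (i , zero) _ = refl
      S (i , suc j) ¬3∣ = vanish _ (i , j) λ 3∣ → ¬3∣ (≡.subst (3 ℕ.∣_)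
        (solve 3 (λ n i j → con 3 :+ (n :+ con 2 :* (i :+ j)) := con 1 :+ n :+ con 2 :* (i :+ (con 1 :+ j))) ≡.refl n i j)
        (ℕ.∣m∣n⇒∣m+n ℕ.∣-refl 3∣))

      NE : northEastward s (λ s′ → transition n s′ (0 , 0)) ≈ 0#
      NE = vanish _ (suc i , suc j) λ 3∣ → ¬3∣ (ℕ.∣m+n∣m⇒∣n (≡.subst (3 ℕ.∣_)
        (solve 3 (λ n i j → n :+ con 2 :* ((con 1 :+ i) :+ (con 1 :+ j)) := con 3 :+ (con 1 :+ n :+ con 2 :* (i :+ j))) ≡.refl n i j)
        3∣) ℕ.∣-refl)

  P₀₀-support : ∀ n → ¬ 3 ℕ.∣ n → T.P₀₀ n ≈ 0#
  P₀₀-support n ¬3∣ = return-support n (0 , 0) (¬3∣ ∘ ≡.subst (3 ℕ.∣_) (ℕ.+-identityʳ n))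

  P₀₀≈multiplesOf3 : T.P₀₀ T.≈ T.P₀₀-multiplesOf3
  P₀₀≈multiplesOf3 n = cases (3 ℕ.∣? n)
    where
    cases : (d : Dec (3 ℕ.∣ n)) → T.P₀₀ n ≈ (if does d then prob (3 ℕ.* (n ℕ./ 3)) 0 0 else 0#)
    cases (yes 3∣n) = reflexive (≡.cong (λ m → prob m 0 0) (≡.sym (ℕ.m*[n/m]≡n 3∣n)))
    cases (no ¬3∣n) = P₀₀-support n ¬3∣n

-- The kernel method

module Formulas {a ℓ} (A : RawRing a ℓ) (p r t : RawRing.Carrier A) where
  open RingNotation A

  weight K : Carrier → Carrier → Carrier
  weight x y = p * x + p * y + r * (x * x) * (y * y)
  K x y = x * y - t * weight x y

  -- From x (y - t)(trxy - p) = - K - y α(x): multiplication by trxy - p turns, modulo K, the term p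
  -- x (y - t) F(x) into - p y α(x) F(x), and r x y into (y ω(x) + x ω(y))/2.
  α ω : Carrier → Carrier
  α x = p * t - (1# - p) * x + r * (t * t) * (x * x)
  ω x = r * ((1# - p) * x - 2 · (p * t))

  θ : Carrier → Carrier → Carrier
  θ x F = 2 · (p * α x * F) - ω x

  -- The remainder of θ of order x², where F′ and F″ arise from F by twice removing the constant
  -- term and dividing by x.
  θ₂ : (F F′ F″ : Carrier) → Carrier
  θ₂ F F′ F″ = 2 · (p * (p * t * F″ - (1# - p) * F′ + r * (t * t) * F))

  low : (h x : Carrier) → Carrier
  low h x = h * (2 · (p * t) - x)

  -- The division by x² is carried out: after θ = low + x² n₂ no negative power of x remains, so
  -- this is a genuine series.
  Β : (h x n₂ : Carrier) → Carrier
  Β h x n₂ = h * h * (1# + 4 · (p * r * (t * t) * x)) + 2 · (low h x * n₂) + x * x * (n₂ * n₂)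

  Η : (x y Q F G : Carrier) → Carrier
  Η x y Q F G = 2 · (Q * (t * r * x * y - p) + p * (F + G) + r)

  τ : Carrier
  τ = 4 · (p * p * r * (t * t * t))

  -- `S` is the square root of 1 - 4prt²Z²x, that is √Δ₊ at x/p, and 2ptZ is the double root of θ².
  root : (Z x S : Carrier) → Carrier
  root Z x S = (2 · (p * t * Z) - x) * S

  root₂ : (Z S′ : Carrier) → Carrier
  root₂ Z S′ = - S′ - p * t * Z * (S′ * S′)

  -- The coefficient of x² in ζ² (2ptZ - x)² (1 - 4prt²Z²x). It is ζ² + 4τZ, and τZ = ζ - ζ².
  cubic : Carrier → Carrier
  cubic ζ = 4 · ζ - 3 · (ζ * ζ)

  -- Times x² it equals θ² - ω² modulo α, once θ² is written as the cubic polynomial in x; the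
  -- reduction uses rt²x² = (1 - p) x - pt.
  discriminant : (h ζ : Carrier) → Carrier
  discriminant h ζ = h * h * (cubic ζ - 4 · (p * r * (t * t * t)) - 4 · (p * (1# - p)))
    - r * r * ((1# - p) * (1# - p) - 4 · (p * r * (t * t * t)))

  -- Z² δ(ζ) is Δ₋(p/t). It arises as the cofactor of ζ - (1 - p) in ζ³ - ζ² + p (1 - p)².
  δ : Carrier → Carrier
  δ ζ = ζ * ζ - p * ζ - p * (1# - p)

  square : (x ζ : Carrier) → Carrier
  square x ζ = 4 · (p * p * (t * t)) - 4 · (p * t * x) - 4 · (p * r * (t * t) * (x * x * x)) + cubic ζ * (x * x)

  ε : Carrier → Carrier
  ε Z = Z * (1# - 2 · (p * Z))

  -- From θ = hζ · root and hζε = rs it follows that 2pεαF = rσ.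
  σ : (Z s x S : Carrier) → Carrier
  σ Z s x S = s * root Z x S + ε Z * ((1# - p) * x - 2 · (p * t))

  cofactor : (x y : Carrier) → Carrier
  cofactor x y = (x * (y - t) - K x y) * α y

  denominator : (Z x y : Carrier) → Carrier
  denominator Z x y = 2 · (p * ε Z * α x * α y * K x y)

  numerator : (Z s x y S S′ : Carrier) → Carrier
  numerator Z s x y S S′ =
    2 · (p * ε Z * α x * α y * (x * y)) + p * cofactor x y * σ Z s x S + p * cofactor y x * σ Z s y S′

  -- The part of the functional equation without θ, times ζ - 2p. It equals a sum of two terms, one
  -- with θ(x) and one with θ(y), whose squares are the polynomials `ramified`.
  unramified : (ζ P x y : Carrier) → Carrier
  unramified ζ P x y = (ζ - 2 · p) * (2 · (r * α x * α y * K x y * P) - (2 · (r * α x * α y * (x * y))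
    + cofactor x y * ω x + cofactor y x * ω y))

  ramified : (ζ x y : Carrier) → Carrier
  ramified ζ x y = cofactor x y * cofactor x y * (r * r * δ ζ * square x ζ)

  -- (e - u - v) (e + u - v) (e - u + v) (e + u + v) for u² = b and v² = c.
  conjugates : (e b c : Carrier) → Carrier
  conjugates e b c = (e * e - b - c) * (e * e - b - c) - 4 · (b * c)

  minimal : (ζ P x y : Carrier) → Carrier
  minimal ζ P x y = conjugates (unramified ζ P x y) (ramified ζ x y) (ramified ζ y x)

module OriginFormulas {a ℓ} (A : RawRing a ℓ) (p r : RawRing.Carrier A) where
  open RingNotation A

  -- - e is the value of 4pY² at ζ = 0; hence (4pY² + e)(ζ - 2p)² = r² χ(ζ) with χ(0) = 0.
  e : Carrier
  e = r * r * (1# - p)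

  D χ δ₀ : Carrier → Carrier
  D ζ = ζ - 2 · p
  χ ζ = ζ * ((1# + 3 · p) * ζ - 4 · p)
  δ₀ ζ = ζ * ζ - p * ζ - p * (1# - p)

  -- The coefficients of Σ cₖ p⁵⁻ᵏ (Y - r)ᵏ.
  g₀ g₁ g₂ g₃ g₄ g₅ : (c₀ c₁ c₂ c₃ c₄ c₅ : Carrier) → Carrier
  g₅ c₀ c₁ c₂ c₃ c₄ c₅ = c₅
  g₄ c₀ c₁ c₂ c₃ c₄ c₅ = p * c₄ - 5 · (r * c₅)
  g₃ c₀ c₁ c₂ c₃ c₄ c₅ = p * (p * c₃) - 4 · (r * (p * c₄)) + 10 · (r ^ 2 * c₅)
  g₂ c₀ c₁ c₂ c₃ c₄ c₅ = p * (p * (p * c₂)) - 3 · (r * (p * (p * c₃))) + 6 · (r ^ 2 * (p * c₄)) - 10 · (r ^ 3 * c₅)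
  g₁ c₀ c₁ c₂ c₃ c₄ c₅ = p * (p * (p * (p * c₁))) - 2 · (r * (p * (p * (p * c₂)))) + 3 · (r ^ 2 * (p * (p * c₃)))
    - 4 · (r ^ 3 * (p * c₄)) + 5 · (r ^ 4 * c₅)
  g₀ c₀ c₁ c₂ c₃ c₄ c₅ = p * (p * (p * (p * (p * c₀)))) - r * (p * (p * (p * (p * c₁)))) + r ^ 2 * (p * (p * (p * c₂)))
    - r ^ 3 * (p * (p * c₃)) + r ^ 4 * (p * c₄) - r ^ 5 * c₅

  -- With `λ₁` and c these are the coefficients of 16p² (a + bY² + cY⁴) in powers of 4pY² + e.
  λ₀ : (a b c : Carrier) → Carrier
  λ₀ a b c = 16 · (p * p * a) - 4 · (p * (e * b)) + e * e * c

  λ₁ : (b c : Carrier) → Carrier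
  λ₁ b c = 4 · (p * b) - 2 · (e * c)

  -- This is 16p² (a + bY² + cY⁴)(ζ - 2p)⁴, with Y² eliminated in favour of ζ.
  form : (a b c ζ : Carrier) → Carrier
  form a b c ζ = λ₀ a b c * (D ζ * D ζ * (D ζ * D ζ)) + λ₁ b c * (r * r * (D ζ * D ζ) * χ ζ) + c * (r * r * χ ζ * (r * r * χ ζ))

  slope : (a b c a′ b′ c′ ζ : Carrier) → Carrier
  slope a b c a′ b′ c′ ζ =
    λ₀ a b c * ((ζ - 4 · p) * (D ζ * D ζ + 4 · (p * p))) + λ₁ b c * (r * r * (D ζ * D ζ) * ((1# + 3 · p) * ζ - 4 · p))
      + ζ * (c * (r * r * ((1# + 3 · p) * ζ - 4 · p) * (r * r * ((1# + 3 · p) * ζ - 4 · p))) + form a′ b′ c′ ζ)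

  quintic : (c₀ c₁ c₂ c₃ c₄ c₅ V : Carrier) → Carrier
  quintic c₀ c₁ c₂ c₃ c₄ c₅ V = c₀ + V * (c₁ + V * (c₂ + V * (c₃ + V * (c₄ + V * (c₅ + V * 0#)))))

  -- n₀ + n₁ Y² + n₂ Y⁴ + n₃ Y⁶ is the norm of Y² (ζ - 2p)² - r² δ(ζ) for ζ³ = ζ² - τ.
  n₀ n₁ n₂ n₃ : Carrier → Carrier
  n₀ τ = - (r ^ 6 * ((p * (1# - p) ^ 2 - τ) ^ 2))
  n₁ τ = r ^ 4 * (p ^ 2 - 14 · p ^ 3 + 37 · p ^ 4 - 36 · p ^ 5 + 12 · p ^ 6 - τ * (4 · p - 18 · p ^ 2 + 15 · p ^ 3) + 3 · τ ^ 2)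
  n₂ τ = r ^ 2 * (8 · p ^ 3 - 56 · p ^ 4 + 96 · p ^ 5 - 48 · p ^ 6 + τ * (2 · p - 6 · p ^ 2 + 24 · p ^ 3) - 3 · τ ^ 2)
  n₃ τ = (τ - 4 · (p ^ 2 * (1# - 2 · p))) ^ 2

  -- The coefficients in V of n₀ + n₁Y² + n₂Y⁴ + n₃Y⁶ for Y = pV + r.
  coefficient₀ coefficient₁ coefficient₂ coefficient₃ coefficient₄ coefficient₅ coefficient₆ : Carrier → Carrier
  coefficient₀ τ = r ^ 6 * n₃ τ + r ^ 4 * n₂ τ + r ^ 2 * n₁ τ + n₀ τ
  coefficient₁ τ = p * (6 · (r ^ 5 * n₃ τ) + 4 · (r ^ 3 * n₂ τ) + 2 · (r * n₁ τ))
  coefficient₂ τ = p ^ 2 * (15 · (r ^ 4 * n₃ τ) + 6 · (r ^ 2 * n₂ τ) + n₁ τ)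
  coefficient₃ τ = p ^ 3 * (20 · (r ^ 3 * n₃ τ) + 4 · (r * n₂ τ))
  coefficient₄ τ = p ^ 4 * (15 · (r ^ 2 * n₃ τ) + n₂ τ)
  coefficient₅ τ = p ^ 5 * (6 · (r * n₃ τ))
  coefficient₆ τ = p ^ 6 * n₃ τ

module Norm {a ℓ} (A : RawRing a ℓ) where
  open RingNotation A

  -- For ζ³ = ζ² - τ the norm of a + bζ + cζ² is its product with cofactor₀ + ζ cofactor₁ + ζ² cofactor₂.
  cofactor₀ cofactor₁ cofactor₂ norm : (τ a b c : Carrier) → Carrier
  cofactor₀ τ a b c = a * (a + b + c) + c * τ * (b + c)
  cofactor₁ τ a b c = - (b * (a + b + c) + c * c * τ)
  cofactor₂ τ a b c = b * (b + c) - a * c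
  norm τ a b c = a * cofactor₀ τ a b c - c * τ * cofactor₁ τ a b c - τ * (b + c) * cofactor₂ τ a b c

module KernelLemmas {c ℓ} (R : CommutativeRing c ℓ) where
  open LinearCombination R
  module _ {n : ℕ} where
    open RingNotation (Syntax n) public
    open Formulas (Syntax n) public

  pull-factor = infer 3 λ k x g → [] ⊢ k * (x * g) := x * (k * g)

  kernel-split = infer 7 λ p r t x y k H → H ×[ k := K p r t x y ] ∷ [] ⊢
    k * H := x * (y * H) - t * (weight p r t x y * H)

  -- Modulo x the kernel is - tpy, so x divides tpyg.
  isolate-x = infer 8 λ p r t x y k f g →
    1# ×[ x * f := k * g ] ∷ g ×[ k := K p r t x y ] ∷ [] ⊢
    t * (p * (y * g)) := x * (y * g - t * (p * g) - t * (r * (x * (y * (y * g)))) - f)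

  isolate-y = infer 8 λ p r t x y k f g →
    1# ×[ y * f := k * g ] ∷ g ×[ k := K p r t x y ] ∷ [] ⊢
    t * (p * (x * g)) := y * (x * g - t * (p * g) - t * (r * (y * (x * (x * g)))) - f)

  isolate-α = infer 7 λ p r t x a f g →
    (- 1#) ×[ x * f := a * g ] ∷ (- g) ×[ a := α p r t x ] ∷ [] ⊢
    t * (p * g) := x * (f + (1# - p) * g - r * (t * (t * (x * g))))

  Z-normal = infer 5 λ p q r t Z →
    1# ×[ Z := 1# + 4 · (p * q * r * t ^ 3 * Z ^ 3) ] ∷ - (4 · (p * r * t ^ 3 * Z ^ 3)) ×[ p := q ] ∷ []
    ⊢ Z := 1# + τ p r t * (Z * Z * Z)

  Z-tail = infer 4 λ p r t Z →
    1# ×[ Z := 1# + τ p r t * (Z * Z * Z) ] ∷ [] ⊢ Z := 1# + t * (4 · (p * p * r * (t * t)) * (Z * Z * Z))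

  low-at-0 = infer 6 λ p r t h x f →
    2 · (h * 2 · p) ×[ t := 0# ] ∷ [] ⊢ 2 · low p r t h x + x * x * f := x * (x * f + - (2 · h))

  α-at-0 = infer 4 λ p r t x →
    p + r * t * (x * x) ×[ t := 0# ] ∷ [] ⊢ α p r t x := x * (x * 0# + - (1# - p))

  low-unit = infer 4 λ p r u v →
    1# ×[ (p + r + (p + r)) * u := 1# ] ∷ (p * u + p * u) ×[ v := 1# ] ∷ []
    ⊢ - ((p * v + 0#) + r + ((p * v + 0#) + r + 0#)) * (- u) := 1#

  α-unit = infer 3 λ p r u →
    1# ×[ (p + r) * u := 1# ] ∷ (- u) ×[ p + p + r := 1# ] ∷ [] ⊢ - (1# - p) * (- u) := 1#

  shifted-reciprocal = infer 4 λ p v z ζ →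
    1# ×[ p * v := 1# ] ∷ v ×[ ζ * z := 1# ] ∷ - (v * ζ) ×[ z := 1# ] ∷ [] ⊢ (ζ - (1# - p)) * v := 1#

  reflection-weights = infer 4 λ p r p′ r′ →
    r′ ×[ p′ * (p + r) := p ] ∷ - p′ ×[ r′ * (p + r) := r ] ∷ [] ⊢ r * p′ := p * r′

  reflection-total = infer 5 λ p r p′ r′ u →
    u ×[ p′ * (p + r) := p ] ∷ u ×[ r′ * (p + r) := r ] ∷ - (p′ + r′ - 1#) ×[ (p + r) * u := 1# ] ∷ []
    ⊢ p′ + r′ := 1#

  origin = infer 8 λ p r t p′ r′ V F P →
    2 · (p * t) ×[ F := r′ * P ] ∷ - r ×[ V := 1# + t * ((p′ + p′) * P) ] ∷ - (2 · (t * P)) ×[ r * p′ := p * r′ ] ∷ []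
    ⊢ 2 · (p * t * F) := r * (V - 1#)

  sqrt-rescaled = infer 9 λ p q r t Z x π Δ S →
    1# ×[ S * S := Δ ] ∷ 1# ×[ Δ := 1# - 4 · (p * q * r * t ^ 2 * Z ^ 2 * (π * x)) ] ∷
    4 · (p * r * (t * t) * (Z * Z) * π * x) ×[ p := q ] ∷ - (4 · (p * r * (t * t) * (Z * Z) * x)) ×[ π * p := 1# ] ∷ []
    ⊢ S * S := 1# - 4 · (p * r * (t * t) * (Z * Z) * x)

  vanishing-at-0 = infer 5 λ p r t Z x → - (4 · (p * r * (t * t) * (Z * Z))) ×[ x := 0# ] ∷ []
    ⊢ 1# - 4 · (p * r * (t * t) * (Z * Z) * x) := 1#

  -- P is multiplied by r because r p′ = p r′: the steps along the axis, r p′ X, become p (F - V)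
  -- and so involve the same series F as the steps north-east off the axis.
  functional-equation = infer 17 λ p r t p′ r′ x y V X Y I P W S N F G →
    let Q = r * P + p * (F + G)
        M = weight p r t x y
    in
    - (t * M * (V + r′ * (X + Y))) ×[ p + p + r := 1# ] ∷
    t * (y * X + x * Y) - t * M * (X + Y) ×[ r * p′ := p * r′ ] ∷
    t * M * r * (X + Y) ×[ p′ + r′ := 1# ] ∷
    - (t * M * r) ×[ P := V + X + Y + I ] ∷
    r * x * y ×[ P := 1# + t * (W + (S + N)) ] ∷
    r * t * y ×[ x * W := p′ * X + p * I ] ∷
    r * t * x ×[ y * S := p′ * Y + p * I ] ∷
    r * x * y * t ×[ N := x * (y * (V + r′ * X + r′ * Y + r * I)) ] ∷
    p * K p r t x y - p * x * (y - t) ×[ F := V + r′ * X ] ∷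
    p * K p r t x y - p * y * (x - t) ×[ G := V + r′ * Y ] ∷ []
    ⊢ K p r t x y * Q := r * (x * y) + p * x * (y - t) * F + p * y * (x - t) * G

  kernel-multiple = infer 8 λ p r t x y Q F G →
    2 · (t * r * x * y - p) ×[ K p r t x y * Q := r * (x * y) + p * x * (y - t) * F + p * y * (x - t) * G ] ∷ []
    ⊢ y * θ p r t x F + x * θ p r t y G := - (K p r t x y * Η p r t x y Q F G)

  -- The constant term of θ is 2pt (pV + r). In the coefficient of x the balance 2ptF₁ = r (V - 1)
  -- replaces F₁, and r - 2 (1 - p) = - 1 turns the result into - (pV + r).
  ν-expansion = infer 9 λ p r t x V F F′ F₁ F″ →
    2 · (p * (p * t - (1# - p) * x)) ×[ F := V + x * F′ ] ∷ 2 · (p * p * t * x) ×[ F′ := F₁ + x * F″ ] ∷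
    p * x ×[ 2 · (p * t * F₁) := r * (V - 1#) ] ∷ p * x * V ×[ p + p + r := 1# ] ∷ []
    ⊢ θ p r t x F := low p r t (p * V + r) x + x * x * θ₂ p r t F F′ F″

  -- y θ(x) + x θ(y) is a factor of y² θ(x)² - x² θ(y)²; the subtracted rational functions
  -- contribute 4pt (y - x) h² to the cofactor of K.
  invariant = infer 11 λ p r t x y h n m n₂ m₂ H →
    - (y * y * (n + (low p r t h x + x * x * n₂))) ×[ n := low p r t h x + x * x * n₂ ] ∷
    x * x * (m + (low p r t h y + y * y * m₂)) ×[ m := low p r t h y + y * y * m₂ ] ∷
    y * n - x * m ×[ y * n + x * m := - (K p r t x y * H) ] ∷ []
    ⊢ x * (x * (y * (y * (Β p r t h x n₂ - Β p r t h y m₂)))) :=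
      K p r t x y * (4 · (p * t * (y - x) * (h * h)) - H * (y * n - x * m))

  sqrt-tail = infer 7 λ p r t x Z S S′ →
    1# ×[ S * S := 1# - 4 · (p * r * (t * t) * (Z * Z) * x) ] ∷ - (S + 1# + x * S′) ×[ S := 1# + x * S′ ] ∷ []
    ⊢ x * (S′ + S′ + x * (S′ * S′)) := x * - (4 · (p * r * (t * t) * (Z * Z)))

  root-expansion = infer 9 λ p r t x h Z ζ S S′ →
    h * ζ * (2 · (p * t * Z) - x) ×[ S := 1# + x * S′ ] ∷
    h * ζ * x * p * t * Z ×[ S′ + S′ + x * (S′ * S′) := - (4 · (p * r * (t * t) * (Z * Z))) ] ∷
    h * ζ * x ×[ Z := 1# + τ p r t * (Z * Z * Z) ] ∷
    low p r t h x ×[ ζ * Z := 1# ] ∷ []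
    ⊢ h * ζ * root p r t Z x S := low p r t h x + x * x * (h * ζ * root₂ p r t Z S′)

  squares-agree = infer 11 λ p r t x h Z ζ S m n₂ β →
    x * x ×[ Β p r t h x n₂ := β ] ∷
    h * ζ * root p r t Z x S + (low p r t h x + x * x * m) ×[ h * ζ * root p r t Z x S := low p r t h x + x * x * m ] ∷
    - (h * h * (ζ * ζ) * ((2 · (p * t * Z) - x) * (2 · (p * t * Z) - x))) ×[ S * S := 1# - 4 · (p * r * (t * t) * (Z * Z) * x) ] ∷
    - (h * h * (ζ * ζ) * (4 · (p * t * Z * x) - 4 · (x * x))) ×[ Z := 1# + τ p r t * (Z * Z * Z) ] ∷
    - (h * h * ((4 · (p * p * (t * t)) - 4 · (p * t * x) - 4 · (p * r * (t * t) * (x * x * x))) * (ζ * Z + 1#) + 4 · (ζ * (x * x)))) ×[ ζ * Z := 1# ] ∷ []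
    ⊢ x * (x * ((n₂ - m) * (2 · low p r t h x + x * x * (n₂ + m)))) := x * (x * (β - h * h * cubic p r t ζ))

  root-unique = infer 6 λ n c low x n₂ m →
    1# ×[ n := low + x * x * n₂ ] ∷ (- 1#) ×[ c := low + x * x * m ] ∷ x * x ×[ n₂ - m := 0# ] ∷ [] ⊢ n := c

  -- As θ + ω = 2pαF, the difference θ² - ω² is 2pαF (θ - ω); the other terms of the cofactor come
  -- from reducing the cubic polynomial and ω² modulo α.
  discriminant-multiple = infer 9 λ p r t x h ζ F n₂ β →
    - (θ p r t x F + (low p r t h x + x * x * n₂)) ×[ θ p r t x F := low p r t h x + x * x * n₂ ] ∷
    - (x * x) ×[ Β p r t h x n₂ := β ] ∷ - (x * x) ×[ β := h * h * cubic p r t ζ ] ∷ []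
    ⊢ x * (x * discriminant p r t h ζ) :=
      α p r t x * (2 · (p * F * (θ p r t x F - ω p r t x)) - 4 · (h * h * p * (t - x)) + 4 · (p * t * (r * r)))

  rational-expression = infer 13 λ p r t x y Z s S S′ P F G c →
    2 · (p * ε p r t Z * α p r t x * α p r t y) ×[ K p r t x y * (r * P + p * (F + G)) := r * (x * y) + p * x * (y - t) * F + p * y * (x - t) * G ] ∷
    p * cofactor p r t x y * ε p r t Z ×[ θ p r t x F := c * root p r t Z x S ] ∷
    p * cofactor p r t y x * ε p r t Z ×[ θ p r t y G := c * root p r t Z y S′ ] ∷
    p * (cofactor p r t x y * root p r t Z x S + cofactor p r t y x * root p r t Z y S′) ×[ c * ε p r t Z := r * s ] ∷ []
    ⊢ r * (denominator p r t Z x y * P) := r * numerator p r t Z s x y S S′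

  -- Modulo t one has K = xy and α(x) = - (1 - p) x, which explains the term in x² y².
  denominator-leading = infer 6 λ p r t x y Z →
    let a = p + r * t * (x * x)
        b = p + r * t * (y * y)
    in [] ⊢ denominator p r t Z x y :=
      x * (x * (y * (y * (2 · (p * ε p r t Z * (1# - p) * (1# - p))))))
        + t * (2 · (p * ε p r t Z) * ((t * a * b - (1# - p) * (x * b + y * a)) * K p r t x y
                                     - (1# - p) * (1# - p) * (x * y) * weight p r t x y))

  unramified-split = infer 9 λ p r t x y ζ P F G →
    2 · (α p r t x * α p r t y * (ζ - 2 · p)) ×[ K p r t x y * (r * P + p * (F + G)) := r * (x * y) + p * x * (y - t) * F + p * y * (x - t) * G ] ∷ []
    ⊢ unramified p r t ζ P x y := cofactor p r t x y * ((ζ - 2 · p) * θ p r t x F) + cofactor p r t y x * ((ζ - 2 · p) * θ p r t y G)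

  ramified-square = infer 8 λ p r t x y ζ n h →
    let b = cofactor p r t x y * cofactor p r t x y in
    - (b * ((ζ - 2 · p) * (ζ - 2 · p))) ×[ n * n := h * h * square p r t x ζ ] ∷
    - (b * square p r t x ζ) ×[ h * h * ((ζ - 2 · p) * (ζ - 2 · p)) - r * r * δ p r t ζ := 0# ] ∷ []
    ⊢ ramified p r t ζ x y := cofactor p r t x y * ((ζ - 2 · p) * n) * (cofactor p r t x y * ((ζ - 2 · p) * n))

  conjugates-vanish = infer 8 λ p r t e b c u v →
    let X = (e * e - b - c) + 2 · (u * v) in
    (e + u + v) * X ×[ e := u + v ] ∷ - X - 4 · c ×[ b := u * u ] ∷ - X - 4 · (u * u) ×[ c := v * v ] ∷ []
    ⊢ conjugates p r t e b c := 0#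

  τ-at-origin = infer 2 λ p r → [] ⊢ τ p r 0# := 0#

  -- At t = 0 and x = y = 1 the factors x (y - t) - K vanish and with them both ramified terms, so
  -- the value is the fourth power of the unramified one; 2p + r = 1 puts it into visibly positive
  -- factors.
  minimal-at-0 = infer 2 λ p r →
    let e = 2 · p * (2 · (r * (1# - p) * (1# - p)))
        f = (p + p) * (r + r) * ((p + r) * (p + r))
    in - (4 · (p * r) * (1# - p + (p + r))) * ((e + f) * (e * e + f * f)) ×[ p + p + r := 1# ] ∷ []
    ⊢ minimal p r 0# 0# 0# 1# 1# := f * f * (f * f)

  minimal-at-1 = infer 2 λ p r →
    let e = (1# - 2 · p) * (2 · (r * (1# - p) * (1# - p)))
        f = r * (r + r) * ((p + r) * (p + r))
    in - (2 · r * ((1# - p) * (1# - p) + r * (1# - p + (p + r)))) * ((e + f) * (e * e + f * f)) ×[ p + p + r := 1# ] ∷ []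
    ⊢ minimal p r 0# 1# 0# 1# 1# := f * f * (f * f)

  square-of-θ = infer 9 λ p r t x h ζ n n₂ β →
    n + (low p r t h x + x * x * n₂) ×[ n := low p r t h x + x * x * n₂ ] ∷
    x * x ×[ Β p r t h x n₂ := β ] ∷ x * x ×[ β := h * h * cubic p r t ζ ] ∷ []
    ⊢ n * n := h * h * square p r t x ζ

  cube = infer 2 λ w ζ → 1# ×[ w := ζ * ζ - ζ * ζ * ζ ] ∷ [] ⊢ ζ * ζ * ζ := ζ * ζ - w

  origin-root = infer 7 λ p r t h ζ Z s →
    1# ×[ h * (1# - 2 · (p * Z)) := r * s ] ∷ h * (1# - 2 · (p * Z)) ×[ ζ * Z := 1# ] ∷ []
    ⊢ h * ζ * ε p r t Z := r * s

  discriminant-root = infer 7 λ p r t h ζ Z u →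
    let y = ζ * Z in
    u * u * (Z * Z) ×[ h * h * ((ζ - 2 · p) * (ζ - 2 · p)) - r * r * δ p r t ζ := 0# ] ∷
    (r * u + 1#) * (δ p r t ζ * (Z * Z)) ×[ r * u := 1# ] ∷
    y + 1# - p * Z - u * u * (h * h) * (1# + y - 4 · (p * Z)) ×[ ζ * Z := 1# ] ∷ []
    ⊢ u * (h * (1# - 2 · (p * Z))) * (u * (h * (1# - 2 · (p * Z)))) := 1# - p * Z * (1# + Z) + p ^ 2 * Z ^ 2

  Z-unfold = infer 5 λ p q r t Z →
    1# ×[ Z := 1# + t * (0# + Z * (0# + Z * (0# + Z * (4 · (p * q * r * (t * t)) + Z * 0#)))) ] ∷ []
    ⊢ Z := 1# + 4 · (p * q * r * t ^ 3 * Z ^ 3)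

  Z-fold = infer 5 λ p q r t Z →
    1# ×[ Z := 1# + 4 · (p * q * r * t ^ 3 * Z ^ 3) ] ∷ []
    ⊢ Z := 1# + t * (0# + Z * (0# + Z * (0# + Z * (4 · (p * q * r * (t * t)) + Z * 0#))))

  one-minus-2pZ-unit = infer 4 λ p r u z →
    - (2 · (p * u)) ×[ z := 1# ] ∷ 1# ×[ r * u := 1# ] ∷ - u ×[ p + p + r := 1# ] ∷ []
    ⊢ (1# + - (p * z + 0# + (p * z + 0# + 0#))) * u := 1#

  discriminant-constant = infer 2 λ p z →
    p + p * z + p - p * p * z - p * p ×[ z := 1# ] ∷ []
    ⊢ (1# - p) * (1# - p) := 1# - p * z * (1# + z) + p ^ 2 * z ^ 2

  reciprocal-total = infer 3 λ p r u →
    1# ×[ (p + r + (p + r)) * u := 1# ] ∷ (- (u + u)) ×[ p + p + r := 1# ] ∷ []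
    ⊢ (1# - p + (1# - p)) * u := 1#

  product-inverse = infer 4 λ a D Z ζ →
    a * D ×[ ζ * Z := 1# ] ∷ 1# ×[ a * D := 1# ] ∷ [] ⊢ Z * a * (ζ * D) := 1#

  Δ₊-at-0 = infer 5 λ p q r Z x → [] ⊢ 1# - 4 · (p * q * r * 0# ^ 2 * Z ^ 2 * x) := 1#

  leading-constant = infer 3 λ p r z →
    2 · (p * (1# - p) * (1# - p) * (1# - 2 · (p * z) - 2 · p)) ×[ z := 1# ] ∷
    - (2 · (p * (1# - p) * (1# - p))) ×[ p + p + r := 1# ] ∷ []
    ⊢ 2 · (p * ε p r 0# z * (1# - p) * (1# - p)) := (p + p) * r * ((1# - p) * (1# - p))

  complement = infer 2 λ p r → 1# ×[ p + p + r := 1# ] ∷ [] ⊢ p + r := 1# - p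

  root-constant = infer 5 λ p r u v z →
    p + r ×[ r * u := 1# ] ∷ u * (1# - 2 · (p * z)) * p ×[ v := 1# ] ∷
    - (2 · (u * (p + r) * p)) ×[ z := 1# ] ∷ 1# - u * (p + r) ×[ p + p + r := 1# ] ∷ []
    ⊢ u * ((p * v + r) * (1# - 2 · (p * z))) := 1# - p

  root-scaled = infer 4 λ r u w s → - w ×[ r * u := 1# ] ∷ r ×[ u * w := s ] ∷ [] ⊢ w := r * s

  origin-formula = infer 9 λ p r t V Z s D π ρ →
    π * D ×[ (p * V + r) * (1# - 2 · (p * Z)) := r * s ] ∷
    - (π * (p * V + r)) ×[ (1# - 2 · (p * Z)) * D := 1# ] ∷
    - V - ρ * (1# - s * D) ×[ p * π := 1# ] ∷
    π * (1# - s * D) ×[ ρ * p := r ] ∷ []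
    ⊢ V := ρ * (s * D - 1#)

  -- α(px) is p times the axis factor `a`, so θ at px contains 2p² `a` `f`; the right side follows
  -- from hζ = rsE.
  axis-formula = infer 15 λ p r t x V Z ζ s S f E π c w h →
    let a = t - x * (1# - p) + p * r * x ^ 2 * t ^ 2
        b = (2 · (t * Z) - x) * s * S * E - 2 · t + x * (1# - p)
        d = 1# - 2 · (p * Z)
        m = w * π * p * (2 · (t * Z) - x) * S
    in
    - (a * f - c * b) ×[ (p + p) * w := 1# ] ∷ - (w * b) ×[ c * (p + p) := r ] ∷
    - (w * ((p + p) * (a * f) - r * b)) ×[ π * p := 1# ] ∷
    w * π ×[ θ p r t (p * x) f := h * ζ * root p r t Z (p * x) S ] ∷
    - (m * h * ζ) ×[ Z * d * E := 1# ] ∷ m * h * d * E ×[ ζ * Z := 1# ] ∷ m * E ×[ h * d := r * s ] ∷ []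
    ⊢ a * f := c * b

  axis-factor-at-0 = infer 4 λ p r t x →
    p * r * x * t ^ 2 - (1# - p) ×[ x := 0# ] ∷ [] ⊢ t - x * (1# - p) + p * r * x ^ 2 * t ^ 2 := t

  τ-reciprocal = infer 5 λ p r t Z ζ →
    - (ζ * ζ * ζ) ×[ Z := 1# + τ p r t * (Z * Z * Z) ] ∷
    ζ * ζ - τ p r t * (ζ * Z * (ζ * Z) + ζ * Z + 1#) ×[ ζ * Z := 1# ] ∷ []
    ⊢ τ p r t := ζ * ζ - ζ * ζ * ζ

  -- By τ = ζ² - ζ³, p times the discriminant is h² (ζ³ - (1 + 3p) ζ² + 4pζ - 4p² (1 - p)) - r² (ζ³
  -- - ζ² + p (1 - p)²), and ζ - (1 - p) divides both cubics.
  discriminant-factor = infer 5 λ p r t h ζ →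
    p ×[ discriminant p r t h ζ := 0# ] ∷ h * h - r * r ×[ τ p r t := ζ * ζ - ζ * ζ * ζ ] ∷ []
    ⊢ (h * h * ((ζ - 2 · p) * (ζ - 2 · p)) - r * r * δ p r t ζ) * (ζ - (1# - p)) := 0#

module NormLemmas {c ℓ} (R : CommutativeRing c ℓ) where
  open LinearCombination R
  module _ {n : ℕ} where
    open RingNotation (Syntax n) public
    open Norm (Syntax n) public

  norm-multiple = infer 5 λ ζ τ a b c →
    let d = cofactor₀ τ a b c
        e = cofactor₁ τ a b c
        f = cofactor₂ τ a b c
    in
    d + ζ * e + ζ * ζ * f ×[ a + ζ * b + ζ * ζ * c := 0# ] ∷
    - (ζ * c * f + b * f + c * e + c * f) ×[ ζ * ζ * ζ := ζ * ζ - τ ] ∷ []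
    ⊢ norm τ a b c := 0#

  norm-degenerate = infer 4 λ τ a b c →
    a * c * (b + c) - c * cofactor₁ τ a b c - (b + c) * cofactor₂ τ a b c ×[ τ := 0# ] ∷ []
    ⊢ norm τ a b c := a * (a * (a + b + c))

  at-zero = infer 3 λ a b c → [] ⊢ a + 0# * b + 0# * 0# * c := a

  at-one = infer 3 λ a b c → [] ⊢ a + 1# * b + 1# * 1# * c := a + b + c

  horner-step = infer 6 λ ζ τ e a b c →
    c ×[ ζ * ζ * ζ := ζ * ζ - τ ] ∷ []
    ⊢ e + ζ * (a + ζ * b + ζ * ζ * c) := (e - τ * c) + ζ * a + ζ * ζ * (b + c)

module OriginLemmas {c ℓ} (R : CommutativeRing c ℓ) where
  open LinearCombination R
  module _ {n : ℕ} where
    open RingNotation (Syntax n) public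
    open OriginFormulas (Syntax n) public
    open Norm (Syntax n) using (norm) public

  shift-unknown = infer 9 λ p r V c₀ c₁ c₂ c₃ c₄ c₅ →
    p ^ 5 ×[ quintic p r c₀ c₁ c₂ c₃ c₄ c₅ V := 0# ] ∷ [] ⊢
    quintic p r (g₀ p r c₀ c₁ c₂ c₃ c₄ c₅) (g₁ p r c₀ c₁ c₂ c₃ c₄ c₅) (g₂ p r c₀ c₁ c₂ c₃ c₄ c₅)
                (g₃ p r c₀ c₁ c₂ c₃ c₄ c₅) (g₄ p r c₀ c₁ c₂ c₃ c₄ c₅) (g₅ p r c₀ c₁ c₂ c₃ c₄ c₅) (p * V + r) := 0#

  -- Y² (ζ - 2p)² = r² δ(ζ) turns the even and odd parts in Y into forms in (ζ - 2p)² and χ.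
  even-odd = infer 10 λ p r ζ Y a b c a′ b′ c′ →
    let u = r * r * χ p r ζ
        d = D p r ζ * D p r ζ
        v = (4 · (p * (Y * Y)) + e p r) * d
    in
    16 · (p * p * (d * d)) ×[ quintic p r a a′ b b′ c c′ Y := 0# ] ∷
    - (4 · (p * ((λ₁ p r b c * d + c * (u + v)) + Y * (λ₁ p r b′ c′ * d + c′ * (u + v))))) ×[ Y * Y * (D p r ζ * D p r ζ) - r * r * δ₀ p r ζ := 0# ] ∷ []
    ⊢ form p r a b c ζ + Y * form p r a′ b′ c′ ζ := 0#

  -- Multiplication by the conjugate f - Yg leaves only Y², which is known.
  norm-form = infer 6 λ p r ζ Y f g →
    (f - Y * g) * (D p r ζ * D p r ζ) ×[ f + Y * g := 0# ] ∷ g * g ×[ Y * Y * (D p r ζ * D p r ζ) - r * r * δ₀ p r ζ := 0# ] ∷ []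
    ⊢ f * f * (D p r ζ * D p r ζ) + g * g * - (r * r * δ₀ p r ζ) := 0#

  form-slope = infer 9 λ p r X a b c a′ b′ c′ → [] ⊢
    form p r (a + X * X * a′) (b + X * X * b′) (c + X * X * c′) X :=
      16 · (p * p * (p * p)) * λ₀ p r a b c + X * slope p r a b c a′ b′ c′ X

  slope-at-0 = infer 8 λ p r a b c a′ b′ c′ →
    - (32 · (p * (p * p))) ×[ λ₀ p r a b c := 0# ] ∷ []
    ⊢ slope p r a b c a′ b′ c′ 0# := - (16 · (p * p * p * (r * r))) * λ₁ p r b c

  form-at-1 = infer 5 λ p r a b c →
    1# ×[ form p r a b c 1# := 0# ] ∷ - (D p r 1# * D p r 1# * (D p r 1# * D p r 1#)) ×[ λ₀ p r a b c := 0# ] ∷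
    - (r * r * (D p r 1# * D p r 1#) * χ p r 1#) ×[ λ₁ p r b c := 0# ] ∷ []
    ⊢ c * (r * r * (1# - p) * (r * r * (1# - p))) := 0#

  solve-λ₁ = infer 4 λ p r b c → 1# ×[ λ₁ p r b c := 0# ] ∷ 2 · e p r ×[ c := 0# ] ∷ [] ⊢ b * (4 · p) := 0#

  solve-λ₀ = infer 5 λ p r a b c →
    1# ×[ λ₀ p r a b c := 0# ] ∷ 4 · (p * e p r) ×[ b := 0# ] ∷ - (e p r * e p r) ×[ c := 0# ] ∷ []
    ⊢ a * (16 · (p * p)) := 0#

  solve-g₄ = infer 8 λ p r c₀ c₁ c₂ c₃ c₄ c₅ →
    1# ×[ g₄ p r c₀ c₁ c₂ c₃ c₄ c₅ := 0# ] ∷ 5 · r ×[ c₅ := 0# ] ∷ [] ⊢ c₄ * p := 0#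

  solve-g₃ = infer 8 λ p r c₀ c₁ c₂ c₃ c₄ c₅ →
    1# ×[ g₃ p r c₀ c₁ c₂ c₃ c₄ c₅ := 0# ] ∷ - (10 · r ^ 2) ×[ c₅ := 0# ] ∷ 4 · (r * p) ×[ c₄ := 0# ] ∷ []
    ⊢ c₃ * p * p := 0#

  solve-g₂ = infer 8 λ p r c₀ c₁ c₂ c₃ c₄ c₅ →
    1# ×[ g₂ p r c₀ c₁ c₂ c₃ c₄ c₅ := 0# ] ∷ 10 · r ^ 3 ×[ c₅ := 0# ] ∷ - (6 · (r ^ 2 * p)) ×[ c₄ := 0# ] ∷
    3 · (r * p * p) ×[ c₃ := 0# ] ∷ []
    ⊢ c₂ * p * p * p := 0#

  solve-g₁ = infer 8 λ p r c₀ c₁ c₂ c₃ c₄ c₅ →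
    1# ×[ g₁ p r c₀ c₁ c₂ c₃ c₄ c₅ := 0# ] ∷ - (5 · r ^ 4) ×[ c₅ := 0# ] ∷ 4 · (r ^ 3 * p) ×[ c₄ := 0# ] ∷
    - (3 · (r ^ 2 * p * p)) ×[ c₃ := 0# ] ∷ 2 · (r * p * p * p) ×[ c₂ := 0# ] ∷ []
    ⊢ c₁ * p * p * p * p := 0#

  solve-g₀ = infer 8 λ p r c₀ c₁ c₂ c₃ c₄ c₅ →
    1# ×[ g₀ p r c₀ c₁ c₂ c₃ c₄ c₅ := 0# ] ∷ r ^ 5 ×[ c₅ := 0# ] ∷ - (r ^ 4 * p) ×[ c₄ := 0# ] ∷
    r ^ 3 * p * p ×[ c₃ := 0# ] ∷ - (r ^ 2 * p * p * p) ×[ c₂ := 0# ] ∷ r * p * p * p * p ×[ c₁ := 0# ] ∷ []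
    ⊢ c₀ * p * p * p * p * p := 0#

  quadratic-in-ζ = infer 4 λ p r V ζ →
    let v = (p * V + r) * (p * V + r) in
    1# ×[ v * (D p r ζ * D p r ζ) - r * r * δ₀ p r ζ := 0# ] ∷ []
    ⊢ (4 · (p * p * v) + r * r * (p * (1# - p))) + ζ * (r * r * p - 4 · (p * v)) + ζ * ζ * (v - r * r) := 0#

  -- The extreme coefficients `n₃` and `n₀` are the norms of (ζ - 2p)² and - r² δ(ζ). The former is
  -- the leading one and has to be nonzero for the degree 6.
  norm-of-square = infer 4 λ p r τ v →
    1# ×[ norm τ (4 · (p * p * v) + r * r * (p * (1# - p))) (r * r * p - 4 · (p * v)) (v - r * r) := 0# ] ∷ []
    ⊢ n₀ p r τ + n₁ p r τ * v + n₂ p r τ * (v * v) + n₃ p r τ * (v * v * v) := 0#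

  minimal-polynomial = infer 14 λ p r V m₀ m₁ m₂ m₃ c₀ c₁ c₂ c₃ c₄ c₅ c₆ →
    let v = (p * V + r) * (p * V + r) in
    1# ×[ m₀ + m₁ * v + m₂ * (v * v) + m₃ * (v * v * v) := 0# ] ∷
    1# ×[ c₀ := r ^ 6 * m₃ + r ^ 4 * m₂ + r ^ 2 * m₁ + m₀ ] ∷
    V ×[ c₁ := p * (6 · (r ^ 5 * m₃) + 4 · (r ^ 3 * m₂) + 2 · (r * m₁)) ] ∷
    V ^ 2 ×[ c₂ := p ^ 2 * (15 · (r ^ 4 * m₃) + 6 · (r ^ 2 * m₂) + m₁) ] ∷
    V ^ 3 ×[ c₃ := p ^ 3 * (20 · (r ^ 3 * m₃) + 4 · (r * m₂)) ] ∷
    V ^ 4 ×[ c₄ := p ^ 4 * (15 · (r ^ 2 * m₃) + m₂) ] ∷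
    V ^ 5 ×[ c₅ := p ^ 5 * (6 · (r * m₃)) ] ∷
    V ^ 6 ×[ c₆ := p ^ 6 * m₃ ] ∷ []
    ⊢ c₀ + V * (c₁ + V * (c₂ + V * (c₃ + V * (c₄ + V * (c₅ + V * (c₆ + V * 0#)))))) := 0#

  leading-at-0 = infer 2 λ p r →
    - (16 · (p ^ 10 * (1# - 2 · p + r))) ×[ p + p + r := 1# ] ∷ []
    ⊢ coefficient₆ p r (Formulas.τ (Syntax 2) p r 0#) := p ^ 6 * ((p + p) * (p + p) * r * ((p + p) * (p + p) * r))

  split-variable = infer 5 λ t a b c d →
    [] ⊢ a + t * (b + t * c + t * t * d) := (a + t * t * t * d) + t * b + t * t * c

  split-sum = infer 10 λ t V q a b c A B C S →
    1# ×[ q := a + t * b + t * t * c ] ∷ V ×[ S := A + t * B + t * t * C ] ∷ []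
    ⊢ q + V * S := (a + V * A) + t * (b + V * B) + t * t * (c + V * C)

  split-head = infer 6 λ s V k c T S →
    1# ×[ k := s * c ] ∷ V ×[ T := s * S ] ∷ [] ⊢ k + V * T := s * (c + V * S)

  truncate = infer 4 λ X k a c → [] ⊢ a + k * (X * X * (1# - X)) * c := a + X * X * (k * (1# - X) * c)

  -- t³ is a constant multiple of τ = ζ² (1 - ζ), hence a multiple of ζ - 1: what kills ζ - 1 kills
  -- t³.
  η-regular = infer 6 λ p r t ζ k f →
    k * f ×[ 4 · (p * p * r * (t * t * t)) := ζ * ζ - ζ * ζ * ζ ] ∷ - (k * (ζ * ζ)) ×[ f * (ζ - 1#) := 0# ] ∷
    - (f * (t * t * t)) ×[ 4 · (p * p * r) * k := 1# ] ∷ []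
    ⊢ f * (t * t * t) := 0#

  D²-at-0 = infer 1 λ p → [] ⊢ (0# - 2 · p) * (0# - 2 · p) := 4 · (p * p)

  δ-at-0 = infer 2 λ p r → [] ⊢ - (r * r * δ₀ p r 0#) := r * r * (p * (1# - p))

  negate = infer 2 λ a b → (- 1#) ×[ - a * b := 0# ] ∷ [] ⊢ b * a := 0#

  cube-right = infer 1 λ t → [] ⊢ t * t * t := t * (t * (t * 1#))

  zero-parts = infer 1 λ t → [] ⊢ 0# := 0# + t * 0# + t * t * 0#

  cube = infer 2 λ τ ζ → 1# ×[ τ := ζ * ζ - ζ * ζ * ζ ] ∷ [] ⊢ ζ * ζ * ζ := ζ * ζ - τ

  cube-assoc = infer 2 λ f t → [] ⊢ f * t * t * t := f * (t * t * t)

  add-back = infer 2 λ a s → [] ⊢ a + (s - a) := s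

  square-of-multiple = infer 7 λ X f g f′ g′ P Q →
    (f + X * f′) * P ×[ f := X * f′ ] ∷ (g + X * g′) * Q ×[ g := X * g′ ] ∷ []
    ⊢ f * f * P + g * g * Q := X * (X * (f′ * f′ * P + g′ * g′ * Q))

  cube-scale = infer 5 λ k p r t ζ →
    - (t * t * t) ×[ 4 · (p * p * r) * k := 1# ] ∷ k ×[ 4 · (p * p * r * (t * t * t)) := ζ * ζ - ζ * ζ * ζ ] ∷ []
    ⊢ t * t * t := k * (ζ * ζ * (1# - ζ))

module KernelIdentities {c ℓ} (R : CommutativeRing c ℓ) (p r t x y : CommutativeRing.Carrier R)
  {k} (k≈K : CommutativeRing._≈_ R k (Formulas.K (CommutativeRing.rawRing R) p r t x y)) where
  open CommutativeRing R

  pull-factor : ∀ x g → k * (x * g) ≈ x * (k * g)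
  pull-factor x g = KernelLemmas.pull-factor R (k ∷ x ∷ g ∷ []) []

  weight : Carrier
  weight = Formulas.weight rawRing p r t x y

  kernel-split : ∀ H → k * H ≈ x * (y * H) - t * (weight * H)
  kernel-split H = KernelLemmas.kernel-split R (p ∷ r ∷ t ∷ x ∷ y ∷ k ∷ H ∷ []) (k≈K ∷ [])

  quotient-x quotient-y : (f g : Carrier) → Carrier
  quotient-x f g = y * g - t * (p * g) - t * (r * (x * (y * (y * g)))) - f
  quotient-y f g = x * g - t * (p * g) - t * (r * (y * (x * (x * g)))) - f

  isolate-x : ∀ {f g} → x * f ≈ k * g → t * (p * (y * g)) ≈ x * quotient-x f g
  isolate-x {f} {g} h = KernelLemmas.isolate-x R (p ∷ r ∷ t ∷ x ∷ y ∷ k ∷ f ∷ g ∷ []) (h ∷ k≈K ∷ [])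

  isolate-y : ∀ {f g} → y * f ≈ k * g → t * (p * (x * g)) ≈ y * quotient-y f g
  isolate-y {f} {g} h = KernelLemmas.isolate-y R (p ∷ r ∷ t ∷ x ∷ y ∷ k ∷ f ∷ g ∷ []) (h ∷ k≈K ∷ [])

module AxisIdentities {c ℓ} (R : CommutativeRing c ℓ) (p r t x : CommutativeRing.Carrier R)
  {a} (a≈α : CommutativeRing._≈_ R a (Formulas.α (CommutativeRing.rawRing R) p r t x)) where
  open CommutativeRing R

  pull-factor : ∀ x g → a * (x * g) ≈ x * (a * g)
  pull-factor x g = KernelLemmas.pull-factor R (a ∷ x ∷ g ∷ []) []

  quotient : (f g : Carrier) → Carrier
  quotient f g = f + (1# - p) * g - r * (t * (t * (x * g)))

  isolate : ∀ {f g} → x * f ≈ a * g → t * (p * g) ≈ x * quotient f g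
  isolate {f} {g} h = KernelLemmas.isolate-α R (p ∷ r ∷ t ∷ x ∷ a ∷ f ∷ g ∷ []) (h ∷ a≈α ∷ [])

-- Formulas along ring homomorphisms

module _ {n : ℕ} where
  module E = RingNotation (exprRing ⊥ n)
  module EF = Formulas (exprRing ⊥ n)

module Transport (A : CommutativeRing c ℓ) (B : CommutativeRing c′ ℓ′)
  {h : CommutativeRing.Carrier A → CommutativeRing.Carrier B}
  (h-homo : IsRingHomomorphism (CommutativeRing.rawRing A) (CommutativeRing.rawRing B) h) where
  private
    module A = CommutativeRing A
    module B = CommutativeRing B
    open IsRingHomomorphism h-homo
    module EA = Evaluation {C = ⊥} A.rawRing (λ ())
    module EB = Evaluation {C = ⊥} B.rawRing (λ ())

  transport : ∀ {n} (e : Expr ⊥ n) ρ → h (EA.⟦ e ⟧ ρ) B.≈ EB.⟦ e ⟧ (Vec.map h ρ)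
  transport (ν i) ρ = B.reflexive (≡.sym (Vec.lookup-map i h ρ))
  transport (e ⊕ f) ρ = B.trans (+-homo _ _) (B.+-cong (transport e ρ) (transport f ρ))
  transport (e ⊗ f) ρ = B.trans (*-homo _ _) (B.*-cong (transport e ρ) (transport f ρ))
  transport (⊝ e) ρ = B.trans (-‿homo _) (B.-‿cong (transport e ρ))
  transport 𝟘 ρ = 0#-homo
  transport 𝟙 ρ = 1#-homo

  private
    eval-cong : ∀ {n} (e : Expr ⊥ n) {ρ ρ′} → Pointwise B._≈_ ρ ρ′ → EB.⟦ e ⟧ ρ B.≈ EB.⟦ e ⟧ ρ′
    eval-cong (ν i) ρ≈ = Pointwise.lookup ρ≈ i
    eval-cong (e ⊕ f) ρ≈ = B.+-cong (eval-cong e ρ≈) (eval-cong f ρ≈)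
    eval-cong (e ⊗ f) ρ≈ = B.*-cong (eval-cong e ρ≈) (eval-cong f ρ≈)
    eval-cong (⊝ e) ρ≈ = B.-‿cong (eval-cong e ρ≈)
    eval-cong 𝟘 ρ≈ = B.refl
    eval-cong 𝟙 ρ≈ = B.refl

  -- Equations are moved between rings by naming the formula once as syntax; its value on either
  -- side is then the formula of that ring by computation.
  push : ∀ {n} (e : Expr ⊥ n) {ρ ρ′} → Pointwise B._≈_ (Vec.map h ρ) ρ′ → h (EA.⟦ e ⟧ ρ) B.≈ EB.⟦ e ⟧ ρ′
  push e {ρ} ρ≈ = B.trans (transport e ρ) (eval-cong e ρ≈)

-- Power series in two and three variables

module TwoVariables (A : CommutativeRing c ℓ) where
  R₁ = SeriesRing.seriesRing A
  R₂ = SeriesRing.seriesRing R₁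

  private
    module A = CommutativeRing A
    module R₁ = CommutativeRing R₁
    module R₂ = CommutativeRing R₂
    module S₁ = SeriesRing A
    module S₂ = SeriesRing R₁

  open R₂ using (_≈_; _*_; _+_; 0#)

  x : R₂.Carrier
  x = const R₁.rawRing (var A.rawRing)

  fromT : R₁.Carrier → R₂.Carrier
  fromT f n = const A.rawRing (f n)

  fromT-homo : IsRingHomomorphism R₁.rawRing R₂.rawRing fromT
  fromT-homo = MapSeries.map-homo A R₁ S₁.const-homo

  atX=0 : R₂.Carrier → R₁.Carrier
  atX=0 f n = f n 0

  atX=0-homo : IsRingHomomorphism R₂.rawRing R₁.rawRing atX=0
  atX=0-homo = MapSeries.map-homo R₁ A S₁.constantTerm-homo

  tailX : R₂.Carrier → R₂.Carrier
  tailX f n i = f n (suc i)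

  x-* : ∀ f n → (x * f) n R₁.≈ var A.rawRing R₁.* f n
  x-* f n = S₂.const-* (var A.rawRing) f n

  x-*-zero : ∀ f n → (x * f) n 0 A.≈ A.0#
  x-*-zero f n = A.trans (x-* f n 0) (S₁.var-*-zero (f n))

  x-*-suc : ∀ f n i → (x * f) n (suc i) A.≈ f n i
  x-*-suc f n i = A.trans (x-* f n (suc i)) (S₁.var-*-suc (f n) i)

  x-*-cancel : ∀ {f g} → x * f ≈ x * g → f ≈ g
  x-*-cancel {f} {g} eq n i = A.trans (A.sym (x-*-suc f n i)) (A.trans (eq n (suc i)) (x-*-suc g n i))

  fromT+x* : ∀ f → f ≈ fromT (atX=0 f) + x * tailX f
  fromT+x* f n i = A.trans (S₁.const+var* (f n) i) (A.+-congˡ (A.sym (x-* (tailX f) n i)))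

  x-divides : ∀ {f} → (∀ n → f n 0 A.≈ A.0#) → f ≈ x * tailX f
  x-divides {f} f₀ n zero = A.trans (f₀ n) (A.sym (x-*-zero (tailX f) n))
  x-divides {f} f₀ n (suc i) = A.sym (x-*-suc (tailX f) n i)

  open SeriesEquations A using (Cancellable; *-cancel-zero)

  -- M has a simple zero X(t) = O(t) in x; a multiple of M free of x vanishes there.
  free-multiple≈0 : ∀ {e M γ} → M 0 0 A.≈ A.0# → Cancellable (M 0 1) → e * M ≈ fromT γ → e ≈ 0#
  free-multiple≈0 {e} {M} {γ} M₀₀ M₀₁ eM≈γ n = vanish (suc n) n ℕ.≤-refl
    where
    M₀≈ : M 0 R₁.≈ var A.rawRing R₁.* S₁.tail (M 0)
    M₀≈ = R₁.trans (S₁.const+var* (M 0)) (R₁.trans (R₁.+-congʳ {var A.rawRing R₁.* S₁.tail (M 0)} const≈0) (R₁.+-identityˡ _))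
      where
      const≈0 : const A.rawRing (M 0 0) R₁.≈ R₁.0#
      const≈0 zero = M₀₀
      const≈0 (suc i) = A.refl

    shifted : ∀ f → f R₁.* M 0 R₁.≈ var A.rawRing R₁.* (f R₁.* S₁.tail (M 0))
    shifted f = R₁.trans (R₁.*-congˡ {f} M₀≈) (R₁.trans (R₁.sym (R₁.*-assoc f (var A.rawRing) (S₁.tail (M 0))))
      (R₁.trans (R₁.*-congʳ {S₁.tail (M 0)} (R₁.*-comm f (var A.rawRing))) (R₁.*-assoc (var A.rawRing) f (S₁.tail (M 0)))))

    -- If e has no terms below tᵏ, then the coefficient of tᵏ in e M is e k · M 0, and it has to be
    -- free of x although M 0 is x times a regular series.
    vanish : ∀ n k → k ℕ.< n → e k R₁.≈ R₁.0#
    vanish (suc n) k k<1+n = *-cancel-zero {e k} {S₁.tail (M 0)} M₀₁ λ i →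
      A.trans (A.sym (S₁.var-*-suc (e k R₁.* S₁.tail (M 0)) i))
        (A.trans (A.sym (shifted (e k) (suc i)))
          (A.trans (A.sym (S₂.conv-lowest k {e} M (λ j j<k → vanish n j (ℕ.<-≤-trans j<k (ℕ.≤-pred k<1+n))) (suc i)))
            (eM≈γ k (suc i))))

  ι : A.Carrier → R₂.Carrier
  ι s = const R₁.rawRing (const A.rawRing s)

  ι-homo : IsRingHomomorphism A.rawRing R₂.rawRing ι
  ι-homo = compose R₂.trans S₁.const-homo S₂.const-homo

  t : R₂.Carrier
  t = var R₁.rawRing

  ι-* : ∀ s f n i → (ι s * f) n i A.≈ s A.* f n i
  ι-* s f n i = A.trans (S₂.const-* (const A.rawRing s) f n i) (S₁.const-* s (f n) i)

  opaque
    -- Sealed, so that α enters through `axis≈α` only and is never expanded into coefficients.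
    axis : (p r : A.Carrier) → R₂.Carrier
    axis p r = Formulas.α R₂.rawRing (ι p) (ι r) t x

    axis≈α : ∀ p r → axis p r ≈ Formulas.α R₂.rawRing (ι p) (ι r) t x
    axis≈α p r n i = A.refl

  module _ (p r : A.Carrier) (p-cancellable : Cancellable p) where
    open AxisIdentities R₂ (ι p) (ι r) t x {axis p r} (axis≈α p r)

    -- Modulo x the polynomial α is pt; hence ptg, and with it g, has no term free of x.
    cancel-axis : ∀ {f g} → x * f ≈ axis p r * g → ∃ λ g′ → f ≈ axis p r * g′
    cancel-axis {f} {g} xf≈αg = tailX g , x-*-cancel {f} {axis p r * tailX g} λ n i → A.trans (xf≈αg n i)
      (A.trans (R₂.*-congˡ {axis p r} {g} {x * tailX g} (x-divides g₀) n i) (pull-factor x (tailX g) n i))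
      where
      g₀ : ∀ n → g n 0 A.≈ A.0#
      g₀ n = p-cancellable (g n 0) (A.trans (A.*-comm (g n 0) p) (A.trans
        (A.sym (A.trans (S₂.var-*-suc (ι p * g) n 0) (ι-* p g n 0)))
        (A.trans (isolate {f} {g} xf≈αg (suc n) 0) (x-*-zero (quotient f g) (suc n)))))

module ThreeVariables (A : CommutativeRing c ℓ) where
  open TwoVariables A public using (R₁; R₂)
  R₃ = SeriesRing.seriesRing R₂

  private
    module A = CommutativeRing A
    module R₁ = CommutativeRing R₁
    module R₂ = CommutativeRing R₂
    module R₃ = CommutativeRing R₃
    module S₁ = SeriesRing A
    module S₂ = SeriesRing R₁
    module S₃ = SeriesRing R₂

  open R₃ using (_≈_; _*_; _+_; 0#; _-_)

  ι : A.Carrier → R₃.Carrier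
  ι s = const R₂.rawRing (const R₁.rawRing (const A.rawRing s))

  x y t : R₃.Carrier
  x = const R₂.rawRing (const R₁.rawRing (var A.rawRing))
  y = const R₂.rawRing (var R₁.rawRing)
  t = var R₂.rawRing

  ι-homo : IsRingHomomorphism A.rawRing R₃.rawRing ι
  ι-homo = compose R₃.trans (compose R₂.trans S₁.const-homo S₂.const-homo) S₃.const-homo

  inX inY : R₂.Carrier → R₃.Carrier
  inX f n = const R₁.rawRing (f n)
  inY f n j = const A.rawRing (f n j)

  inX-homo : IsRingHomomorphism R₂.rawRing R₃.rawRing inX
  inX-homo = MapSeries.map-homo R₁ R₂ S₂.const-homo

  inY-homo : IsRingHomomorphism R₂.rawRing R₃.rawRing inY
  inY-homo = MapSeries.map-homo R₁ R₂ (MapSeries.map-homo A R₁ S₁.const-homo)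

  inX-ι : ∀ s → inX (const R₁.rawRing (const A.rawRing s)) ≈ ι s
  inX-ι s = MapSeries.map-const R₁ R₂ S₂.const-homo (const A.rawRing s)

  inX-x : inX (const R₁.rawRing (var A.rawRing)) ≈ x
  inX-x = MapSeries.map-const R₁ R₂ S₂.const-homo (var A.rawRing)

  inX-t : inX (var R₁.rawRing) ≈ t
  inX-t = MapSeries.map-var R₁ R₂ S₂.const-homo

  private
    const-cong : ∀ {a b} → a R₂.≈ b → const R₂.rawRing a ≈ const R₂.rawRing b
    const-cong = IsRingHomomorphism.⟦⟧-cong S₃.const-homo

  inY-ι : ∀ s → inY (const R₁.rawRing (const A.rawRing s)) ≈ ι s
  inY-ι s = R₃.trans (MapSeries.map-const R₁ R₂ (MapSeries.map-homo A R₁ S₁.const-homo) (const A.rawRing s))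
    (const-cong (MapSeries.map-const A R₁ S₁.const-homo s))

  inY-x : inY (const R₁.rawRing (var A.rawRing)) ≈ y
  inY-x = R₃.trans (MapSeries.map-const R₁ R₂ (MapSeries.map-homo A R₁ S₁.const-homo) (var A.rawRing))
    (const-cong (MapSeries.map-var A R₁ S₁.const-homo))

  inY-t : inY (var R₁.rawRing) ≈ t
  inY-t = MapSeries.map-var R₁ R₂ (MapSeries.map-homo A R₁ S₁.const-homo)

  fromT : R₁.Carrier → R₃.Carrier
  fromT f n = const R₁.rawRing (const A.rawRing (f n))

  inY-fromT : ∀ f → inY (TwoVariables.fromT A f) ≈ fromT f
  inY-fromT f n zero = R₁.refl
  inY-fromT f n (suc j) zero = A.refl
  inY-fromT f n (suc j) (suc i) = A.refl

  ι-* : ∀ s f n j i → (ι s * f) n j i A.≈ s A.* f n j i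
  ι-* s f n j i = A.trans (S₃.const-* (const R₁.rawRing (const A.rawRing s)) f n j i) (A.trans (S₂.const-* (const A.rawRing s) (f n) j i) (S₁.const-* s (f n j) i))

  private
    x-* : ∀ f n j → (x * f) n j R₁.≈ var A.rawRing R₁.* f n j
    x-* f n j = R₁.trans (S₃.const-* (const R₁.rawRing (var A.rawRing)) f n j) (S₂.const-* (var A.rawRing) (f n) j)

  x-*-zero : ∀ f n j → (x * f) n j 0 A.≈ A.0#
  x-*-zero f n j = A.trans (x-* f n j 0) (S₁.var-*-zero (f n j))

  x-*-suc : ∀ f n j i → (x * f) n j (suc i) A.≈ f n j i
  x-*-suc f n j i = A.trans (x-* f n j (suc i)) (S₁.var-*-suc (f n j) i)

  y-*-zero : ∀ f n i → (y * f) n 0 i A.≈ A.0#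
  y-*-zero f n i = A.trans (S₃.const-* (var R₁.rawRing) f n 0 i) (S₂.var-*-zero (f n) i)

  y-*-suc : ∀ f n j i → (y * f) n (suc j) i A.≈ f n j i
  y-*-suc f n j i = A.trans (S₃.const-* (var R₁.rawRing) f n (suc j) i) (S₂.var-*-suc (f n) j i)

  t-*-suc : ∀ f n j i → (t * f) (suc n) j i A.≈ f n j i
  t-*-suc f n j i = S₃.var-*-suc f n j i

  t-*-zero : ∀ f j i → (t * f) 0 j i A.≈ A.0#
  t-*-zero f j i = S₃.var-*-zero f j i

  x-*-cancel : ∀ {f g} → x * f ≈ x * g → f ≈ g
  x-*-cancel {f} {g} eq n j i = A.trans (A.sym (x-*-suc f n j i)) (A.trans (eq n j (suc i)) (x-*-suc g n j i))

  y-*-cancel : ∀ {f g} → y * f ≈ y * g → f ≈ g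
  y-*-cancel {f} {g} eq n j i = A.trans (A.sym (y-*-suc f n j i)) (A.trans (eq n (suc j) i) (y-*-suc g n j i))

  opaque
    kernel : (p r : A.Carrier) → R₃.Carrier
    kernel p r = Formulas.K R₃.rawRing (ι p) (ι r) t x y

    kernel≈K : ∀ p r → kernel p r ≈ Formulas.K R₃.rawRing (ι p) (ι r) t x y
    kernel≈K p r n j i = A.refl

  module KernelDivisibility (p r : A.Carrier) (p-cancellable : SeriesEquations.Cancellable A p) where
    open KernelIdentities R₃ (ι p) (ι r) t x y {kernel p r} (kernel≈K p r)

    private
      p*≈0 : ∀ {a} → p A.* a A.≈ A.0# → a A.≈ A.0#
      p*≈0 pa≈0 = p-cancellable _ (A.trans (A.*-comm _ p) pa≈0)

    cancel-x : ∀ {f g} → x * f ≈ kernel p r * g → ∃ λ g′ → f ≈ kernel p r * g′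
    cancel-x {f} {g} xf≈Kg = g′ , x-*-cancel {f} {kernel p r * g′} λ n j i → A.trans (xf≈Kg n j i)
      (A.trans (R₃.*-congˡ {kernel p r} {g} {x * g′} g≈xg′ n j i) (pull-factor x g′ n j i))
      where
      g′ : R₃.Carrier
      g′ n j i = g n j (suc i)

      g≈xg′ : g ≈ x * g′
      -- At the degrees n + 1 in t and j + 1 in y, `isolate-x` exhibits p times the coefficient of g
      -- that has to vanish.
      g≈xg′ n j zero = A.trans (p*≈0 (A.trans (A.sym (A.trans (t-*-suc (ι p * (y * g)) n (suc j) 0)
        (A.trans (ι-* p (y * g) n (suc j) 0) (A.*-congˡ (y-*-suc g n j 0)))))
        (A.trans (isolate-x {f} {g} xf≈Kg (suc n) (suc j) 0) (x-*-zero (quotient-x f g) (suc n) (suc j))))) (A.sym (x-*-zero g′ n j))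
      g≈xg′ n j (suc i) = A.sym (x-*-suc g′ n j i)

    cancel-y : ∀ {f g} → y * f ≈ kernel p r * g → ∃ λ g′ → f ≈ kernel p r * g′
    cancel-y {f} {g} yf≈Kg = g′ , y-*-cancel {f} {kernel p r * g′} λ n j i → A.trans (yf≈Kg n j i)
      (A.trans (R₃.*-congˡ {kernel p r} {g} {y * g′} g≈yg′ n j i) (pull-factor y g′ n j i))
      where
      g′ : R₃.Carrier
      g′ n j i = g n (suc j) i

      g≈yg′ : g ≈ y * g′
      g≈yg′ n zero i = A.trans (p*≈0 (A.trans (A.sym (A.trans (t-*-suc (ι p * (x * g)) n 0 (suc i))
        (A.trans (ι-* p (x * g) n 0 (suc i)) (A.*-congˡ (x-*-suc g n 0 i)))))
        (A.trans (isolate-y {f} {g} yf≈Kg (suc n) 0 (suc i)) (y-*-zero (quotient-y f g) (suc n) (suc i))))) (A.sym (y-*-zero g′ n i))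
      g≈yg′ n (suc j) i = A.sym (y-*-suc g′ n j i)

    -- A decoupled multiple of the kernel is trivial: K ≡ xy modulo t.
    decoupled : ∀ {B H} → inX B - inY B ≈ kernel p r * H → ∃ λ β → B R₂.≈ TwoVariables.fromT A β
    decoupled {B} {H} eq = TwoVariables.atX=0 A B , λ { n zero → A.refl ; n (suc i) → B-tail n i }
      where
      open Algebra.Properties.Ring A.ring using (-0#≈0#)

      Below : ℕ → Set _
      Below n = ∀ {k} → k ℕ.< n → ∀ j i → H k j i A.≈ A.0#

      tail≈0 : ∀ n → Below n → ∀ j i → (t * (weight * H)) n j i A.≈ A.0#
      tail≈0 zero H-below j i = t-*-zero (weight * H) j i
      tail≈0 (suc n) H-below j i = A.trans (t-*-suc (weight * H) n j i) (A.trans (R₃.*-comm weight H n j i)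
        (S₃.conv-zeroˡ n {H} weight (λ k k≤n → H-below (s≤s k≤n)) j i))

      leading : ∀ n → Below n → ∀ j i → (inX B - inY B) n j i A.≈ (x * (y * H)) n j i
      leading n H-below j i = A.trans (eq n j i) (A.trans (kernel-split H n j i)
        (A.trans (A.+-congˡ (A.trans (A.-‿cong (tail≈0 n H-below j i)) -0#≈0#)) (A.+-identityʳ _)))

      vanish : ∀ n j i → (inX B - inY B) n (suc j) (suc i) A.≈ A.0#
      vanish n j i = A.trans (A.+-identityˡ (A.- A.0#)) -0#≈0#

      -- At the lowest order in t at which H can be nonzero, B(x) - B(y) equals xyH; every term of
      -- xyH is mixed in x and y, and B(x) - B(y) has no mixed terms.
      H≈0 : ∀ n j i → H n j i A.≈ A.0#
      H≈0 = <-rec (λ n → ∀ j i → H n j i A.≈ A.0#) λ n H-below j i →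
        A.trans (A.sym (A.trans (x-*-suc (y * H) n (suc j) i) (y-*-suc H n j i)))
          (A.trans (A.sym (leading n H-below (suc j) (suc i))) (vanish n j i))

      difference : ∀ n i → (inX B - inY B) n 0 (suc i) A.≈ B n (suc i)
      difference n i = A.trans (A.+-congˡ -0#≈0#) (A.+-identityʳ (B n (suc i)))

      B-tail : ∀ n i → B n (suc i) A.≈ A.0#
      B-tail n i = A.trans (A.sym (difference n i)) (A.trans (leading n (λ {k} _ → H≈0 k) 0 (suc i))
        (A.trans (x-*-suc (y * H) n 0 i) (y-*-zero H n i)))

-- Explicit polynomials for the series of all walks

module ExplicitPolynomials {c ℓ₁ ℓ₂ ℓ₃} (ℝ : RealField c ℓ₁ ℓ₂ ℓ₃) (p r : RealField.Carrier ℝ)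
  (p>0 : RealField._<_ ℝ (RealField.0# ℝ) p) (r>0 : RealField._<_ ℝ (RealField.0# ℝ) r)
  (2p+r≈1 : RealField._≈_ ℝ (RealField._+_ ℝ (RealField._+_ ℝ p p) r) (RealField.1# ℝ))
  where
  open RealFacts ℝ
  open RealField ℝ using (_#_; +-pos)
  open PolynomialArithmetic ℝ
  open Polynomials ℝ
  open Algebra.Apartness.Properties.HeytingCommutativeRing (RealField.heytingCommutativeRing ℝ) using (#-congʳ; x#0y#0→xy#0)
  private
    module A = CommutativeRing realRing
    C = A.Carrier

    module X {n : ℕ} where
      open RingNotation (exprRing C n) public
      open Formulas (exprRing C n) (κ p) (κ r) public

    p#0 : p # A.0#
    p#0 = >0⇒# p>0
    r#0 : r # A.0#
    r#0 = >0⇒# r>0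
    p+r#0 : p A.+ r # A.0#
    p+r#0 = >0⇒# (+-pos p>0 r>0)
    double#0 : ∀ {a} → RealField._<_ ℝ A.0# a → a A.+ a # A.0#
    double#0 a>0 = >0⇒# (+-pos a>0 a>0)

    square#0 : ∀ {a} → a # A.0# → a A.* a # A.0#
    square#0 a#0 = x#0y#0→xy#0 a#0 a#0

  private
    -- Variables: x, y, t, Z, √Δ₋(p/t), √Δ₊(x/p), √Δ₊(y/q).
    denominatorE numeratorE : Expr C 7
    denominatorE = X.denominator (ν 2F) (ν 3F) (ν 0F) (ν 1F)
    numeratorE = X.numerator (ν 2F) (ν 3F) (ν 4F) (ν 0F) (ν 1F) (ν 5F) (ν 6F)

  denominatorP numeratorP : Poly C 7
  denominatorP = proj₁ (represent denominatorE)
  numeratorP = proj₁ (represent numeratorE)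

  module _ (S : CommutativeRing c ℓ₁) {ι : C → CommutativeRing.Carrier S}
    (ι-homo : IsRingHomomorphism A.rawRing (CommutativeRing.rawRing S) ι) where
    open CommutativeRing S
    open RingNotation rawRing using (_·_)
    private
      module F = Formulas rawRing (ι p) (ι r)
      module ι = IsRingHomomorphism ι-homo
      module I = KernelLemmas S

    leading : (t Z : Carrier) → Carrier
    leading t Z = 2 · (ι p * F.ε t Z * (1# - ι p) * (1# - ι p))

    denominator-leading : ∀ x y t Z s Sx Sy → let vars = x ∷ y ∷ t ∷ Z ∷ s ∷ Sx ∷ Sy ∷ [] in
      ∃ λ v → eval rawRing ι denominatorP vars ≈ x * (x * (y * (y * leading t Z))) + t * v
    denominator-leading x y t Z s Sx Sy = _ , trans (proj₂ (represent denominatorE) S ι-homo (x ∷ y ∷ t ∷ Z ∷ s ∷ Sx ∷ Sy ∷ []))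
      (I.denominator-leading (ι p ∷ ι r ∷ t ∷ x ∷ y ∷ Z ∷ []) [])

    module _ {x y t Z s Sx Sy P F G c h ζ : Carrier}
      (kernel : F.K t x y * (ι r * P + ι p * (F + G)) ≈ ι r * (x * y) + ι p * x * (y - t) * F + ι p * y * (x - t) * G) where

      private
        vars : Vec Carrier 7
        vars = x ∷ y ∷ t ∷ Z ∷ s ∷ Sx ∷ Sy ∷ []

      rational : F.θ t x F ≈ c * F.root t Z x Sx → F.θ t y G ≈ c * F.root t Z y Sy → c * F.ε t Z ≈ ι r * s →
        eval rawRing ι denominatorP vars * P ≈ eval rawRing ι numeratorP vars
      rational axis-x axis-y cε = trans (*-congʳ (proj₂ (represent denominatorE) S ι-homo vars))
        (trans cancelled (sym (proj₂ (represent numeratorE) S ι-homo vars)))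
        where
        scaled : ι r * (F.denominator t Z x y * P) ≈ ι r * F.numerator t Z s x y Sx Sy
        scaled = I.rational-expression (ι p ∷ ι r ∷ t ∷ x ∷ y ∷ Z ∷ s ∷ Sx ∷ Sy ∷ P ∷ F ∷ G ∷ c ∷ [])
          (kernel ∷ axis-x ∷ axis-y ∷ cε ∷ [])

        cancelled : F.denominator t Z x y * P ≈ F.numerator t Z s x y Sx Sy
        cancelled = RingLemmas.unit-cancel-both S (ι r ∷ ι (proj₁ (#⇒unit r#0)) ∷ _ ∷ _ ∷ [])
          (trans (sym (ι.*-homo r _)) (trans (ι.⟦⟧-cong (proj₂ (#⇒unit r#0))) ι.1#-homo) ∷ scaled ∷ [])

  private
    -- Variables: ζ, the unknown, x, y, t.
    minimalE : Expr C 5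
    minimalE = X.minimal (ν 4F) (ν 0F) (ν 1F) (ν 2F) (ν 3F)

    τE : Expr C 4
    τE = X.τ (ν 3F)

    normE : Expr C 4
    normE = Norm.norm (exprRing C 4) (ν 0F) (ν 1F) (ν 2F) (ν 3F)

    shiftE : Expr C 3
    shiftE = ν 0F ⊕ (⊝ (ν 1F ⊗ ν 2F))

    -- Remainders modulo ζ³ - ζ² + τ, by Horner's rule.
    remainder : ∀ n → Poly C n → List (Poly C n) → Vec (Poly C n) 3
    remainder n τ [] = constP n A.0# ∷ constP n A.0# ∷ constP n A.0# ∷ []
    remainder n τ (e ∷ es) with remainder n τ es
    ... | a ∷ b ∷ c ∷ [] = substitute shiftE (e ∷ τ ∷ c ∷ []) ∷ a ∷ addP n b c ∷ []

  normP : ∀ n → Poly C n → List (Poly C n) → Poly C n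
  normP n τ es = substitute normE (τ ∷ remainder n τ es)

  module _ (S : CommutativeRing c ℓ₁) {ι : C → CommutativeRing.Carrier S}
    (ι-homo : IsRingHomomorphism A.rawRing (CommutativeRing.rawRing S) ι) where
    open CommutativeRing S
    private
      ev : ∀ n → Poly C n → Vec Carrier n → Carrier
      ev n P = eval rawRing ι {n} P
      module N = NormLemmas S

    private
      value : ∀ n (ρ : Vec Carrier n) → Vec (Poly C n) 3 → Carrier → Carrier
      value n ρ (a ∷ b ∷ c ∷ []) ζ = ev n a ρ + ζ * ev n b ρ + ζ * ζ * ev n c ρ

    eval-remainder : ∀ n τ es (ρ : Vec Carrier n) {ζ} → ζ * ζ * ζ ≈ ζ * ζ - ev n τ ρ →
      ev (suc n) es (ζ ∷ ρ) ≈ value n ρ (remainder n τ es) ζ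
    eval-remainder n τ [] ρ {ζ} cubic = sym (trans (+-cong (trans (+-cong 0≈ (trans (*-congˡ 0≈) (zeroʳ ζ))) (+-identityˡ 0#))
      (trans (*-congˡ 0≈) (zeroʳ _))) (+-identityˡ 0#))
      where
      0≈ : ev n (constP n A.0#) ρ ≈ 0#
      0≈ = eval-0 S ι-homo n ρ
    eval-remainder n τ (e ∷ es) ρ {ζ} cubic with remainder n τ es | eval-remainder n τ es ρ {ζ} cubic
    ... | a ∷ b ∷ c ∷ [] | ih = trans (+-congˡ (*-congˡ ih))
      (trans (N.horner-step (ζ ∷ _ ∷ ev n e ρ ∷ ev n a ρ ∷ ev n b ρ ∷ ev n c ρ ∷ []) (cubic ∷ []))
        (+-cong (+-congʳ (sym (eval-substitute S ι-homo shiftE (e ∷ τ ∷ c ∷ []) ρ))) (*-congˡ (sym (eval-add S ι-homo n b c ρ)))))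

    eval-norm : ∀ n τ es (ρ : Vec Carrier n) {ζ} → ζ * ζ * ζ ≈ ζ * ζ - ev n τ ρ →
      ev (suc n) es (ζ ∷ ρ) ≈ 0# → ev n (normP n τ es) ρ ≈ 0#
    eval-norm n τ es ρ {ζ} cubic root with remainder n τ es | eval-remainder n τ es ρ {ζ} cubic
    ... | a ∷ b ∷ c ∷ [] | eq = trans (eval-substitute S ι-homo normE (τ ∷ a ∷ b ∷ c ∷ []) ρ)
      (N.norm-multiple (ζ ∷ _ ∷ ev n a ρ ∷ ev n b ρ ∷ ev n c ρ ∷ []) (trans (sym eq) root ∷ cubic ∷ []))

  -- Where τ vanishes, the roots of ζ³ - ζ² + τ are 0, 0 and 1.
  norm-nonzero : ∀ n τ es (ρ : Vec C n) → evalℝ n τ ρ A.≈ A.0# →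
    evalℝ (suc n) es (A.0# ∷ ρ) # A.0# → evalℝ (suc n) es (A.1# ∷ ρ) # A.0# → evalℝ n (normP n τ es) ρ # A.0#
  norm-nonzero n τ es ρ τ≈0 at0 at1 with remainder n τ es
    | eval-remainder realRing (identity A.rawRing A.refl) n τ es ρ {A.0#}
        (A.trans (A.zeroʳ _) (A.sym (A.trans (A.+-cong (A.zeroʳ _) (A.-‿cong τ≈0)) (A.-‿inverseʳ A.0#))))
    | eval-remainder realRing (identity A.rawRing A.refl) n τ es ρ {A.1#}
        (A.trans (A.*-identityʳ _) (A.sym (A.trans (A.+-congˡ (A.trans (A.-‿cong τ≈0) -0#≈0#)) (A.+-identityʳ _))))
    where open Algebra.Properties.Ring A.ring using (-0#≈0#)
  ... | a ∷ b ∷ c ∷ [] | eq0 | eq1 = #-congʳ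
    (A.sym (A.trans (eval-substitute realRing (identity A.rawRing A.refl) normE (τ ∷ a ∷ b ∷ c ∷ []) ρ)
      (NormLemmas.norm-degenerate realRing (_ ∷ ev a ∷ ev b ∷ ev c ∷ []) (τ≈0 ∷ []))))
    (x#0y#0→xy#0 a#0 (x#0y#0→xy#0 a#0 (#-congʳ (A.trans eq1 (NormLemmas.at-one realRing (ev a ∷ ev b ∷ ev c ∷ []) [])) at1)))
    where
    ev : Poly C n → C
    ev P = evalℝ n P ρ
    a#0 : ev a # A.0#
    a#0 = #-congʳ (A.trans eq0 (NormLemmas.at-zero realRing (ev a ∷ ev b ∷ ev c ∷ []) [])) at0

  private
    τP : Poly C 4
    τP = proj₁ (represent τE)
    minimalP : Poly C 5
    minimalP = proj₁ (represent minimalE)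

  -- Variables: the unknown, x, y, t.
  annihilator : Poly C 4
  annihilator = normP 4 τP minimalP

  -- At the test point t = 0 the cubic equation of ζ has known roots and the ramified terms vanish,
  -- while x = y = 1 keeps K and α apart from 0.
  annihilator-nonzero : Nonzero 4 annihilator
  annihilator-nonzero = eval#⇒nonzero 4 annihilator ρ (norm-nonzero 4 τP minimalP ρ
    (A.trans (proj₂ (represent τE) realRing id-homo ρ) (KernelLemmas.τ-at-origin realRing (p ∷ r ∷ []) []))
    (#-congʳ (A.sym (A.trans (proj₂ (represent minimalE) realRing id-homo (A.0# ∷ ρ)) (KernelLemmas.minimal-at-0 realRing (p ∷ r ∷ []) (2p+r≈1 ∷ []))))
      (square#0 (square#0 (x#0y#0→xy#0 (x#0y#0→xy#0 (double#0 p>0) (double#0 r>0)) (square#0 p+r#0)))))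
    (#-congʳ (A.sym (A.trans (proj₂ (represent minimalE) realRing id-homo (A.1# ∷ ρ)) (KernelLemmas.minimal-at-1 realRing (p ∷ r ∷ []) (2p+r≈1 ∷ []))))
      (square#0 (square#0 (x#0y#0→xy#0 (x#0y#0→xy#0 r#0 (double#0 r>0)) (square#0 p+r#0))))))
    where
    ρ : Vec C 4
    ρ = A.0# ∷ A.1# ∷ A.1# ∷ A.0# ∷ []
    id-homo : IsRingHomomorphism A.rawRing A.rawRing id
    id-homo = identity A.rawRing A.refl

  module _ (S : CommutativeRing c ℓ₁) {ι : C → CommutativeRing.Carrier S}
    (ι-homo : IsRingHomomorphism A.rawRing (CommutativeRing.rawRing S) ι) where
    open CommutativeRing S
    private
      module F = Formulas rawRing (ι p) (ι r)
      module I = KernelLemmas S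

    -- The square roots hidden in θ(x) and θ(y) disappear in the product of the four conjugates, and
    -- ζ disappears in the norm for ζ³ = ζ² - τ.
    annihilates : ∀ {x y t P F G h ζ} →
      F.K t x y * (ι r * P + ι p * (F + G)) ≈ ι r * (x * y) + ι p * x * (y - t) * F + ι p * y * (x - t) * G →
      F.θ t x F * F.θ t x F ≈ h * h * F.square t x ζ → F.θ t y G * F.θ t y G ≈ h * h * F.square t y ζ →
      h * h * ((ζ - (ι p + (ι p + 0#))) * (ζ - (ι p + (ι p + 0#)))) - ι r * ι r * F.δ t ζ ≈ 0# →
      ζ * ζ * ζ ≈ ζ * ζ - F.τ t →
      eval rawRing ι annihilator (P ∷ x ∷ y ∷ t ∷ []) ≈ 0#
    annihilates {x} {y} {t} {P} {F} {G} {h} {ζ} kernel square-x square-y origin cubic =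
      eval-norm S ι-homo 4 τP minimalP ρ
        (trans cubic (+-congˡ (-‿cong (sym (proj₂ (represent τE) S ι-homo ρ)))))
        (trans (proj₂ (represent minimalE) S ι-homo (ζ ∷ ρ))
          (I.conjugates-vanish (ι p ∷ ι r ∷ t ∷ _ ∷ _ ∷ _ ∷ _ ∷ _ ∷ [])
            (I.unramified-split (ι p ∷ ι r ∷ t ∷ x ∷ y ∷ ζ ∷ P ∷ F ∷ G ∷ []) (kernel ∷ []) ∷
             I.ramified-square (ι p ∷ ι r ∷ t ∷ x ∷ y ∷ ζ ∷ F.θ t x F ∷ h ∷ []) (square-x ∷ origin ∷ []) ∷
             I.ramified-square (ι p ∷ ι r ∷ t ∷ y ∷ x ∷ ζ ∷ F.θ t y G ∷ h ∷ []) (square-y ∷ origin ∷ []) ∷ [])))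
      where
      ρ : Vec Carrier 4
      ρ = P ∷ x ∷ y ∷ t ∷ []

-- Rescaling of x and passage between the series rings

module _ {c ℓ} (R₁ R₂ : CommutativeRing c ℓ) where
  private
    module R₁ = CommutativeRing R₁
    module R₂ = CommutativeRing R₂
  open RingNotation R₂.rawRing

  -- `h` stands for x ↦ x/p, which turns Δ₊ into 1 - 4prt²Z²x because p = q; `g` stands for x ↦ 0.
  module RescaledRoot
    {h : R₂.Carrier → R₂.Carrier} (h-homo : IsRingHomomorphism R₂.rawRing R₂.rawRing h)
    {g : R₂.Carrier → R₁.Carrier} (g-homo : IsRingHomomorphism R₂.rawRing R₁.rawRing g)
    {p q r t Z x π √ Δ : R₂.Carrier}
    (h-p : h p R₂.≈ p) (h-q : h q R₂.≈ q) (h-r : h r R₂.≈ r) (h-t : h t R₂.≈ t) (h-Z : h Z R₂.≈ Z) (h-x : h x R₂.≈ π R₂.* x)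
    (p≈q : p R₂.≈ q) (π*p≈1 : π R₂.* p R₂.≈ R₂.1#) (g-x : g x R₁.≈ R₁.0#)
    (√-square : √ R₂.* √ R₂.≈ Δ)
    (Δ≈ : Δ R₂.≈ 1# - 4 · (p * q * r * t ^ 2 * Z ^ 2 * x))
    where
    private
      module h = IsRingHomomorphism h-homo
      module g = IsRingHomomorphism g-homo
      open Transport R₂ R₂ h-homo using () renaming (push to push-h)
      open Transport R₂ R₁ g-homo using () renaming (push to push-g)

    rescaled-square : h √ R₂.* h √ R₂.≈ R₂.1# R₂.- 4 · (p R₂.* r R₂.* (t R₂.* t) R₂.* (Z R₂.* Z) R₂.* x)
    rescaled-square = KernelLemmas.sqrt-rescaled R₂ (p ∷ q ∷ r ∷ t ∷ Z ∷ x ∷ π ∷ h Δ ∷ h √ ∷ [])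
      (R₂.trans (R₂.sym (h.*-homo √ √)) (h.⟦⟧-cong √-square) ∷
       R₂.trans (h.⟦⟧-cong Δ≈)
         (push-h (E.1# E.- 4 E.· (ν 0F E.* ν 1F E.* ν 2F E.* ν 3F E.^ 2 E.* ν 4F E.^ 2 E.* ν 5F)) {p ∷ q ∷ r ∷ t ∷ Z ∷ x ∷ []}
           (h-p ∷ h-q ∷ h-r ∷ h-t ∷ h-Z ∷ h-x ∷ [])) ∷
       p≈q ∷ π*p≈1 ∷ [])

    constant-square : g (h √) R₁.* g (h √) R₁.≈ R₁.1#
    constant-square = R₁.trans (R₁.sym (g.*-homo (h √) (h √))) (R₁.trans (g.⟦⟧-cong rescaled-square)
      (R₁.trans (push-g (E.1# E.- 4 E.· (ν 0F E.* ν 1F E.* (ν 2F E.* ν 2F) E.* (ν 3F E.* ν 3F) E.* ν 4F)) {p ∷ r ∷ t ∷ Z ∷ x ∷ []}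
        (R₁.refl ∷ R₁.refl ∷ R₁.refl ∷ R₁.refl ∷ R₁.refl ∷ []))
        (KernelLemmas.vanishing-at-0 R₁ (_ ∷ _ ∷ _ ∷ _ ∷ g x ∷ []) (g-x ∷ []))))

  -- Here `h` stands for x ↦ px, which leads from F(x) to Q(px, 0) and from √Δ₊(x/p) back to √Δ₊(x).
  module RescaledAxis
    {h : R₂.Carrier → R₂.Carrier} (h-homo : IsRingHomomorphism R₂.rawRing R₂.rawRing h)
    {g : R₂.Carrier → R₁.Carrier} (g-homo : IsRingHomomorphism R₂.rawRing R₁.rawRing g)
    {p r t x V Z ζ s √ F f S E π c w a b : R₂.Carrier} {t₁ : R₁.Carrier}
    (h-p : h p R₂.≈ p) (h-r : h r R₂.≈ r) (h-t : h t R₂.≈ t) (h-x : h x R₂.≈ p R₂.* x)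
    (h-V : h V R₂.≈ V) (h-Z : h Z R₂.≈ Z) (h-ζ : h ζ R₂.≈ ζ) (h-√ : h √ R₂.≈ S) (h-F : h F R₂.≈ f)
    (g-x : g x R₁.≈ R₁.0#) (g-t : g t R₁.≈ t₁)
    (a≈ : a R₂.≈ t - x * (1# - p) + p * r * x ^ 2 * t ^ 2)
    (b≈ : b R₂.≈ c * ((2 · (t * Z) - x) * s * S * E - 2 · t + x * (1# - p)))
    where
    private
      module h = IsRingHomomorphism h-homo
      module g = IsRingHomomorphism g-homo
      open Transport R₂ R₂ h-homo using () renaming (push to push-h)
      open Transport R₂ R₁ g-homo using () renaming (push to push-g)

    axis-formula : (p R₂.+ p) R₂.* w R₂.≈ R₂.1# → c R₂.* (p R₂.+ p) R₂.≈ r → π R₂.* p R₂.≈ R₂.1# →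
      Formulas.θ R₂.rawRing p r t x F R₂.≈ (p R₂.* V R₂.+ r) R₂.* ζ R₂.* Formulas.root R₂.rawRing p r t Z x √ →
      Z R₂.* (1# - 2 · (p * Z)) R₂.* E R₂.≈ R₂.1# → ζ R₂.* Z R₂.≈ R₂.1# →
      (p R₂.* V R₂.+ r) R₂.* (1# - 2 · (p * Z)) R₂.≈ r R₂.* s →
      a R₂.* f R₂.≈ b
    axis-formula 2pw cp πp root EZ ζZ h√ = R₂.trans (R₂.*-congʳ a≈) (R₂.trans
      (KernelLemmas.axis-formula R₂ (p ∷ r ∷ t ∷ x ∷ V ∷ Z ∷ ζ ∷ s ∷ S ∷ f ∷ E ∷ π ∷ c ∷ w ∷ (p * V + r) ∷ [])
        (2pw ∷ cp ∷ πp ∷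
         R₂.trans (R₂.sym (push-h (EF.θ (ν 0F) (ν 1F) (ν 2F) (ν 3F) (ν 4F)) {p ∷ r ∷ t ∷ x ∷ F ∷ []} (h-p ∷ h-r ∷ h-t ∷ h-x ∷ h-F ∷ [])))
           (R₂.trans (h.⟦⟧-cong root)
             (push-h ((ν 0F E.* ν 4F E.+ ν 1F) E.* ν 6F E.* EF.root (ν 0F) (ν 1F) (ν 2F) (ν 5F) (ν 3F) (ν 7F))
               {p ∷ r ∷ t ∷ x ∷ V ∷ Z ∷ ζ ∷ √ ∷ []} (h-p ∷ h-r ∷ h-t ∷ h-x ∷ h-V ∷ h-Z ∷ h-ζ ∷ h-√ ∷ []))) ∷
         EZ ∷ ζZ ∷ h√ ∷ []))
      (R₂.sym b≈))

    axis-factor-at-0 : g a R₁.≈ t₁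
    axis-factor-at-0 = R₁.trans (g.⟦⟧-cong a≈) (R₁.trans
      (push-g (ν 2F E.- ν 3F E.* (E.1# E.- ν 0F) E.+ ν 0F E.* ν 1F E.* ν 3F E.^ 2 E.* ν 2F E.^ 2) {p ∷ r ∷ t ∷ x ∷ []}
        (R₁.refl ∷ R₁.refl ∷ R₁.refl ∷ R₁.refl ∷ []))
      (R₁.trans (KernelLemmas.axis-factor-at-0 R₁ (g p ∷ g r ∷ g t ∷ g x ∷ []) (g-x ∷ [])) g-t))

  module KernelTransfer
    {g : R₁.Carrier → R₂.Carrier} (g-homo : IsRingHomomorphism R₁.rawRing R₂.rawRing g)
    {p r V Z s : R₁.Carrier} {p′ r′ : R₂.Carrier} (g-p : g p R₂.≈ p′) (g-r : g r R₂.≈ r′)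
    where
    open RingNotation R₁.rawRing using () renaming (_·_ to _·₁_; _-_ to _-₁_)
    open RingNotation R₂.rawRing using () renaming (_·_ to _·₂_; _-_ to _-₂_)
    open Transport R₁ R₂ g-homo
    private module g = IsRingHomomorphism g-homo

    transfer : (p R₁.* V R₁.+ r) R₁.* (R₁.1# -₁ 2 ·₁ (p R₁.* Z)) R₁.≈ r R₁.* s →
      (p′ R₂.* g V R₂.+ r′) R₂.* (R₂.1# -₂ 2 ·₂ (p′ R₂.* g Z)) R₂.≈ r′ R₂.* g s
    transfer eq = R₂.trans
      (R₂.sym (push ((ν 0F E.* ν 2F E.+ ν 1F) E.* (E.1# E.- 2 E.· (ν 0F E.* ν 3F))) {p ∷ r ∷ V ∷ Z ∷ []} (g-p ∷ g-r ∷ R₂.refl ∷ R₂.refl ∷ [])))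
      (R₂.trans (g.⟦⟧-cong eq) (push (ν 0F E.* ν 1F) {r ∷ s ∷ []} (g-r ∷ R₂.refl ∷ [])))

    transfer-inverse : ∀ {e} → Z R₁.* (R₁.1# -₁ 2 ·₁ (p R₁.* Z)) R₁.* e R₁.≈ R₁.1# →
      g Z R₂.* (R₂.1# -₂ 2 ·₂ (p′ R₂.* g Z)) R₂.* g e R₂.≈ R₂.1#
    transfer-inverse {e} eq = R₂.trans
      (R₂.sym (push (ν 1F E.* (E.1# E.- 2 E.· (ν 0F E.* ν 1F)) E.* ν 2F) {p ∷ Z ∷ e ∷ []} (g-p ∷ R₂.refl ∷ R₂.refl ∷ [])))
      (R₂.trans (g.⟦⟧-cong eq) g.1#-homo)

-- The kernel method in abstract rings

-- All that the argument uses of the series rings and of the walk: embeddings, cancellation laws and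
-- the equations of the walk. With abstract rings no step has to look into a series.
record KernelModel {c ℓ₁ ℓ₂ ℓ₃} (ℝ : RealField c ℓ₁ ℓ₂ ℓ₃) (p r : RealField.Carrier ℝ)
  (p>0 : RealField._<_ ℝ (RealField.0# ℝ) p) (r>0 : RealField._<_ ℝ (RealField.0# ℝ) r)
  (2p+r≈1 : RealField._≈_ ℝ (RealField._+_ ℝ (RealField._+_ ℝ p p) r) (RealField.1# ℝ))
  : Set (Level.suc (c ⊔ ℓ₁)) where
  field
    R₁ R₂ R₃ : CommutativeRing c ℓ₁
  module A = CommutativeRing (RealFacts.realRing ℝ)
  module R₁ = CommutativeRing R₁
  module R₂ = CommutativeRing R₂
  module R₃ = CommutativeRing R₃
  field
    ι₁ : A.Carrier → R₁.Carrier
    ι₁-homo : IsRingHomomorphism A.rawRing R₁.rawRing ι₁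
    ι₂ : A.Carrier → R₂.Carrier
    ι₂-homo : IsRingHomomorphism A.rawRing R₂.rawRing ι₂
    ι₃ : A.Carrier → R₃.Carrier
    ι₃-homo : IsRingHomomorphism A.rawRing R₃.rawRing ι₃
    fromT : R₁.Carrier → R₂.Carrier
    fromT-homo : IsRingHomomorphism R₁.rawRing R₂.rawRing fromT
    inX : R₂.Carrier → R₃.Carrier
    inX-homo : IsRingHomomorphism R₂.rawRing R₃.rawRing inX
    inY : R₂.Carrier → R₃.Carrier
    inY-homo : IsRingHomomorphism R₂.rawRing R₃.rawRing inY
    t₁ : R₁.Carrier
    t₂ x₂ : R₂.Carrier
    t₃ x₃ y₃ : R₃.Carrier
    fromT-ι : ∀ a → fromT (ι₁ a) R₂.≈ ι₂ a
    fromT-t : fromT t₁ R₂.≈ t₂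
    inX-ι : ∀ a → inX (ι₂ a) R₃.≈ ι₃ a
    inX-t : inX t₂ R₃.≈ t₃
    inX-x : inX x₂ R₃.≈ x₃
    inY-ι : ∀ a → inY (ι₂ a) R₃.≈ ι₃ a
    inY-t : inY t₂ R₃.≈ t₃
    inY-x : inY x₂ R₃.≈ y₃
    inY-fromT : ∀ f → inY (fromT f) R₃.≈ inX (fromT f)
  p₁ = ι₁ p
  r₁ = ι₁ r
  p₂ = ι₂ p
  r₂ = ι₂ r
  p₃ = ι₃ p
  r₃ = ι₃ r
  field
    axis : R₂.Carrier
    axis≈α : axis R₂.≈ Formulas.α R₂.rawRing p₂ r₂ t₂ x₂
    kernel : R₃.Carrier
    kernel≈K : kernel R₃.≈ Formulas.K R₃.rawRing p₃ r₃ t₃ x₃ y₃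
    fromT-injective : ∀ {f} → fromT f R₂.≈ R₂.0# → f R₁.≈ R₁.0#
    x-cancel : ∀ {f g} → x₂ R₂.* f R₂.≈ x₂ R₂.* g → f R₂.≈ g
    cancel-α : ∀ {f g} → x₂ R₂.* f R₂.≈ axis R₂.* g → ∃ λ g′ → f R₂.≈ axis R₂.* g′
    cancel-x : ∀ {f g} → x₃ R₃.* f R₃.≈ kernel R₃.* g → ∃ λ g′ → f R₃.≈ kernel R₃.* g′
    cancel-y : ∀ {f g} → y₃ R₃.* f R₃.≈ kernel R₃.* g → ∃ λ g′ → f R₃.≈ kernel R₃.* g′
    decoupled : ∀ {B H} → inX B R₃.- inY B R₃.≈ kernel R₃.* H → ∃ λ β → B R₂.≈ fromT β
    free-α : ∀ {e γ} → e R₂.* axis R₂.≈ fromT γ → e R₂.≈ R₂.0#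
    p′ r′ : A.Carrier
    r*p′≈p*r′ : r A.* p′ A.≈ p A.* r′
    p′+r′≈1 : p′ A.+ r′ A.≈ A.1#
    V F₁′ P₁₀ : R₁.Carrier
    F F′ F″ : R₂.Carrier
    -- X̂, Ŷ and I are the parts of P on the two axes without the origin and in the interior; W, S
    -- and N collect the arrivals by each kind of step.
    P X̂ Ŷ I W S N : R₃.Carrier
  V₃ = inX (fromT V)
  field
    decomposition : P R₃.≈ V₃ R₃.+ X̂ R₃.+ Ŷ R₃.+ I
    first-and-last : P R₃.≈ R₃.1# R₃.+ t₃ R₃.* (W R₃.+ (S R₃.+ N))
    westward : x₃ R₃.* W R₃.≈ ι₃ p′ R₃.* X̂ R₃.+ p₃ R₃.* I
    southward : y₃ R₃.* S R₃.≈ ι₃ p′ R₃.* Ŷ R₃.+ p₃ R₃.* I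
    northEastward : N R₃.≈ x₃ R₃.* (y₃ R₃.* (V₃ R₃.+ ι₃ r′ R₃.* X̂ R₃.+ ι₃ r′ R₃.* Ŷ R₃.+ r₃ R₃.* I))
    inX-F : inX F R₃.≈ V₃ R₃.+ ι₃ r′ R₃.* X̂
    inY-F : inY F R₃.≈ V₃ R₃.+ ι₃ r′ R₃.* Ŷ
    F-tail : F R₂.≈ fromT V R₂.+ x₂ R₂.* F′
    F′-tail : F′ R₂.≈ fromT F₁′ R₂.+ x₂ R₂.* F″
    F₁′≈ : F₁′ R₁.≈ ι₁ r′ R₁.* P₁₀
    V≈ : V R₁.≈ R₁.1# R₁.+ t₁ R₁.* ((ι₁ p′ R₁.+ ι₁ p′) R₁.* P₁₀)
  open RingNotation R₂.rawRing using () renaming (_·_ to _·₂_)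
  field
    free-low : ∀ {e f γ} → e R₂.* (2 ·₂ Formulas.low R₂.rawRing p₂ r₂ t₂ (p₂ R₂.* fromT V R₂.+ r₂) x₂ R₂.+ x₂ R₂.* x₂ R₂.* f) R₂.≈ fromT γ → e R₂.≈ R₂.0#
    Z ζ : R₁.Carrier
    √ √′ : R₂.Carrier
    Z-equation : Z R₁.≈ R₁.1# R₁.+ Formulas.τ R₁.rawRing p₁ r₁ t₁ R₁.* (Z R₁.* Z R₁.* Z)
    ζZ : ζ R₁.* Z R₁.≈ R₁.1#
    ζ-cancel : ∀ {f} → f R₁.* (ζ R₁.- (R₁.1# R₁.- p₁)) R₁.≈ R₁.0# → f R₁.≈ R₁.0#
    √-tail : √ R₂.≈ R₂.1# R₂.+ x₂ R₂.* √′
    √-square : √ R₂.* √ R₂.≈ R₂.1# R₂.- 4 ·₂ (p₂ R₂.* r₂ R₂.* (t₂ R₂.* t₂) R₂.* (fromT Z R₂.* fromT Z) R₂.* x₂)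

module KernelMethod {c ℓ₁ ℓ₂ ℓ₃} {ℝ : RealField c ℓ₁ ℓ₂ ℓ₃} {p r : RealField.Carrier ℝ}
  {p>0 : RealField._<_ ℝ (RealField.0# ℝ) p} {r>0 : RealField._<_ ℝ (RealField.0# ℝ) r}
  {2p+r≈1 : RealField._≈_ ℝ (RealField._+_ ℝ (RealField._+_ ℝ p p) r) (RealField.1# ℝ)}
  (M : KernelModel ℝ p r p>0 r>0 2p+r≈1) where

  open KernelModel M
  private
    open RingNotation R₁.rawRing using () renaming (_·_ to _·₁_)
    open RingNotation R₂.rawRing using () renaming (_·_ to _·₂_)
    module F₁ = Formulas R₁.rawRing p₁ r₁ t₁
    module F₂ = Formulas R₂.rawRing p₂ r₂ t₂
    module F₃ = Formulas R₃.rawRing p₃ r₃ t₃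
    module I₁ = KernelLemmas R₁
    module I₂ = KernelLemmas R₂
    module I₃ = KernelLemmas R₃
    module fromT = IsRingHomomorphism fromT-homo
    module inX = IsRingHomomorphism inX-homo
    module inY = IsRingHomomorphism inY-homo
    open Transport R₁ R₂ fromT-homo using () renaming (push to push-T)
    open Transport R₂ R₃ inX-homo using () renaming (push to push-X)
    open Transport R₂ R₃ inY-homo using () renaming (push to push-Y)

    h₁ : R₁.Carrier
    h₁ = p₁ R₁.* V R₁.+ r₁
    h₂ n₂ N₂ : R₂.Carrier
    h₂ = p₂ R₂.* fromT V R₂.+ r₂
    n₂ = F₂.θ₂ F F′ F″
    N₂ = F₂.θ x₂ F
    h₃ : R₃.Carrier
    h₃ = p₃ R₃.* V₃ R₃.+ r₃

    fromT-h : fromT h₁ R₂.≈ h₂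
    fromT-h = push-T (ν 0F E.* ν 1F E.+ ν 2F) {p₁ ∷ V ∷ r₁ ∷ []} (fromT-ι p ∷ R₂.refl ∷ fromT-ι r ∷ [])

    inX-h : inX h₂ R₃.≈ h₃
    inX-h = push-X (ν 0F E.* ν 1F E.+ ν 2F) {p₂ ∷ fromT V ∷ r₂ ∷ []} (inX-ι p ∷ R₃.refl ∷ inX-ι r ∷ [])

    inY-h : inY h₂ R₃.≈ h₃
    inY-h = push-Y (ν 0F E.* ν 1F E.+ ν 2F) {p₂ ∷ fromT V ∷ r₂ ∷ []} (inY-ι p ∷ inY-fromT V ∷ inY-ι r ∷ [])

    module ι₁ = IsRingHomomorphism ι₁-homo
    module ι₂ = IsRingHomomorphism ι₂-homo
    module ι₃ = IsRingHomomorphism ι₃-homo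

    total₂ : p₂ R₂.+ p₂ R₂.+ r₂ R₂.≈ R₂.1#
    total₂ = R₂.trans (R₂.+-congʳ (R₂.sym (ι₂.+-homo p p)))
      (R₂.trans (R₂.sym (ι₂.+-homo (p A.+ p) r)) (R₂.trans (ι₂.⟦⟧-cong 2p+r≈1) ι₂.1#-homo))

    total₃ : p₃ R₃.+ p₃ R₃.+ r₃ R₃.≈ R₃.1#
    total₃ = R₃.trans (R₃.+-congʳ (R₃.sym (ι₃.+-homo p p)))
      (R₃.trans (R₃.sym (ι₃.+-homo (p A.+ p) r)) (R₃.trans (ι₃.⟦⟧-cong 2p+r≈1) ι₃.1#-homo))

    walk : F₃.K x₃ y₃ R₃.* (r₃ R₃.* P R₃.+ p₃ R₃.* (inX F R₃.+ inY F)) R₃.≈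
      r₃ R₃.* (x₃ R₃.* y₃) R₃.+ p₃ R₃.* x₃ R₃.* (y₃ R₃.- t₃) R₃.* inX F R₃.+ p₃ R₃.* y₃ R₃.* (x₃ R₃.- t₃) R₃.* inY F
    walk = I₃.functional-equation
      (p₃ ∷ r₃ ∷ t₃ ∷ ι₃ p′ ∷ ι₃ r′ ∷ x₃ ∷ y₃ ∷ V₃ ∷ X̂ ∷ Ŷ ∷ I ∷ P ∷ W ∷ S ∷ N ∷ inX F ∷ inY F ∷ [])
      (total₃ ∷ R₃.trans (R₃.sym (ι₃.*-homo r p′)) (R₃.trans (ι₃.⟦⟧-cong r*p′≈p*r′) (ι₃.*-homo p r′)) ∷
       R₃.trans (R₃.sym (ι₃.+-homo p′ r′)) (R₃.trans (ι₃.⟦⟧-cong p′+r′≈1) ι₃.1#-homo) ∷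
       decomposition ∷ first-and-last ∷ westward ∷ southward ∷ northEastward ∷ inX-F ∷ inY-F ∷ [])

    Q : R₃.Carrier
    Q = r₃ R₃.* P R₃.+ p₃ R₃.* (inX F R₃.+ inY F)

    origin : 2 ·₁ (p₁ R₁.* t₁ R₁.* F₁′) R₁.≈ r₁ R₁.* (V R₁.- R₁.1#)
    origin = I₁.origin (p₁ ∷ r₁ ∷ t₁ ∷ ι₁ p′ ∷ ι₁ r′ ∷ V ∷ F₁′ ∷ P₁₀ ∷ [])
      (F₁′≈ ∷ V≈ ∷ R₁.trans (R₁.sym (ι₁.*-homo r p′)) (R₁.trans (ι₁.⟦⟧-cong r*p′≈p*r′) (ι₁.*-homo p r′)) ∷ [])

    origin₂ : 2 ·₂ (p₂ R₂.* t₂ R₂.* fromT F₁′) R₂.≈ r₂ R₂.* (fromT V R₂.- R₂.1#)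
    origin₂ = R₂.trans (R₂.sym (push-T (2 E.· (ν 0F E.* ν 1F E.* ν 2F)) {p₁ ∷ t₁ ∷ F₁′ ∷ []} (fromT-ι p ∷ fromT-t ∷ R₂.refl ∷ [])))
      (R₂.trans (fromT.⟦⟧-cong origin) (push-T (ν 0F E.* (ν 1F E.- E.1#)) {r₁ ∷ V ∷ []} (fromT-ι r ∷ R₂.refl ∷ [])))

    N-expansion : N₂ R₂.≈ F₂.low h₂ x₂ R₂.+ x₂ R₂.* x₂ R₂.* n₂
    N-expansion = I₂.ν-expansion (p₂ ∷ r₂ ∷ t₂ ∷ x₂ ∷ fromT V ∷ F ∷ F′ ∷ fromT F₁′ ∷ F″ ∷ [])
      (F-tail ∷ F′-tail ∷ origin₂ ∷ total₂ ∷ [])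

    N-expression : Expr ⊥ 5
    N-expression = EF.θ (ν 0F) (ν 1F) (ν 2F) (ν 3F) (ν 4F)

    expansion : Expr ⊥ 6
    expansion = EF.low (ν 0F) (ν 1F) (ν 2F) (ν 3F) (ν 4F) E.+ ν 4F E.* ν 4F E.* ν 5F

    N-expansion-X : F₃.θ x₃ (inX F) R₃.≈ F₃.low h₃ x₃ R₃.+ x₃ R₃.* x₃ R₃.* inX n₂
    N-expansion-X = R₃.trans
      (R₃.sym (push-X N-expression {p₂ ∷ r₂ ∷ t₂ ∷ x₂ ∷ F ∷ []} (inX-ι p ∷ inX-ι r ∷ inX-t ∷ inX-x ∷ R₃.refl ∷ [])))
      (R₃.trans (inX.⟦⟧-cong N-expansion)
        (push-X expansion {p₂ ∷ r₂ ∷ t₂ ∷ h₂ ∷ x₂ ∷ n₂ ∷ []} (inX-ι p ∷ inX-ι r ∷ inX-t ∷ inX-h ∷ inX-x ∷ R₃.refl ∷ [])))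

    N-expansion-Y : F₃.θ y₃ (inY F) R₃.≈ F₃.low h₃ y₃ R₃.+ y₃ R₃.* y₃ R₃.* inY n₂
    N-expansion-Y = R₃.trans
      (R₃.sym (push-Y N-expression {p₂ ∷ r₂ ∷ t₂ ∷ x₂ ∷ F ∷ []} (inY-ι p ∷ inY-ι r ∷ inY-t ∷ inY-x ∷ R₃.refl ∷ [])))
      (R₃.trans (inY.⟦⟧-cong N-expansion)
        (push-Y expansion {p₂ ∷ r₂ ∷ t₂ ∷ h₂ ∷ x₂ ∷ n₂ ∷ []} (inY-ι p ∷ inY-ι r ∷ inY-t ∷ inY-h ∷ inY-x ∷ R₃.refl ∷ [])))

    Β-expression : Expr ⊥ 6
    Β-expression = EF.Β (ν 0F) (ν 1F) (ν 2F) (ν 3F) (ν 4F) (ν 5F)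

    Β-difference : ∃ λ H → inX (F₂.Β h₂ x₂ n₂) R₃.- inY (F₂.Β h₂ x₂ n₂) R₃.≈ kernel R₃.* H
    Β-difference =
      let _ , e₁ = cancel-x (to-kernel (I₃.invariant
            (p₃ ∷ r₃ ∷ t₃ ∷ x₃ ∷ y₃ ∷ h₃ ∷ F₃.θ x₃ (inX F) ∷ F₃.θ y₃ (inY F) ∷ inX n₂ ∷ inY n₂ ∷ F₃.Η x₃ y₃ Q (inX F) (inY F) ∷ [])
            (N-expansion-X ∷ N-expansion-Y ∷
             I₃.kernel-multiple (p₃ ∷ r₃ ∷ t₃ ∷ x₃ ∷ y₃ ∷ Q ∷ inX F ∷ inY F ∷ []) (walk ∷ []) ∷ [])))
          _ , e₂ = cancel-x e₁
          _ , e₃ = cancel-y e₂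
          H , e₄ = cancel-y e₃
      in H , R₃.trans (R₃.+-cong
          (push-X Β-expression {p₂ ∷ r₂ ∷ t₂ ∷ h₂ ∷ x₂ ∷ n₂ ∷ []} (inX-ι p ∷ inX-ι r ∷ inX-t ∷ inX-h ∷ inX-x ∷ R₃.refl ∷ []))
          (R₃.-‿cong (push-Y Β-expression {p₂ ∷ r₂ ∷ t₂ ∷ h₂ ∷ x₂ ∷ n₂ ∷ []} (inY-ι p ∷ inY-ι r ∷ inY-t ∷ inY-h ∷ inY-x ∷ R₃.refl ∷ []))))
          e₄
      where
      to-kernel : ∀ {f g} → f R₃.≈ F₃.K x₃ y₃ R₃.* g → f R₃.≈ kernel R₃.* g
      to-kernel f≈ = R₃.trans f≈ (R₃.*-congʳ (R₃.sym kernel≈K))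

    β : R₁.Carrier
    β = proj₁ (decoupled (proj₂ Β-difference))

    Β≈β : F₂.Β h₂ x₂ n₂ R₂.≈ fromT β
    Β≈β = proj₂ (decoupled (proj₂ Β-difference))

    Z₂ ζ₂ m : R₂.Carrier
    Z₂ = fromT Z
    ζ₂ = fromT ζ
    m = h₂ R₂.* ζ₂ R₂.* F₂.root₂ Z₂ √′

    Z-equation₂ : Z₂ R₂.≈ R₂.1# R₂.+ F₂.τ R₂.* (Z₂ R₂.* Z₂ R₂.* Z₂)
    Z-equation₂ = R₂.trans (fromT.⟦⟧-cong Z-equation)
      (push-T (E.1# E.+ EF.τ (ν 0F) (ν 1F) (ν 2F) E.* (ν 3F E.* ν 3F E.* ν 3F)) {p₁ ∷ r₁ ∷ t₁ ∷ Z ∷ []}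
        (fromT-ι p ∷ fromT-ι r ∷ fromT-t ∷ R₂.refl ∷ []))

    ζZ₂ : ζ₂ R₂.* Z₂ R₂.≈ R₂.1#
    ζZ₂ = R₂.trans (R₂.sym (fromT.*-homo ζ Z)) (R₂.trans (fromT.⟦⟧-cong ζZ) fromT.1#-homo)

    root-expansion : h₂ R₂.* ζ₂ R₂.* F₂.root Z₂ x₂ √ R₂.≈ F₂.low h₂ x₂ R₂.+ x₂ R₂.* x₂ R₂.* m
    root-expansion = I₂.root-expansion (p₂ ∷ r₂ ∷ t₂ ∷ x₂ ∷ h₂ ∷ Z₂ ∷ ζ₂ ∷ √ ∷ √′ ∷ [])
      (√-tail ∷ x-cancel (I₂.sqrt-tail (p₂ ∷ r₂ ∷ t₂ ∷ x₂ ∷ Z₂ ∷ √ ∷ √′ ∷ []) (√-square ∷ √-tail ∷ [])) ∷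
       Z-equation₂ ∷ ζZ₂ ∷ [])

    γ : R₁.Carrier
    γ = β R₁.- h₁ R₁.* h₁ R₁.* F₁.cubic ζ

    cubic-expression : Expr ⊥ 6
    cubic-expression = ν 4F E.- ν 3F E.* ν 3F E.* EF.cubic (ν 0F) (ν 1F) (ν 2F) (ν 5F)

    fromT-γ : fromT γ R₂.≈ fromT β R₂.- h₂ R₂.* h₂ R₂.* F₂.cubic ζ₂
    fromT-γ = push-T cubic-expression {p₁ ∷ r₁ ∷ t₁ ∷ h₁ ∷ β ∷ ζ ∷ []} (fromT-ι p ∷ fromT-ι r ∷ fromT-t ∷ fromT-h ∷ R₂.refl ∷ R₂.refl ∷ [])

    difference-of-squares : (n₂ R₂.- m) R₂.* (2 ·₂ F₂.low h₂ x₂ R₂.+ x₂ R₂.* x₂ R₂.* (n₂ R₂.+ m)) R₂.≈ fromT γ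
    difference-of-squares = R₂.trans (x-cancel (x-cancel
      (I₂.squares-agree (p₂ ∷ r₂ ∷ t₂ ∷ x₂ ∷ h₂ ∷ Z₂ ∷ ζ₂ ∷ √ ∷ m ∷ n₂ ∷ fromT β ∷ [])
        (Β≈β ∷ root-expansion ∷ √-square ∷ Z-equation₂ ∷ ζZ₂ ∷ []))))
      (R₂.sym fromT-γ)

    n₂≈m : n₂ R₂.- m R₂.≈ R₂.0#
    n₂≈m = free-low difference-of-squares

    β≈cubic : fromT β R₂.≈ h₂ R₂.* h₂ R₂.* F₂.cubic ζ₂
    β≈cubic = x∙y⁻¹≈ε⇒x≈y _ _ (R₂.trans (R₂.sym fromT-γ) (R₂.trans (R₂.sym difference-of-squares)
      (R₂.trans (R₂.*-congʳ n₂≈m) (R₂.zeroˡ _))))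
      where open Algebra.Properties.Ring R₂.ring using (x∙y⁻¹≈ε⇒x≈y)

  axis-root : Formulas.θ R₂.rawRing p₂ r₂ t₂ x₂ F R₂.≈ (p₂ R₂.* fromT V R₂.+ r₂) R₂.* fromT ζ R₂.* Formulas.root R₂.rawRing p₂ r₂ t₂ (fromT Z) x₂ √
  axis-root = I₂.root-unique (N₂ ∷ h₂ R₂.* ζ₂ R₂.* F₂.root Z₂ x₂ √ ∷ F₂.low h₂ x₂ ∷ x₂ ∷ n₂ ∷ m ∷ [])
    (N-expansion ∷ root-expansion ∷ n₂≈m ∷ [])

  private
    discriminant-expression : Expr ⊥ 5
    discriminant-expression = EF.discriminant (ν 0F) (ν 1F) (ν 2F) (ν 3F) (ν 4F)

    fromT-discriminant : fromT (F₁.discriminant h₁ ζ) R₂.≈ F₂.discriminant h₂ ζ₂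
    fromT-discriminant = push-T discriminant-expression {p₁ ∷ r₁ ∷ t₁ ∷ h₁ ∷ ζ ∷ []}
      (fromT-ι p ∷ fromT-ι r ∷ fromT-t ∷ fromT-h ∷ R₂.refl ∷ [])

    -- α divides x² times the discriminant, hence the discriminant itself. As this is free of x and
    -- α has a simple root in x, the quotient is 0.
    discriminant≈0 : F₁.discriminant h₁ ζ R₁.≈ R₁.0#
    discriminant≈0 =
      let _ , e₁ = cancel-α (to-axis (I₂.discriminant-multiple (p₂ ∷ r₂ ∷ t₂ ∷ x₂ ∷ h₂ ∷ ζ₂ ∷ F ∷ n₂ ∷ fromT β ∷ [])
                     (N-expansion ∷ Β≈β ∷ β≈cubic ∷ [])))
          g , e₂ = cancel-α e₁
          gα≈ = R₂.trans (R₂.*-comm g axis) (R₂.trans (R₂.sym e₂) (R₂.sym fromT-discriminant))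
      in fromT-injective (R₂.trans (R₂.sym gα≈) (R₂.trans (R₂.*-congʳ (free-α gα≈)) (R₂.zeroˡ _)))
      where
      to-axis : ∀ {f g} → f R₂.≈ F₂.α x₂ R₂.* g → f R₂.≈ axis R₂.* g
      to-axis f≈ = R₂.trans f≈ (R₂.*-congʳ (R₂.sym axis≈α))

  τ-reciprocal : Formulas.τ R₁.rawRing p₁ r₁ t₁ R₁.≈ ζ R₁.* ζ R₁.- ζ R₁.* ζ R₁.* ζ
  τ-reciprocal = I₁.τ-reciprocal (p₁ ∷ r₁ ∷ t₁ ∷ Z ∷ ζ ∷ []) (Z-equation ∷ ζZ ∷ [])

  origin-square : (p₁ R₁.* V R₁.+ r₁) R₁.* (p₁ R₁.* V R₁.+ r₁) R₁.* ((ζ R₁.- 2 ·₁ p₁) R₁.* (ζ R₁.- 2 ·₁ p₁))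
    R₁.- r₁ R₁.* r₁ R₁.* Formulas.δ R₁.rawRing p₁ r₁ t₁ ζ R₁.≈ R₁.0#
  origin-square = ζ-cancel (I₁.discriminant-factor (p₁ ∷ r₁ ∷ t₁ ∷ h₁ ∷ ζ ∷ [])
    (discriminant≈0 ∷ τ-reciprocal ∷ []))

  private
    N² : N₂ R₂.* N₂ R₂.≈ h₂ R₂.* h₂ R₂.* F₂.square x₂ ζ₂
    N² = I₂.square-of-θ (p₂ ∷ r₂ ∷ t₂ ∷ x₂ ∷ h₂ ∷ ζ₂ ∷ N₂ ∷ n₂ ∷ fromT β ∷ []) (N-expansion ∷ Β≈β ∷ β≈cubic ∷ [])

    ζ₃ : R₃.Carrier
    ζ₃ = inX ζ₂

    square-expression : Expr ⊥ 6
    square-expression = ν 3F E.* ν 3F E.* EF.square (ν 0F) (ν 1F) (ν 2F) (ν 4F) (ν 5F)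

    N²-X : F₃.θ x₃ (inX F) R₃.* F₃.θ x₃ (inX F) R₃.≈ h₃ R₃.* h₃ R₃.* F₃.square x₃ ζ₃
    N²-X = R₃.trans
      (R₃.sym (push-X (N-expression E.* N-expression) {p₂ ∷ r₂ ∷ t₂ ∷ x₂ ∷ F ∷ []} (inX-ι p ∷ inX-ι r ∷ inX-t ∷ inX-x ∷ R₃.refl ∷ [])))
      (R₃.trans (inX.⟦⟧-cong N²)
        (push-X square-expression {p₂ ∷ r₂ ∷ t₂ ∷ h₂ ∷ x₂ ∷ ζ₂ ∷ []} (inX-ι p ∷ inX-ι r ∷ inX-t ∷ inX-h ∷ inX-x ∷ R₃.refl ∷ [])))

    N²-Y : F₃.θ y₃ (inY F) R₃.* F₃.θ y₃ (inY F) R₃.≈ h₃ R₃.* h₃ R₃.* F₃.square y₃ ζ₃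
    N²-Y = R₃.trans
      (R₃.sym (push-Y (N-expression E.* N-expression) {p₂ ∷ r₂ ∷ t₂ ∷ x₂ ∷ F ∷ []} (inY-ι p ∷ inY-ι r ∷ inY-t ∷ inY-x ∷ R₃.refl ∷ [])))
      (R₃.trans (inY.⟦⟧-cong N²)
        (push-Y square-expression {p₂ ∷ r₂ ∷ t₂ ∷ h₂ ∷ x₂ ∷ ζ₂ ∷ []} (inY-ι p ∷ inY-ι r ∷ inY-t ∷ inY-h ∷ inY-x ∷ inY-fromT ζ ∷ [])))

    open Transport R₁ R₃ (compose R₃.trans fromT-homo inX-homo) using () renaming (push to push₃)

    fromT-inX-ι : ∀ a → inX (fromT (ι₁ a)) R₃.≈ ι₃ a
    fromT-inX-ι a = R₃.trans (inX.⟦⟧-cong (fromT-ι a)) (inX-ι a)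

    fromT-inX-t : inX (fromT t₁) R₃.≈ t₃
    fromT-inX-t = R₃.trans (inX.⟦⟧-cong fromT-t) inX-t

    open ExplicitPolynomials ℝ p r p>0 r>0 2p+r≈1 using (annihilator; annihilates; denominatorP; numeratorP; rational)

  P-algebraic : Polynomials.eval ℝ R₃.rawRing ι₃ annihilator (P ∷ x₃ ∷ y₃ ∷ t₃ ∷ []) R₃.≈ R₃.0#
  P-algebraic = annihilates R₃ ι₃-homo walk N²-X N²-Y
    (R₃.trans (R₃.sym (push₃ (ν 2F E.* ν 2F E.* ((ν 3F E.- 2 E.· ν 0F) E.* (ν 3F E.- 2 E.· ν 0F)) E.- ν 1F E.* ν 1F E.* EF.δ (ν 0F) (ν 1F) (ν 4F) (ν 3F))
        {p₁ ∷ r₁ ∷ h₁ ∷ ζ ∷ t₁ ∷ []} (fromT-inX-ι p ∷ fromT-inX-ι r ∷ R₃.trans (inX.⟦⟧-cong fromT-h) inX-h ∷ R₃.refl ∷ fromT-inX-t ∷ [])))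
      (R₃.trans (inX.⟦⟧-cong (fromT.⟦⟧-cong origin-square)) (R₃.trans (inX.⟦⟧-cong fromT.0#-homo) inX.0#-homo)))
    (R₃.trans (R₃.sym (push₃ (ν 0F E.* ν 0F E.* ν 0F) {ζ ∷ []} (R₃.refl ∷ [])))
      (R₃.trans (inX.⟦⟧-cong (fromT.⟦⟧-cong (I₁.cube (F₁.τ ∷ ζ ∷ []) (τ-reciprocal ∷ []))))
        (push₃ (ν 3F E.* ν 3F E.- EF.τ (ν 0F) (ν 1F) (ν 2F)) {p₁ ∷ r₁ ∷ t₁ ∷ ζ ∷ []}
          (fromT-inX-ι p ∷ fromT-inX-ι r ∷ fromT-inX-t ∷ R₃.refl ∷ []))))

  module _ {s : R₁.Carrier} {√ʸ : R₃.Carrier} (inY-√ : inY √ R₃.≈ √ʸ) (h√ : (p₁ R₁.* V R₁.+ r₁) R₁.* (R₁.1# R₁.- 2 ·₁ (p₁ R₁.* Z)) R₁.≈ r₁ R₁.* s) where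
    P-rational :
      Polynomials.eval ℝ R₃.rawRing ι₃ denominatorP (x₃ ∷ y₃ ∷ t₃ ∷ inX (fromT Z) ∷ inX (fromT s) ∷ inX √ ∷ √ʸ ∷ []) R₃.* P R₃.≈
      Polynomials.eval ℝ R₃.rawRing ι₃ numeratorP (x₃ ∷ y₃ ∷ t₃ ∷ inX (fromT Z) ∷ inX (fromT s) ∷ inX √ ∷ √ʸ ∷ [])
    P-rational = rational R₃ ι₃-homo {h = h₃} {ζ = ζ₃} walk
      (R₃.trans
        (R₃.sym (push-X N-expression {p₂ ∷ r₂ ∷ t₂ ∷ x₂ ∷ F ∷ []} (inX-ι p ∷ inX-ι r ∷ inX-t ∷ inX-x ∷ R₃.refl ∷ [])))
        (R₃.trans (inX.⟦⟧-cong axis-root)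
          (push-X root-expression {p₂ ∷ r₂ ∷ t₂ ∷ x₂ ∷ h₂ ∷ ζ₂ ∷ Z₂ ∷ √ ∷ []}
            (inX-ι p ∷ inX-ι r ∷ inX-t ∷ inX-x ∷ inX-h ∷ R₃.refl ∷ R₃.refl ∷ R₃.refl ∷ []))))
      (R₃.trans
        (R₃.sym (push-Y N-expression {p₂ ∷ r₂ ∷ t₂ ∷ x₂ ∷ F ∷ []} (inY-ι p ∷ inY-ι r ∷ inY-t ∷ inY-x ∷ R₃.refl ∷ [])))
        (R₃.trans (inY.⟦⟧-cong axis-root)
          (push-Y root-expression {p₂ ∷ r₂ ∷ t₂ ∷ x₂ ∷ h₂ ∷ ζ₂ ∷ Z₂ ∷ √ ∷ []}
            (inY-ι p ∷ inY-ι r ∷ inY-t ∷ inY-x ∷ inY-h ∷ inY-fromT ζ ∷ inY-fromT Z ∷ inY-√ ∷ []))))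
      (R₃.trans
        (R₃.sym (push₃ (ν 1F E.* ν 2F E.* EF.ε (ν 0F) (ν 4F) (ν 4F) (ν 3F)) {p₁ ∷ h₁ ∷ ζ ∷ Z ∷ t₁ ∷ []}
          (fromT-inX-ι p ∷ R₃.trans (inX.⟦⟧-cong fromT-h) inX-h ∷ R₃.refl ∷ R₃.refl ∷ fromT-inX-t ∷ [])))
        (R₃.trans (inX.⟦⟧-cong (fromT.⟦⟧-cong (I₁.origin-root (p₁ ∷ r₁ ∷ t₁ ∷ h₁ ∷ ζ ∷ Z ∷ s ∷ []) (h√ ∷ ζZ ∷ []))))
          (push₃ (ν 0F E.* ν 1F) {r₁ ∷ s ∷ []} (fromT-inX-ι r ∷ R₃.refl ∷ []))))
      where
      root-expression : Expr ⊥ 8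
      root-expression = ν 4F E.* ν 5F E.* EF.root (ν 0F) (ν 1F) (ν 2F) (ν 6F) (ν 3F) (ν 7F)

-- The series of the walk

module WalkSeries {c ℓ₁ ℓ₂ ℓ₃} (ℝ : RealField c ℓ₁ ℓ₂ ℓ₃) (p q r : RealField.Carrier ℝ)
  (p>0 : RealField._<_ ℝ (RealField.0# ℝ) p)
  (q>0 : RealField._<_ ℝ (RealField.0# ℝ) q)
  (r>0 : RealField._<_ ℝ (RealField.0# ℝ) r)
  (total : RealField._≈_ ℝ (RealField._+_ ℝ (RealField._+_ ℝ p q) r) (RealField.1# ℝ))
  (p≈q : RealField._≈_ ℝ p q) where

  open RealFacts ℝ
  open RealField ℝ using (_÷_⟨_⟩; +-pos)
  open Walk ℝ p q r p>0 q>0 r>0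
  open WalkFacts ℝ p q r p>0 q>0 r>0
  open WalkFacts.Symmetric ℝ p q r p>0 q>0 r>0 p≈q
  module A = CommutativeRing realRing
  module Two = TwoVariables realRing
  module Three = ThreeVariables realRing
  open Two public using (R₁; R₂)
  open Three public using (R₃)
  module R₁ = CommutativeRing R₁
  module R₂ = CommutativeRing R₂
  module R₃ = CommutativeRing R₃
  private
    module S₁ = SeriesRing realRing
    module S₂ = SeriesRing R₁
    module ι₁ = IsRingHomomorphism S₁.const-homo

  2p+r : p A.+ p A.+ r A.≈ A.1#
  2p+r = A.trans (A.+-congʳ (A.+-congˡ p≈q)) total

  r*p′≈p*r′ : r A.* p′ A.≈ p A.* r′
  r*p′≈p*r′ = KernelLemmas.reflection-weights realRing (p ∷ r ∷ p′ ∷ r′ ∷ []) (p′-spec ∷ r′-spec ∷ [])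

  p′+r′≈1 : p′ A.+ r′ A.≈ A.1#
  p′+r′≈1 = KernelLemmas.reflection-total realRing (p ∷ r ∷ p′ ∷ r′ ∷ _ ∷ [])
    (p′-spec ∷ r′-spec ∷ proj₂ (#⇒unit (>0⇒# p+r>0)) ∷ [])

  -- F is Q(x, 0); by the symmetry p = q it serves for the other axis too.
  F F′ F″ : R₂.Carrier
  F = XT.fromT T.P₀₀ R₂.+ XT.ι r′ R₂.* XT.P₁
  F′ = Two.tailX F
  F″ = Two.tailX F′

  F-coefficient : ∀ n i → F n i A.≈ XT.fromT T.P₀₀ n i A.+ r′ A.* XT.P₁ n i
  F-coefficient n i = A.+-congˡ (A.trans (S₂.const-* (const A.rawRing r′) XT.P₁ n i) (S₁.const-* r′ (XT.P₁ n) i))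

  F-tail : F R₂.≈ XT.fromT T.P₀₀ R₂.+ Two.x R₂.* F′
  F-tail n i = A.trans (Two.fromT+x* F n i) (A.+-congʳ (constant i))
    where
    constant : ∀ i → Two.fromT (Two.atX=0 F) n i A.≈ XT.fromT T.P₀₀ n i
    constant zero = A.trans (F-coefficient n 0) (A.trans (A.+-congˡ (A.zeroʳ r′)) (A.+-identityʳ _))
    constant (suc i) = A.refl

  P₁₀ : R₁.Carrier
  P₁₀ n = prob n 1 0

  F₁≈ : Two.atX=0 F′ R₁.≈ T.ι r′ R₁.* P₁₀
  F₁≈ n = A.trans (F-coefficient n 1) (A.trans (A.+-identityˡ _) (A.sym (S₁.const-* r′ P₁₀ n)))

  -- The origin is entered from (1, 0) and from (0, 1), and by symmetry both contribute the same.
  V≈ : T.P₀₀ R₁.≈ R₁.1# R₁.+ T.t R₁.* ((T.ι p′ R₁.+ T.ι p′) R₁.* P₁₀)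
  V≈ zero = A.sym (A.trans (A.+-congˡ (S₁.var-*-zero ((T.ι p′ R₁.+ T.ι p′) R₁.* P₁₀))) (A.+-identityʳ _))
  V≈ (suc n) = A.trans (transition-forward n (0 , 0) (0 , 0))
    (A.trans (A.+-cong (A.sym (S₁.const-* p′ P₁₀ n))
      (A.trans (A.+-identityʳ _) (A.trans (A.*-cong (A.sym p′≈q″) (prob-swap n 0 1)) (A.sym (S₁.const-* p′ P₁₀ n)))))
      (A.sym (A.trans (A.+-identityˡ _) (A.trans (S₁.var-*-suc ((T.ι p′ R₁.+ T.ι p′) R₁.* P₁₀) n)
        (S₁.conv-distribʳ n (T.ι p′) (T.ι p′) P₁₀)))))

  private
    V̂ X̂ Ŷ I W S N : R₃.Carrier
    V̂ = XYT.fromT T.P₀₀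
    X̂ = XYT.inX XT.P₁
    Ŷ = XYT.inY XT.P₁
    I n (suc j) (suc i) = prob n (suc i) (suc j)
    I n zero _ = A.0#
    I n (suc j) zero = A.0#
    W n j i = west (transition n (0 , 0)) (i , j)
    S n j i = south (transition n (0 , 0)) (i , j)
    N n j i = northEast (transition n (0 , 0)) (i , j)

    0+0+0 : A.0# A.+ A.0# A.+ A.0# A.≈ A.0#
    0+0+0 = A.trans (A.+-identityʳ _) (A.+-identityʳ _)

    decomposition : XYT.P R₃.≈ V̂ R₃.+ X̂ R₃.+ Ŷ R₃.+ I
    decomposition n zero zero = A.sym (A.trans (A.+-identityʳ _) (A.trans (A.+-identityʳ _) (A.+-identityʳ _)))
    decomposition n zero (suc i) = A.sym (A.trans (A.+-identityʳ _) (A.trans (A.+-identityʳ _) (A.+-identityˡ _)))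
    decomposition n (suc j) zero = A.sym (A.trans (A.+-identityʳ _) (A.trans (A.+-congʳ (A.+-identityʳ _))
      (A.trans (A.+-identityˡ _) (prob-swap n (suc j) 0))))
    decomposition n (suc j) (suc i) = A.sym (A.trans (A.+-congʳ 0+0+0) (A.+-identityˡ _))

    first-and-last : XYT.P R₃.≈ R₃.1# R₃.+ Three.t R₃.* (W R₃.+ (S R₃.+ N))
    first-and-last zero j i = A.sym (A.trans (A.+-congˡ (Three.t-*-zero (W R₃.+ (S R₃.+ N)) j i))
      (A.trans (A.+-identityʳ _) (start j i)))
      where
      start : ∀ j i → R₃.1# 0 j i A.≈ prob 0 i j
      start zero zero = A.refl
      start zero (suc i) = A.refl
      start (suc j) zero = A.refl
      start (suc j) (suc i) = A.refl
    first-and-last (suc n) j i = A.sym (A.trans (A.+-identityˡ _)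
      (A.trans (Three.t-*-suc (W R₃.+ (S R₃.+ N)) n j i) (A.sym (transition-forward n (0 , 0) (i , j)))))

    sum₂ : ∀ {a b : A.Carrier} → a A.≈ A.0# → b A.≈ A.0# → a A.+ b A.≈ A.0#
    sum₂ a b = A.trans (A.+-cong a b) (A.+-identityˡ _)

    combine : ∀ s s′ G H n j i → (XYT.ι s R₃.* G R₃.+ XYT.ι s′ R₃.* H) n j i A.≈ s A.* G n j i A.+ s′ A.* H n j i
    combine s s′ G H n j i = A.+-cong (Three.ι-* s G n j i) (Three.ι-* s′ H n j i)

    westward : XYT.x R₃.* W R₃.≈ XYT.ι p′ R₃.* X̂ R₃.+ XYT.ι p R₃.* I
    westward n j i = A.trans (cases j i) (A.sym (combine p′ p X̂ I n j i))
      where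
      cases : ∀ j i → (XYT.x R₃.* W) n j i A.≈ p′ A.* X̂ n j i A.+ p A.* I n j i
      cases zero zero = A.trans (Three.x-*-zero W n 0) (A.sym (sum₂ (A.zeroʳ p′) (A.zeroʳ p)))
      cases (suc j) zero = A.trans (Three.x-*-zero W n (suc j)) (A.sym (sum₂ (A.zeroʳ p′) (A.zeroʳ p)))
      cases zero (suc i) = A.trans (Three.x-*-suc W n 0 i) (A.sym (A.trans (A.+-congˡ (A.zeroʳ p)) (A.+-identityʳ _)))
      cases (suc j) (suc i) = A.trans (Three.x-*-suc W n (suc j) i) (A.sym (A.trans (A.+-congʳ (A.zeroʳ p′)) (A.+-identityˡ _)))

    southward : XYT.y R₃.* S R₃.≈ XYT.ι p′ R₃.* Ŷ R₃.+ XYT.ι p R₃.* I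
    southward n j i = A.trans (cases j i) (A.sym (combine p′ p Ŷ I n j i))
      where
      cases : ∀ j i → (XYT.y R₃.* S) n j i A.≈ p′ A.* Ŷ n j i A.+ p A.* I n j i
      cases zero zero = A.trans (Three.y-*-zero S n 0) (A.sym (sum₂ (A.zeroʳ p′) (A.zeroʳ p)))
      cases zero (suc i) = A.trans (Three.y-*-zero S n (suc i)) (A.sym (sum₂ (A.zeroʳ p′) (A.zeroʳ p)))
      cases (suc j) zero = A.trans (Three.y-*-suc S n j 0) (A.sym (A.trans (A.+-congˡ (A.zeroʳ p))
        (A.trans (A.+-identityʳ _) (A.*-cong p′≈q″ (prob-swap n (suc j) 0)))))
      cases (suc j) (suc i) = A.trans (Three.y-*-suc S n j (suc i)) (A.sym (A.trans (A.+-congʳ (A.zeroʳ p′))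
        (A.trans (A.+-identityˡ _) (A.*-congʳ p≈q))))

    G : R₃.Carrier
    G = V̂ R₃.+ XYT.ι r′ R₃.* X̂ R₃.+ XYT.ι r′ R₃.* Ŷ R₃.+ XYT.ι r R₃.* I

    northEastward : N R₃.≈ XYT.x R₃.* (XYT.y R₃.* G)
    northEastward n zero zero = A.sym (Three.x-*-zero (XYT.y R₃.* G) n 0)
    northEastward n (suc j) zero = A.sym (Three.x-*-zero (XYT.y R₃.* G) n (suc j))
    northEastward n zero (suc i) = A.sym (A.trans (Three.x-*-suc (XYT.y R₃.* G) n 0 i) (Three.y-*-zero G n i))
    northEastward n (suc j) (suc i) = A.sym (A.trans (Three.x-*-suc (XYT.y R₃.* G) n (suc j) i)
      (A.trans (Three.y-*-suc G n j i) (A.trans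
        (A.+-cong (A.+-cong (A.+-congˡ (Three.ι-* r′ X̂ n j i)) (Three.ι-* r′ Ŷ n j i)) (Three.ι-* r I n j i))
        (cases j i))))
      where
      cases : ∀ j i → V̂ n j i A.+ r′ A.* X̂ n j i A.+ r′ A.* Ŷ n j i A.+ r A.* I n j i A.≈ northEastWeight (i , j) A.* prob n i j
      cases zero zero = A.trans (A.+-cong (A.+-cong (A.+-congˡ (A.zeroʳ r′)) (A.zeroʳ r′)) (A.zeroʳ r))
        (A.trans (A.+-identityʳ _) (A.trans (A.+-identityʳ _) (A.trans (A.+-identityʳ _) (A.sym (A.*-identityˡ _)))))
      cases zero (suc i) = A.trans (A.+-cong (A.+-congˡ (A.zeroʳ r′)) (A.zeroʳ r))
        (A.trans (A.+-identityʳ _) (A.trans (A.+-identityʳ _) (A.+-identityˡ _)))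
      cases (suc j) zero = A.trans (A.+-cong (A.+-congʳ (A.+-congˡ (A.zeroʳ r′))) (A.zeroʳ r))
        (A.trans (A.+-identityʳ _) (A.trans (A.+-congʳ (A.+-identityˡ _)) (A.trans (A.+-identityˡ _)
          (A.*-cong r′≈r″ (prob-swap n (suc j) 0)))))
      cases (suc j) (suc i) = A.trans (A.+-congʳ (A.trans (A.+-cong (A.+-congˡ (A.zeroʳ r′)) (A.zeroʳ r′)) 0+0+0)) (A.+-identityˡ _)

    inX-F : XYT.inX F R₃.≈ V̂ R₃.+ XYT.ι r′ R₃.* X̂
    inX-F n j i = A.trans (inX.+-homo (XT.fromT T.P₀₀) (XT.ι r′ R₂.* XT.P₁) n j i)
      (A.+-congˡ (A.trans (inX.*-homo (XT.ι r′) XT.P₁ n j i)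
        (R₃.*-congʳ {X̂} {XYT.inX (XT.ι r′)} {XYT.ι r′} (Three.inX-ι r′) n j i)))
      where module inX = IsRingHomomorphism Three.inX-homo

    inY-F : XYT.inY F R₃.≈ V̂ R₃.+ XYT.ι r′ R₃.* Ŷ
    inY-F n j i = A.trans (inY.+-homo (XT.fromT T.P₀₀) (XT.ι r′ R₂.* XT.P₁) n j i)
      (A.+-cong (Three.inY-fromT T.P₀₀ n j i) (A.trans (inY.*-homo (XT.ι r′) XT.P₁ n j i)
        (R₃.*-congʳ {Ŷ} {XYT.inY (XT.ι r′)} {XYT.ι r′} (Three.inY-ι r′) n j i)))
      where module inY = IsRingHomomorphism Three.inY-homo

  private
    module Eq₁ = SeriesEquations realRing
    module ι₂ = IsRingHomomorphism Two.ι-homo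

  -- 0 < 1 is not among the axioms; here it follows from 1 = p + p + r.
  1+1>0 : RealField._<_ ℝ A.0# (A.1# A.+ A.1#)
  1+1>0 = +-pos 1>0 1>0
    where
    open IsStrictPartialOrder (RealField.isStrictPartialOrder ℝ) using (<-respʳ-≈)
    1>0 : RealField._<_ ℝ A.0# A.1#
    1>0 = <-respʳ-≈ 2p+r (+-pos (+-pos p>0 p>0) r>0)

  rescaleX-homo : ∀ s → IsRingHomomorphism R₂.rawRing R₂.rawRing (XT.rescaleX s)
  rescaleX-homo s = MapSeries.map-homo R₁ R₁ (S₁.rescale-homo s)

  rescale-inverse : ∀ {a b} → a A.* b A.≈ A.1# → ∀ f i → rescale A.rawRing b (rescale A.rawRing a f) i A.≈ f i
  rescale-inverse {a} {b} ab≈1 f zero = A.trans (A.*-identityˡ _) (A.*-identityˡ _)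
  rescale-inverse {a} {b} ab≈1 f (suc i) = A.trans
    (RingLemmas.cancel-inverse realRing (a ∷ b ∷ _ ∷ _ ∷ f (suc i) ∷ []) (ab≈1 ∷ []))
    (rescale-inverse ab≈1 (f ∘ suc) i)

  rescale-fromT : ∀ s (f : T.Carrier) → XT.rescaleX s (XT.fromT f) R₂.≈ XT.fromT f
  rescale-fromT s f n zero = A.*-identityˡ _
  rescale-fromT s f n (suc i) = A.zeroʳ _

  rescale-ι : ∀ s a → XT.rescaleX s (XT.ι a) R₂.≈ XT.ι a
  rescale-ι s a zero zero = A.*-identityˡ _
  rescale-ι s a zero (suc i) = A.zeroʳ _
  rescale-ι s a (suc n) i = A.zeroʳ _

  rescale-t : ∀ s → XT.rescaleX s XT.t R₂.≈ XT.t
  rescale-t s zero i = A.zeroʳ _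
  rescale-t s (suc zero) zero = A.*-identityˡ _
  rescale-t s (suc zero) (suc i) = A.zeroʳ _
  rescale-t s (suc (suc n)) i = A.zeroʳ _

  rescale-x : ∀ s → XT.rescaleX s XT.x R₂.≈ XT.ι s R₂.* XT.x
  rescale-x s n i = A.trans (cases n i) (A.sym (A.trans (S₂.const-* (const A.rawRing s) XT.x n i) (S₁.const-* s (XT.x n) i)))
    where
    cases : ∀ n i → XT.rescaleX s XT.x n i A.≈ s A.* XT.x n i
    cases zero zero = A.trans (A.zeroʳ _) (A.sym (A.zeroʳ s))
    cases zero (suc zero) = A.*-congʳ (A.*-identityʳ s)
    cases zero (suc (suc i)) = A.trans (A.zeroʳ _) (A.sym (A.zeroʳ s))
    cases (suc n) i = A.trans (A.zeroʳ _) (A.sym (A.zeroʳ s))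

  p-cancellable : Eq₁.Cancellable p
  p-cancellable = #⇒cancellable (>0⇒# p>0)

  cancellable-resp : ∀ {a b} → a A.≈ b → Eq₁.Cancellable a → Eq₁.Cancellable b
  cancellable-resp a≈b a-canc c cb≈0 = a-canc c (A.trans (A.*-congˡ a≈b) cb≈0)

  -- M ≡ x (c + O(x)) modulo t with c invertible.
  free : ∀ {e M γ} f {g : R₁.Carrier} → M 0 R₁.≈ T.t R₁.* (T.t R₁.* f R₁.+ g) → Eq₁.Cancellable (g 0) →
    e R₂.* M R₂.≈ Two.fromT γ → e R₂.≈ R₂.0#
  free {e} {M} {γ} f {g} M₀ g₀ = Two.free-multiple≈0 {e} {M} {γ} (A.trans (M₀ 0) (S₁.var-*-zero (T.t R₁.* f R₁.+ g)))
    (cancellable-resp (A.sym (A.trans (M₀ 1) (A.trans (S₁.var-*-suc (T.t R₁.* f R₁.+ g) 0)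
      (A.trans (A.+-congʳ (S₁.var-*-zero f)) (A.+-identityˡ (g 0)))))) g₀)

  open Transport R₂ R₁ S₂.constantTerm-homo using () renaming (push to push-0)
  open RingNotation R₂.rawRing using () renaming (_·_ to _·₂_)

  free-low : ∀ {e f γ} → e R₂.* (2 ·₂ Formulas.low R₂.rawRing (XT.ι p) (XT.ι r) XT.t (XT.ι p R₂.* XT.fromT T.P₀₀ R₂.+ XT.ι r) XT.x
                               R₂.+ XT.x R₂.* XT.x R₂.* f) R₂.≈ Two.fromT γ → e R₂.≈ R₂.0#
  free-low {e} {f} {γ} = free {e} {2 ·₂ Formulas.low R₂.rawRing (XT.ι p) (XT.ι r) XT.t h XT.x R₂.+ XT.x R₂.* XT.x R₂.* f} {γ} (f 0)
    (R₁.trans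
      (push-0 (2 E.· EF.low (ν 0F) (ν 1F) (ν 2F) (ν 3F) (ν 4F) E.+ ν 4F E.* ν 4F E.* ν 5F)
        {XT.ι p ∷ XT.ι r ∷ XT.t ∷ h ∷ XT.x ∷ f ∷ []} (R₁.refl ∷ R₁.refl ∷ R₁.refl ∷ h₀ ∷ R₁.refl ∷ R₁.refl ∷ []))
      (KernelLemmas.low-at-0 R₁ (const A.rawRing p ∷ const A.rawRing r ∷ R₁.0# ∷ (const A.rawRing p R₁.* const A.rawRing (T.P₀₀ 0) R₁.+ const A.rawRing r) ∷ T.t ∷ f 0 ∷ []) (R₁.refl ∷ [])))
    -- At t = 0 the factor is - 2 (p + r) x + O(x²), since P₀₀ has constant term 1.
    (Eq₁.unit⇒cancellable (KernelLemmas.low-unit realRing (p ∷ r ∷ _ ∷ T.P₀₀ 0 ∷ [])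
      (proj₂ (#⇒unit (>0⇒# (+-pos p+r>0 p+r>0))) ∷ A.refl ∷ [])))
    where
    h : R₂.Carrier
    h = XT.ι p R₂.* XT.fromT T.P₀₀ R₂.+ XT.ι r
    h₀ : h 0 R₁.≈ const A.rawRing p R₁.* const A.rawRing (T.P₀₀ 0) R₁.+ const A.rawRing r
    h₀ i = A.+-congʳ (A.+-identityʳ _)

  free-axis : ∀ {e γ} → e R₂.* Two.axis p r R₂.≈ Two.fromT γ → e R₂.≈ R₂.0#
  free-axis {e} {γ} = free {e} {Two.axis p r} {γ} R₁.0#
    (λ i → A.trans (Two.axis≈α p r 0 i) (A.trans
      (push-0 (EF.α (ν 0F) (ν 1F) (ν 2F) (ν 3F)) {XT.ι p ∷ XT.ι r ∷ XT.t ∷ XT.x ∷ []}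
        (R₁.refl ∷ R₁.refl ∷ R₁.refl ∷ R₁.refl ∷ []) i)
      (KernelLemmas.α-at-0 R₁ (const A.rawRing p ∷ const A.rawRing r ∷ R₁.0# ∷ T.t ∷ []) (R₁.refl ∷ []) i)))
    (Eq₁.unit⇒cancellable (KernelLemmas.α-unit realRing (p ∷ r ∷ _ ∷ [])
      (proj₂ (#⇒unit (>0⇒# p+r>0)) ∷ 2p+r ∷ [])))

  atX=0-x : Two.atX=0 XT.x R₁.≈ R₁.0#
  atX=0-x zero = A.refl
  atX=0-x (suc n) = A.refl

  module _ (Z : T.Carrier) (isZ : T.IsZ Z) where
    Z-equation : Z R₁.≈ R₁.1# R₁.+ Formulas.τ R₁.rawRing (T.ι p) (T.ι r) T.t R₁.* (Z R₁.* Z R₁.* Z)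
    Z-equation = KernelLemmas.Z-normal R₁ (T.ι p ∷ T.ι q ∷ T.ι r ∷ T.t ∷ Z ∷ []) (isZ ∷ ι₁.⟦⟧-cong p≈q ∷ [])

    Z₀ : Z 0 A.≈ A.1#
    Z₀ = A.trans (KernelLemmas.Z-tail R₁ (T.ι p ∷ T.ι r ∷ T.t ∷ Z ∷ []) (Z-equation ∷ []) 0)
      (A.trans (A.+-congˡ (S₁.var-*-zero (4 · (T.ι p R₁.* T.ι p R₁.* T.ι r R₁.* (T.t R₁.* T.t)) R₁.* (Z R₁.* Z R₁.* Z)))) (A.+-identityʳ _))
      where open RingNotation R₁.rawRing using (_·_)

    private
      module Z⁻¹ = Eq₁.Inverse Z {A.1#} (A.trans (A.*-identityʳ _) Z₀)

    ζ : T.Carrier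
    ζ = Z⁻¹.inverse

    ζZ : ζ R₁.* Z R₁.≈ R₁.1#
    ζZ = R₁.trans (R₁.*-comm ζ Z) Z⁻¹.*-inverse

    -- ζ has constant term 1, so the cancelled factor has constant term p.
    ζ-cancel : ∀ {f} → f R₁.* (ζ R₁.- (R₁.1# R₁.- T.ι p)) R₁.≈ R₁.0# → f R₁.≈ R₁.0#
    ζ-cancel {f} = Eq₁.*-cancel-zero {f} {ζ R₁.- (R₁.1# R₁.- T.ι p)} (Eq₁.unit⇒cancellable
      (KernelLemmas.shifted-reciprocal realRing (p ∷ _ ∷ Z 0 ∷ ζ 0 ∷ [])
        (proj₂ (#⇒unit (>0⇒# p>0)) ∷ A.trans (A.sym (S₁.*-zero-coeff ζ Z)) (ζZ 0) ∷ Z₀ ∷ [])))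

    module _ (√Δ₊ : XT.Carrier) (is√ : XT.Is√Δ₊ Z √Δ₊) where
      π : A.Carrier
      π = A.1# ÷ p ⟨ p>0 ⟩

      √ : XT.Carrier
      √ = XT.rescaleX π √Δ₊

      module Rescaled = RescaledRoot R₁ R₂ (rescaleX-homo π) Two.atX=0-homo
        {XT.ι p} {XT.ι q} {XT.ι r} {XT.t} {XT.fromT Z} {XT.x} {XT.ι π} {√Δ₊} {XT.Δ₊ Z}
        (rescale-ι π p) (rescale-ι π q) (rescale-ι π r) (rescale-t π) (rescale-fromT π Z) (rescale-x π)
        (ι₂.⟦⟧-cong p≈q)
        (λ n i → A.trans (A.sym (ι₂.*-homo π p n i)) (A.trans (ι₂.⟦⟧-cong (÷-*-cancel A.1# p>0) n i) (ι₂.1#-homo n i)))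
        atX=0-x
        (proj₁ is√) (λ n i → A.refl)

      -- The hypothesis on √Δ₊ fixes its coefficient of t⁰ only. At x = 0 the square is 1, and
      -- uniqueness of square roots extends the value 1 to all orders in t.
      √-constant : Two.atX=0 √ R₁.≈ R₁.1#
      √-constant = Eq₁.sqrt-unique {R₁.1#} {A.1#} {_} {Two.atX=0 √} {R₁.1#} (proj₂ (#⇒unit (>0⇒# 1+1>0)))
        (Rescaled.constant-square , A.trans (A.*-identityˡ _) (proj₂ is√ 0))
        (R₁.*-identityˡ R₁.1# , A.refl)

      √-tail : √ R₂.≈ R₂.1# R₂.+ XT.x R₂.* Two.tailX √
      √-tail n i = A.trans (Two.fromT+x* √ n i) (A.+-congʳ (constant n i))
        where
        constant : ∀ n i → Two.fromT (Two.atX=0 √) n i A.≈ R₂.1# n i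
        constant zero zero = √-constant 0
        constant zero (suc i) = A.refl
        constant (suc n) zero = √-constant (suc n)
        constant (suc n) (suc i) = A.refl

      model : KernelModel ℝ p r p>0 r>0 2p+r
      model = record
        { R₁ = R₁ ; R₂ = R₂ ; R₃ = R₃
        ; ι₁ = T.ι ; ι₁-homo = S₁.const-homo ; ι₂ = XT.ι ; ι₂-homo = Two.ι-homo ; ι₃ = XYT.ι ; ι₃-homo = Three.ι-homo
        ; fromT = XT.fromT ; fromT-homo = Two.fromT-homo
        ; inX = XYT.inX ; inX-homo = Three.inX-homo ; inY = XYT.inY ; inY-homo = Three.inY-homo
        ; t₁ = T.t ; t₂ = XT.t ; x₂ = XT.x ; t₃ = XYT.t ; x₃ = XYT.x ; y₃ = XYT.y
        ; fromT-ι = MapSeries.map-const realRing R₁ S₁.const-homo ; fromT-t = MapSeries.map-var realRing R₁ S₁.const-homo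
        ; inX-ι = Three.inX-ι ; inX-t = Three.inX-t ; inX-x = Three.inX-x
        ; inY-ι = Three.inY-ι ; inY-t = Three.inY-t ; inY-x = Three.inY-x ; inY-fromT = Three.inY-fromT
        ; axis = Two.axis p r ; axis≈α = Two.axis≈α p r
        ; kernel = Three.kernel p r ; kernel≈K = Three.kernel≈K p r
        ; fromT-injective = λ f≈0 n → f≈0 n 0
        ; x-cancel = λ {f} {g} → Two.x-*-cancel {f} {g}
        ; cancel-α = λ {f} {g} → Two.cancel-axis p r p-cancellable {f} {g}
        ; cancel-x = λ {f} {g} → Three.KernelDivisibility.cancel-x p r p-cancellable {f} {g}
        ; cancel-y = λ {f} {g} → Three.KernelDivisibility.cancel-y p r p-cancellable {f} {g}
        ; decoupled = λ {B} {H} → Three.KernelDivisibility.decoupled p r p-cancellable {B} {H}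
        ; free-α = λ {e} {γ} → free-axis {e} {γ}
        ; p′ = p′ ; r′ = r′ ; r*p′≈p*r′ = r*p′≈p*r′ ; p′+r′≈1 = p′+r′≈1
        ; V = T.P₀₀ ; F₁′ = Two.atX=0 F′ ; P₁₀ = P₁₀ ; F = F ; F′ = F′ ; F″ = F″
        ; P = XYT.P ; X̂ = X̂ ; Ŷ = Ŷ ; I = I ; W = W ; S = S ; N = N
        ; decomposition = decomposition ; first-and-last = first-and-last
        ; westward = westward ; southward = southward ; northEastward = northEastward
        ; inX-F = inX-F ; inY-F = inY-F
        ; F-tail = F-tail ; F′-tail = Two.fromT+x* F′ ; F₁′≈ = F₁≈ ; V≈ = V≈
        ; free-low = λ {e} {f} {γ} → free-low {e} {f} {γ}
        ; Z = Z ; ζ = ζ ; √ = √ ; √′ = Two.tailX √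
        ; Z-equation = Z-equation ; ζZ = ζZ ; ζ-cancel = λ {f} → ζ-cancel {f}
        ; √-tail = √-tail ; √-square = Rescaled.rescaled-square
        }

-- The formulas, and the algebraicity of P

module Conclusion {c ℓ₁ ℓ₂ ℓ₃} (ℝ : RealField c ℓ₁ ℓ₂ ℓ₃) (p q r : RealField.Carrier ℝ)
  (p>0 : RealField._<_ ℝ (RealField.0# ℝ) p)
  (q>0 : RealField._<_ ℝ (RealField.0# ℝ) q)
  (r>0 : RealField._<_ ℝ (RealField.0# ℝ) r)
  (total : RealField._≈_ ℝ (RealField._+_ ℝ (RealField._+_ ℝ p q) r) (RealField.1# ℝ))
  (p≈q : RealField._≈_ ℝ p q) where

  open RealFacts ℝ
  open RealField ℝ using (_÷_⟨_⟩; +-pos; _#_)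
  open Walk ℝ p q r p>0 q>0 r>0
  open WalkFacts ℝ p q r p>0 q>0 r>0 using (module Symmetric)
  open WalkSeries ℝ p q r p>0 q>0 r>0 total p≈q
  open Algebra.Apartness.Properties.HeytingCommutativeRing (RealField.heytingCommutativeRing ℝ) using (#-congʳ; x#0y#0→xy#0)
  private
    module S₁ = SeriesRing realRing
    module S₂ = SeriesRing R₁
    module S₃ = SeriesRing R₂
    module Eq₁ = SeriesEquations realRing
    module Eq₂ = SeriesEquations R₁
    module ι₁ = IsRingHomomorphism S₁.const-homo
    module ι₂ = IsRingHomomorphism Two.ι-homo
    module fromT = IsRingHomomorphism Two.fromT-homo

    u : A.Carrier
    u = proj₁ (#⇒unit (>0⇒# r>0))
    r*u≈1 : r A.* u A.≈ A.1#
    r*u≈1 = proj₂ (#⇒unit (>0⇒# r>0))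

  Z-exists-unique : ∃! T._≈_ T.IsZ
  Z-exists-unique = fix ,
    KernelLemmas.Z-unfold R₁ (T.ι p ∷ T.ι q ∷ T.ι r ∷ T.t ∷ fix ∷ []) (fix-unfold ∷ []) ,
    λ {Z} isZ → fix-unique fix-unfold (KernelLemmas.Z-fold R₁ (T.ι p ∷ T.ι q ∷ T.ι r ∷ T.t ∷ Z ∷ []) (isZ ∷ []))
    where
    open RingNotation R₁.rawRing using (_·_)
    -- The equation reads Z = 1 + t · (4pqrt²) Z³; the list holds the coefficients of Z⁰, ..., Z³.
    open Eq₁.Fixpoint R₁.1# (R₁.0# ∷ R₁.0# ∷ R₁.0# ∷ 4 · (T.ι p R₁.* T.ι q R₁.* T.ι r R₁.* (T.t R₁.* T.t)) ∷ [])

  module _ (Z : T.Carrier) (isZ : T.IsZ Z) where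
    private
      v : A.Carrier
      v = proj₁ (#⇒unit (>0⇒# (+-pos p+r>0 p+r>0)))

      2[1-p]*v≈1 : (A.1# A.- p A.+ (A.1# A.- p)) A.* v A.≈ A.1#
      2[1-p]*v≈1 = KernelLemmas.reciprocal-total realRing (p ∷ r ∷ v ∷ [])
        (proj₂ (#⇒unit (>0⇒# (+-pos p+r>0 p+r>0))) ∷ 2p+r ∷ [])

    √Δ₋-exists-unique : ∃! T._≈_ (T.Is√Δ₋[p/t] Z)
    √Δ₋-exists-unique = Eq₁.sqrt-exists-unique (T.Δ₋[p/t] Z) {A.1# A.- p} {v}
      (A.trans (KernelLemmas.discriminant-constant realRing (p ∷ Z 0 ∷ []) (Z₀ Z isZ ∷ []))
        (A.sym (push (E.1# E.- ν 0F E.* ν 1F E.* (E.1# E.+ ν 1F) E.+ ν 0F E.^ 2 E.* ν 1F E.^ 2) {T.ι p ∷ Z ∷ []}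
          (A.refl ∷ A.refl ∷ []))))
      2[1-p]*v≈1
      where open Transport R₁ realRing S₁.constantTerm-homo

    √Δ₊-exists-unique : ∃! XT._≈_ (XT.Is√Δ₊ Z)
    √Δ₊-exists-unique = Eq₂.sqrt-exists-unique (XT.Δ₊ Z) {R₁.1#} {T.ι w}
      (λ i → A.trans (R₁.*-identityˡ R₁.1# i) (A.sym (A.trans
        (push (E.1# E.- 4 E.· (ν 0F E.* ν 1F E.* ν 2F E.* ν 3F E.^ 2 E.* ν 4F E.^ 2 E.* ν 5F))
          {XT.ι p ∷ XT.ι q ∷ XT.ι r ∷ XT.t ∷ XT.fromT Z ∷ XT.x ∷ []}
          (R₁.refl ∷ R₁.refl ∷ R₁.refl ∷ R₁.refl ∷ R₁.refl ∷ R₁.refl ∷ []) i)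
        (KernelLemmas.Δ₊-at-0 R₁ (T.ι p ∷ T.ι q ∷ T.ι r ∷ const A.rawRing (Z 0) ∷ T.t ∷ []) [] i))))
      (λ i → A.trans (R₁.*-congʳ {T.ι w} (λ j → A.sym (A.trans (ι₁.+-homo A.1# A.1# j) (A.+-cong (ι₁.1#-homo j) (ι₁.1#-homo j)))) i)
        (A.trans (A.sym (ι₁.*-homo (A.1# A.+ A.1#) w i)) (A.trans (ι₁.⟦⟧-cong (proj₂ (#⇒unit (>0⇒# 1+1>0))) i) (ι₁.1#-homo i))))
      where
      open Transport R₂ R₁ S₂.constantTerm-homo
      w : A.Carrier
      w = proj₁ (#⇒unit (>0⇒# 1+1>0))

    module _ (√Δ₋ : T.Carrier) (√Δ₊ : XT.Carrier) (is√₋ : T.Is√Δ₋[p/t] Z √Δ₋) (is√₊ : XT.Is√Δ₊ Z √Δ₊) where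
      private
        open module M = KernelMethod (model Z isZ √Δ₊ is√₊)
        open RingNotation R₁.rawRing using (_·_)
        ζ′ : T.Carrier
        ζ′ = ζ Z isZ

      -- By `origin-square` the square of (pP₀₀ + r)(1 - 2pZ)/r is Δ₋, and its constant term (p +
      -- r)(1 - 2p)/r = 1 - p decides the sign.
      √Δ₋-root : (T.ι p R₁.* T.P₀₀ R₁.+ T.ι r) R₁.* (R₁.1# R₁.- 2 · (T.ι p R₁.* Z)) R₁.≈ T.ι r R₁.* √Δ₋
      √Δ₋-root = KernelLemmas.root-scaled R₁ (T.ι r ∷ T.ι u ∷ h[1-2pZ] ∷ √Δ₋ ∷ []) (ι[r*u]≈1 ∷ root ∷ [])
        where
        h[1-2pZ] : T.Carrier
        h[1-2pZ] = (T.ι p R₁.* T.P₀₀ R₁.+ T.ι r) R₁.* (R₁.1# R₁.- 2 · (T.ι p R₁.* Z))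

        ι[r*u]≈1 : T.ι r R₁.* T.ι u R₁.≈ R₁.1#
        ι[r*u]≈1 = R₁.trans (R₁.sym (ι₁.*-homo r u)) (R₁.trans (ι₁.⟦⟧-cong r*u≈1) ι₁.1#-homo)

        open Transport R₁ realRing S₁.constantTerm-homo

        root : T.ι u R₁.* h[1-2pZ] R₁.≈ √Δ₋
        root = Eq₁.sqrt-unique {T.Δ₋[p/t] Z} {A.1# A.- p} {v} {T.ι u R₁.* h[1-2pZ]} {√Δ₋} 2[1-p]*v≈1
          (KernelLemmas.discriminant-root R₁ (T.ι p ∷ T.ι r ∷ T.t ∷ (T.ι p R₁.* T.P₀₀ R₁.+ T.ι r) ∷ ζ′ ∷ Z ∷ T.ι u ∷ [])
             (M.origin-square ∷ ι[r*u]≈1 ∷ ζZ Z isZ ∷ []) ,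
           A.trans (push (ν 0F E.* ((ν 1F E.* ν 2F E.+ ν 3F) E.* (E.1# E.- 2 E.· (ν 1F E.* ν 4F))))
                     {T.ι u ∷ T.ι p ∷ T.P₀₀ ∷ T.ι r ∷ Z ∷ []} (A.refl ∷ A.refl ∷ A.refl ∷ A.refl ∷ A.refl ∷ []))
             (KernelLemmas.root-constant realRing (p ∷ r ∷ u ∷ A.1# ∷ Z 0 ∷ []) (r*u≈1 ∷ A.refl ∷ Z₀ Z isZ ∷ 2p+r ∷ [])))
          is√₋

      private
        module D = Eq₁.Inverse (T.1-2pZ Z) {u}
          (KernelLemmas.one-minus-2pZ-unit realRing (p ∷ r ∷ u ∷ Z 0 ∷ []) (Z₀ Z isZ ∷ r*u≈1 ∷ 2p+r ∷ []))

      D⁻¹ : T.Carrier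
      D⁻¹ = D.inverse

      D-invertible : T.Invertible T.1# T._*_ (T.1-2pZ Z)
      D-invertible = D⁻¹ , R₁.trans (R₁.*-comm D⁻¹ (T.1-2pZ Z)) D.*-inverse , D.*-inverse

      E⁻¹ : XT.Carrier
      E⁻¹ = XT.fromT (ζ′ R₁.* D⁻¹)

      E-inverse : XT.Z[1-2pZ] Z R₂.* E⁻¹ R₂.≈ R₂.1#
      E-inverse n i = A.trans (R₂.*-congʳ {E⁻¹} {XT.Z[1-2pZ] Z} {XT.fromT (Z R₁.* T.1-2pZ Z)}
          (λ n i → A.sym (fromT.*-homo Z (T.1-2pZ Z) n i)) n i)
        (A.trans (A.sym (fromT.*-homo (Z R₁.* T.1-2pZ Z) (ζ′ R₁.* D⁻¹) n i))
          (A.trans (fromT.⟦⟧-cong (KernelLemmas.product-inverse R₁ (T.1-2pZ Z ∷ D⁻¹ ∷ Z ∷ ζ′ ∷ []) (ζZ Z isZ ∷ D.*-inverse ∷ [])) n i)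
            (fromT.1#-homo n i)))

      E-invertible : XT.Invertible XT.1# XT._*_ (XT.Z[1-2pZ] Z)
      E-invertible = E⁻¹ , (λ n i → A.trans (R₂.*-comm E⁻¹ (XT.Z[1-2pZ] Z) n i) (E-inverse n i)) , E-inverse

      origin-formula : T.P₀₀ T.≈ T.originFormula √Δ₋ D⁻¹
      origin-formula = KernelLemmas.origin-formula R₁
        (T.ι p ∷ T.ι r ∷ T.t ∷ T.P₀₀ ∷ Z ∷ √Δ₋ ∷ D⁻¹ ∷ T.ι (proj₁ (#⇒unit (>0⇒# p>0))) ∷ T.ι (r ÷ p ⟨ p>0 ⟩) ∷ [])
        (√Δ₋-root ∷ D.*-inverse ∷
         R₁.trans (R₁.sym (ι₁.*-homo p _)) (R₁.trans (ι₁.⟦⟧-cong (proj₂ (#⇒unit (>0⇒# p>0)))) ι₁.1#-homo) ∷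
         R₁.trans (R₁.sym (ι₁.*-homo (r ÷ p ⟨ p>0 ⟩) p)) (ι₁.⟦⟧-cong (÷-*-cancel r p>0)) ∷ [])

      private
        ι-inverse : ∀ {a b} → a A.* b A.≈ A.1# → XT.ι a R₂.* XT.ι b R₂.≈ R₂.1#
        ι-inverse {a} {b} ab≈1 n i = A.trans (A.sym (ι₂.*-homo a b n i)) (A.trans (ι₂.⟦⟧-cong ab≈1 n i) (ι₂.1#-homo n i))

        p+p : XT.ι p R₂.+ XT.ι p R₂.≈ XT.ι (p A.+ p)
        p+p n i = A.sym (ι₂.+-homo p p n i)

        p+p-unit : A.Carrier
        p+p-unit = proj₁ (#⇒unit (>0⇒# (+-pos p>0 p>0)))

        half : A.Carrier
        half = r ÷ (p A.+ p) ⟨ +-pos p>0 p>0 ⟩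

        rescale-Q : XT.rescaleX p F R₂.≈ XT.Q[px,0]
        rescale-Q n i = A.trans (rescaleX.+-homo (XT.fromT T.P₀₀) (XT.ι r′ R₂.* XT.P₁) n i)
          (A.+-cong (rescale-fromT p T.P₀₀ n i) (A.trans (rescaleX.*-homo (XT.ι r′) XT.P₁ n i)
            (R₂.*-congʳ {XT.rescaleX p XT.P₁} {XT.rescaleX p (XT.ι r′)} {XT.ι r′} (rescale-ι p r′) n i)))
          where module rescaleX = IsRingHomomorphism (rescaleX-homo p)

        rescale-√ : XT.rescaleX p (√ Z isZ √Δ₊ is√₊) R₂.≈ √Δ₊
        rescale-√ n i = rescale-inverse (÷-*-cancel A.1# p>0) (√Δ₊ n) i

        atX=0-t : Two.atX=0 XT.t R₁.≈ T.t
        atX=0-t zero = A.refl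
        atX=0-t (suc zero) = A.refl
        atX=0-t (suc (suc n)) = A.refl

        module Transferred = KernelTransfer R₁ R₂ Two.fromT-homo {T.ι p} {T.ι r} {T.P₀₀} {Z} {√Δ₋} {XT.ι p} {XT.ι r}
          (MapSeries.map-const realRing R₁ S₁.const-homo p) (MapSeries.map-const realRing R₁ S₁.const-homo r)

        module Axis = RescaledAxis R₁ R₂ (rescaleX-homo p) Two.atX=0-homo
          {XT.ι p} {XT.ι r} {XT.t} {XT.x} {XT.fromT T.P₀₀} {XT.fromT Z} {XT.fromT ζ′} {XT.fromT √Δ₋} {√ Z isZ √Δ₊ is√₊}
          {F} {XT.Q[px,0]} {√Δ₊} {E⁻¹} {XT.ι (π Z isZ √Δ₊ is√₊)} {XT.ι half} {XT.ι p+p-unit} {XT.axisFactor} {XT.axisFormula Z √Δ₋ √Δ₊ E⁻¹} {T.t}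
          (rescale-ι p p) (rescale-ι p r) (rescale-t p) (rescale-x p)
          (rescale-fromT p T.P₀₀) (rescale-fromT p Z) (rescale-fromT p ζ′) rescale-√ rescale-Q atX=0-x atX=0-t
          (λ n i → A.refl) (λ n i → A.refl)

      axis-formula : XT.axisFactor R₂.* XT.Q[px,0] R₂.≈ XT.axisFormula Z √Δ₋ √Δ₊ E⁻¹
      axis-formula = Axis.axis-formula
        (λ n i → A.trans (R₂.*-congʳ {XT.ι p+p-unit} p+p n i) (ι-inverse (proj₂ (#⇒unit (>0⇒# (+-pos p>0 p>0)))) n i))
        (λ n i → A.trans (R₂.*-congˡ {XT.ι half} p+p n i) (A.trans (A.sym (ι₂.*-homo half (p A.+ p) n i))
          (ι₂.⟦⟧-cong (÷-*-cancel r (+-pos p>0 p>0)) n i)))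
        (ι-inverse (÷-*-cancel A.1# p>0))
        M.axis-root
        (Transferred.transfer-inverse {ζ′ R₁.* D⁻¹}
          (KernelLemmas.product-inverse R₁ (T.1-2pZ Z ∷ D⁻¹ ∷ Z ∷ ζ′ ∷ []) (ζZ Z isZ ∷ D.*-inverse ∷ [])))
        (λ n i → A.trans (A.sym (fromT.*-homo ζ′ Z n i)) (A.trans (fromT.⟦⟧-cong (ζZ Z isZ) n i) (fromT.1#-homo n i)))
        (Transferred.transfer √Δ₋-root)

      axisFactor-at-0 : XT.atX=0 XT.axisFactor R₁.≈ T.t
      axisFactor-at-0 = Axis.axis-factor-at-0

      Q-at-0 : XT.atX=0 XT.Q[px,0] R₁.≈ T.P₀₀
      Q-at-0 n = A.trans (A.+-congˡ (A.trans (Two.ι-* r′ (XT.rescaleX p XT.P₁) n 0)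
        (A.trans (A.*-congˡ (A.zeroʳ _)) (A.zeroʳ r′)))) (A.+-identityʳ _)

      -- Obtained from the left side of the axis formula at x = 0, without any computation on its
      -- right side.
      axisFormula-at-0 : XT.atX=0 (XT.axisFormula Z √Δ₋ √Δ₊ E⁻¹) R₁.≈ T.t R₁.* T.originFormula √Δ₋ D⁻¹
      axisFormula-at-0 n = A.trans (A.sym (axis-formula n 0)) (A.trans
        (IsRingHomomorphism.*-homo Two.atX=0-homo XT.axisFactor XT.Q[px,0] n)
        (R₁.*-cong axisFactor-at-0 (R₁.trans Q-at-0 origin-formula) n))

      private
        √/q : XT.Carrier
        √/q = XT.rescaleX (A.1# ÷ q ⟨ q>0 ⟩) √Δ₊

        inY-√ : XYT.inY (√ Z isZ √Δ₊ is√₊) R₃.≈ XYT.inY √/q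
        inY-√ = IsRingHomomorphism.⟦⟧-cong Three.inY-homo {√ Z isZ √Δ₊ is√₊} {√/q}
          λ n i → A.*-congʳ (power-cong i)
          where
          open RingNotation A.rawRing using (_^_)
          power-cong : ∀ i → (A.1# ÷ p ⟨ p>0 ⟩) ^ i A.≈ (A.1# ÷ q ⟨ q>0 ⟩) ^ i
          power-cong zero = A.refl
          power-cong (suc i) = A.*-cong (Symmetric.quotient-cong p≈q p>0 q>0 A.refl p≈q) (power-cong i)

        open ExplicitPolynomials ℝ p r p>0 r>0 2p+r

        vars : Vec XYT.Carrier 7
        vars = XYT.x ∷ XYT.y ∷ XYT.t ∷ XYT.fromT Z ∷ XYT.fromT √Δ₋ ∷ XYT.inX (√ Z isZ √Δ₊ is√₊) ∷ XYT.inY √/q ∷ []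

        leading-coefficient : leading R₃ Three.ι-homo XYT.t (XYT.fromT Z) 0 0 0 A.≈ (p A.+ p) A.* r A.* ((A.1# A.- p) A.* (A.1# A.- p))
        leading-coefficient = A.trans
          (Transport.push R₃ realRing (compose A.trans (compose R₁.trans S₃.constantTerm-homo S₂.constantTerm-homo) S₁.constantTerm-homo)
            (2 E.· (ν 0F E.* EF.ε (ν 0F) (ν 1F) (ν 2F) (ν 3F) E.* (E.1# E.- ν 0F) E.* (E.1# E.- ν 0F)))
            {XYT.ι p ∷ XYT.ι r ∷ XYT.t ∷ XYT.fromT Z ∷ []} (A.refl ∷ A.refl ∷ A.refl ∷ A.refl ∷ []))
          (KernelLemmas.leading-constant realRing (p ∷ r ∷ Z 0 ∷ []) (Z₀ Z isZ ∷ 2p+r ∷ []))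

        1-p#0 : A.1# A.- p # A.0#
        1-p#0 = #-congʳ (KernelLemmas.complement realRing (p ∷ r ∷ []) (2p+r ∷ [])) (>0⇒# p+r>0)

        -- The indices are the degrees in t, y and x: at t = 0 the denominator contains x² y² with
        -- the coefficient 2pr (1 - p)².
        denominator-coefficient : Polynomials.eval ℝ R₃.rawRing XYT.ι denominatorP vars 0 2 2 # A.0#
        denominator-coefficient =
          let v , eq = denominator-leading R₃ Three.ι-homo XYT.x XYT.y XYT.t (XYT.fromT Z) (XYT.fromT √Δ₋)
                         (XYT.inX (√ Z isZ √Δ₊ is√₊)) (XYT.inY √/q)
              L = leading R₃ Three.ι-homo XYT.t (XYT.fromT Z)
          in #-congʳ (A.sym (A.trans (eq 0 2 2) (A.trans
               (A.+-cong
                 (A.trans (Three.x-*-suc (XYT.x R₃.* (XYT.y R₃.* (XYT.y R₃.* L))) 0 2 1)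
                   (A.trans (Three.x-*-suc (XYT.y R₃.* (XYT.y R₃.* L)) 0 2 0)
                     (A.trans (Three.y-*-suc (XYT.y R₃.* L) 0 1 0) (Three.y-*-suc L 0 0 0))))
                 (Three.t-*-zero v 2 2))
               (A.trans (A.+-identityʳ _) leading-coefficient))))
             (x#0y#0→xy#0 (x#0y#0→xy#0 (>0⇒# (+-pos p>0 p>0)) (>0⇒# r>0)) (x#0y#0→xy#0 1-p#0 1-p#0))

      P-expressible : XYT.IsExpressibleIn Z √Δ₋ √Δ₊ XYT.P
      P-expressible = numeratorP , denominatorP , (0 , 2 , 2 , denominator-coefficient) ,
        M.P-rational {√Δ₋} {XYT.inY √/q} inY-√ √Δ₋-root

  P-isAlgebraic : XYT.IsAlgebraic XYT.P
  P-isAlgebraic = annihilator , annihilator-nonzero , KernelMethod.P-algebraic (model Z isZ √Δ₊ is√₊)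
    where
    open ExplicitPolynomials ℝ p r p>0 r>0 2p+r using (annihilator; annihilator-nonzero)
    Z = proj₁ Z-exists-unique
    isZ = proj₁ (proj₂ Z-exists-unique)
    √Δ₊ = proj₁ (√Δ₊-exists-unique Z isZ)
    is√₊ = proj₁ (proj₂ (√Δ₊-exists-unique Z isZ))

-- The degree of P₀₀

module UnivariatePolynomials {c ℓ₁ ℓ₂ ℓ₃} (ℝ : RealField c ℓ₁ ℓ₂ ℓ₃) where
  open RealFacts ℝ
  open PolynomialArithmetic ℝ
  open Polynomials ℝ
  private
    module A = CommutativeRing realRing
    C = A.Carrier

  composeP : Poly C 1 → Poly C 1 → Poly C 1
  composeP [] q = []
  composeP (a ∷ c) q = addP 1 (constP 1 a) (mulP 1 q (composeP c q))

  module Values (S : CommutativeRing c ℓ₁) {ι : C → CommutativeRing.Carrier S}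
    (ι-homo : IsRingHomomorphism A.rawRing (CommutativeRing.rawRing S) ι) where
    open CommutativeRing S
    open IsRingHomomorphism ι-homo

    ev : Poly C 1 → Carrier → Carrier
    ev c s = eval rawRing ι {1} c (s ∷ [])

    ev-cong : ∀ c {s s′} → s ≈ s′ → ev c s ≈ ev c s′
    ev-cong [] s≈ = refl
    ev-cong (a ∷ c) s≈ = +-congˡ (*-cong s≈ (ev-cong c s≈))

    ev-compose : ∀ c q s → ev (composeP c q) s ≈ ev c (ev q s)
    ev-compose [] q s = refl
    ev-compose (a ∷ c) q s = trans (eval-add S ι-homo 1 (constP 1 a) (mulP 1 q (composeP c q)) (s ∷ []))
      (+-cong (eval-const S ι-homo 1 a (s ∷ []))
        (trans (eval-mul S ι-homo 1 q (composeP c q) (s ∷ [])) (*-congˡ (ev-compose c q s))))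

    ev-zero : ∀ c → Zero 1 c → ∀ s → ev c s ≈ 0#
    ev-zero [] [] s = refl
    ev-zero (a ∷ c) (lift a≈0 ∷ c≈0) s = trans (+-cong (trans (⟦⟧-cong a≈0) 0#-homo)
      (trans (*-congˡ (ev-zero c c≈0 s)) (zeroʳ s))) (+-identityˡ 0#)

  R₁ : CommutativeRing c ℓ₁
  R₁ = SeriesRing.seriesRing realRing
  private
    module R₁ = CommutativeRing R₁
    module S₁ = SeriesRing realRing

  open Values R₁ S₁.const-homo public

  Regular : R₁.Carrier → Set _
  Regular s = ∀ f → f R₁.* s R₁.≈ R₁.0# → f R₁.≈ R₁.0#

  -- A regular series without constant term is transcendental over ℝ: the constant term of the
  -- relation is its lowest coefficient, and afterwards s cancels.
  ev≈0⇒zero : ∀ {s} → s 0 A.≈ A.0# → Regular s → ∀ c → ev c s R₁.≈ R₁.0# → Zero 1 c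
  ev≈0⇒zero s₀ regular [] _ = []
  ev≈0⇒zero {s} s₀ regular (a ∷ c) eq = lift a≈0 ∷ ev≈0⇒zero s₀ regular c
    (regular (ev c s) (R₁.trans (R₁.*-comm (ev c s) s) λ n → A.trans (A.sym (A.trans (A.+-congʳ (const≈0 n)) (A.+-identityˡ _))) (eq n)))
    where
    a≈0 : a A.≈ A.0#
    a≈0 = A.trans (A.sym (A.trans (A.+-congˡ (A.trans (S₁.*-zero-coeff s (ev c s)) (A.trans (A.*-congʳ s₀) (A.zeroˡ _))))
      (A.+-identityʳ a))) (eq 0)
    const≈0 : const A.rawRing a R₁.≈ R₁.0#
    const≈0 zero = a≈0
    const≈0 (suc n) = A.refl

  X : R₁.Carrier
  X = var A.rawRing

  X-regular : Regular X
  X-regular f fX≈0 n = A.trans (A.sym (A.trans (R₁.*-comm f X (suc n)) (S₁.var-*-suc f n))) (fX≈0 (suc n))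

  private
    1+X : Expr C 1
    1+X = 𝟙 ⊕ ν 0F
    1+XP : Poly C 1
    1+XP = proj₁ (represent 1+X)

  -- An identity between polynomials in ζ = 1 + O(t) may be read in ℝ[X].
  transfer : ∀ {ζ} → ζ 0 A.≈ A.1# → Regular (ζ R₁.- R₁.1#) → ∀ Q → ev Q ζ R₁.≈ R₁.0# → ev Q X R₁.≈ R₁.0#
  transfer {ζ} ζ₀ regular Q eq = R₁.trans (R₁.sym (shift (OriginLemmas.add-back R₁ (R₁.1# ∷ X ∷ []) [])))
    (ev-zero (composeP Q 1+XP) (ev≈0⇒zero {ζ R₁.- R₁.1#} (A.trans (A.+-congʳ ζ₀) (A.-‿inverseʳ A.1#)) regular (composeP Q 1+XP)
      (R₁.trans (shift (OriginLemmas.add-back R₁ (R₁.1# ∷ ζ ∷ []) [])) eq)) (X R₁.- R₁.1#))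
    where
    shift : ∀ {s} → R₁.1# R₁.+ (s R₁.- R₁.1#) R₁.≈ s → ev (composeP Q 1+XP) (s R₁.- R₁.1#) R₁.≈ ev Q s
    shift {s} 1+s≈ = R₁.trans (ev-compose Q 1+XP (s R₁.- R₁.1#))
      (ev-cong Q {s′ = s} (R₁.trans (proj₂ (represent 1+X) R₁ S₁.const-homo ((s R₁.- R₁.1#) ∷ [])) 1+s≈))

module FormExpansion {c ℓ} (R : CommutativeRing c ℓ) (p r X : CommutativeRing.Carrier R) where
  open CommutativeRing R
  open RingNotation rawRing using (_·_)
  open OriginFormulas rawRing p r

  expand : ∀ {A B C a b c a′ b′ c′} → A ≈ a + X * X * a′ → B ≈ b + X * X * b′ → C ≈ c + X * X * c′ →
    16 · (p * p * (p * p)) * λ₀ a b c + X * slope a b c a′ b′ c′ X ≈ form A B C X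
  expand {A} {B} {C} {a} {b} {c} {a′} {b′} {c′} A≈ B≈ C≈ = trans
    (sym (OriginLemmas.form-slope R (p ∷ r ∷ X ∷ a ∷ b ∷ c ∷ a′ ∷ b′ ∷ c′ ∷ []) []))
    (sym (Transport.push R R (identity rawRing refl)
      (OriginFormulas.form (exprRing ⊥ 6) (ν 0F) (ν 1F) (ν 2F) (ν 3F) (ν 4F) (ν 5F))
      {p ∷ r ∷ A ∷ B ∷ C ∷ X ∷ []} (refl ∷ refl ∷ A≈ ∷ B≈ ∷ C≈ ∷ refl ∷ [])))

module OriginDegree {c ℓ₁ ℓ₂ ℓ₃} (ℝ : RealField c ℓ₁ ℓ₂ ℓ₃) (p r : RealField.Carrier ℝ)
  (p>0 : RealField._<_ ℝ (RealField.0# ℝ) p) (r>0 : RealField._<_ ℝ (RealField.0# ℝ) r)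
  (2p+r≈1 : RealField._≈_ ℝ (RealField._+_ ℝ (RealField._+_ ℝ p p) r) (RealField.1# ℝ)) where
  open RealFacts ℝ
  open RealField ℝ using (_#_; +-pos; *-pos)
  open PolynomialArithmetic ℝ
  open Polynomials ℝ
  open UnivariatePolynomials ℝ
  open Algebra.Apartness.Properties.HeytingCommutativeRing (RealField.heytingCommutativeRing ℝ) using (#-congʳ; x#0y#0→xy#0)
  private
    module A = CommutativeRing realRing
    C = A.Carrier
    module R₁ = CommutativeRing R₁
    module S₁ = SeriesRing realRing
    module ι = IsRingHomomorphism S₁.const-homo
    module Eq₁ = SeriesEquations realRing
    module I = OriginLemmas R₁
    module Iℝ = OriginLemmas realRing
    ι : C → R₁.Carrier
    ι = const A.rawRing
    module F = OriginFormulas R₁.rawRing (ι p) (ι r)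
    module Fℝ = OriginFormulas A.rawRing p r
    module FE {n} = OriginFormulas (exprRing C n) (κ p) (κ r)
    id-homo : IsRingHomomorphism A.rawRing A.rawRing id
    id-homo = identity A.rawRing A.refl
    module ℝ-values = Values realRing id-homo

    p#0 : p # A.0#
    p#0 = >0⇒# p>0
    r#0 : r # A.0#
    r#0 = >0⇒# r>0
    1-p>0 : RealField._<_ ℝ A.0# (A.1# A.- p)
    1-p>0 = >0-resp (KernelLemmas.complement realRing (p ∷ r ∷ []) (2p+r≈1 ∷ [])) (+-pos p>0 r>0)
    1-p#0 : A.1# A.- p # A.0#
    1-p#0 = >0⇒# 1-p>0

    double#0 : ∀ {a} → RealField._<_ ℝ A.0# a → a A.+ a # A.0#
    double#0 a>0 = >0⇒# (+-pos a>0 a>0)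

    cancel : ∀ {a b} → b # A.0# → a A.* b A.≈ A.0# → a A.≈ A.0#
    cancel {a} b#0 = #⇒cancellable b#0 a

    open RingNotation A.rawRing using (_·_; _^_)

  ·-pos : ∀ n {a} → RealField._<_ ℝ A.0# a → RealField._<_ ℝ A.0# (suc n · a)
  ·-pos zero a>0 = >0-resp (A.sym (A.+-identityʳ _)) a>0
  ·-pos (suc n) a>0 = +-pos a>0 (·-pos n a>0)

  ^-# : ∀ n {a} → a # A.0# → a ^ suc n # A.0#
  ^-# zero a#0 = #-congʳ (A.sym (A.*-identityʳ _)) a#0
  ^-# (suc n) a#0 = x#0y#0→xy#0 a#0 (^-# n a#0)

  private
    pp>0 : RealField._<_ ℝ A.0# (p A.* p)
    pp>0 = *-pos p>0 p>0

  head₀ : Poly C 1 → C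
  head₀ [] = A.0#
  head₀ (a ∷ _) = a

  tail₀ : Poly C 1 → Poly C 1
  tail₀ [] = []
  tail₀ (_ ∷ c) = c

  ev-head-tail : ∀ c s → ev c s R₁.≈ ι (head₀ c) R₁.+ s R₁.* ev (tail₀ c) s
  ev-head-tail [] s = R₁.sym (R₁.trans (R₁.+-cong ι.0#-homo (R₁.zeroʳ s)) (R₁.+-identityˡ R₁.0#))
  ev-head-tail (a ∷ c) s = R₁.refl

  ιp-regular : Regular (ι p)
  ιp-regular f = Eq₁.*-cancel-zero {f} {ι p} (#⇒cancellable p#0)

  private
    const≈0 : ∀ {a} → a A.≈ A.0# → ι a R₁.≈ R₁.0#
    const≈0 a≈0 zero = a≈0
    const≈0 a≈0 (suc n) = A.refl

    X*≈0 : ∀ {f} → X R₁.* f R₁.≈ R₁.0# → f R₁.≈ R₁.0#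
    X*≈0 {f} eq = X-regular f (R₁.trans (R₁.*-comm f X) eq)

    leading-zero : ∀ {f} → f 0 A.≈ A.0# → f R₁.≈ X R₁.* S₁.tail f
    leading-zero {f} f₀ = R₁.trans (S₁.const+var* f) (R₁.trans (R₁.+-congʳ {X R₁.* S₁.tail f} (const≈0 f₀)) (R₁.+-identityˡ _))

    -- Positivity at X = 0 kills the constant terms of a and b. Then X² divides the relation, and
    -- descent kills all their coefficients.
    definite : ∀ {P Q} → RealField._<_ ℝ A.0# (P 0) → RealField._<_ ℝ A.0# (Q 0) →
      ∀ n a b → a R₁.* a R₁.* P R₁.+ b R₁.* b R₁.* Q R₁.≈ R₁.0# → a n A.≈ A.0# × b n A.≈ A.0#
    definite {P} {Q} P₀ Q₀ n a b eq = at n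
      where
      lowest : a 0 A.≈ A.0# × b 0 A.≈ A.0#
      lowest = positive-form (a 0) (b 0) P₀ Q₀ (A.trans (A.sym (Transport.push R₁ realRing S₁.constantTerm-homo
        (ν 0F E.* ν 0F E.* ν 1F E.+ ν 2F E.* ν 2F E.* ν 3F) {a ∷ P ∷ b ∷ Q ∷ []} (A.refl ∷ A.refl ∷ A.refl ∷ A.refl ∷ []))) (eq 0))

      at : ∀ n → a n A.≈ A.0# × b n A.≈ A.0#
      at zero = lowest
      at (suc n) = definite {P} {Q} P₀ Q₀ n (S₁.tail a) (S₁.tail b) (X*≈0 (X*≈0 (R₁.trans (R₁.sym
        (I.square-of-multiple (X ∷ a ∷ b ∷ S₁.tail a ∷ S₁.tail b ∷ P ∷ Q ∷ [])
          (leading-zero {a} (proj₁ lowest) ∷ leading-zero {b} (proj₂ lowest) ∷ []))) eq)))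

  -- w ζ vanishes doubly at ζ = 0 and simply at ζ = 1.
  module _ (k : C) where
    w : R₁.Carrier → R₁.Carrier
    w s = ι k R₁.* (s R₁.* s R₁.* (R₁.1# R₁.- s))

    private
      truncated : ∀ c → ev c (w X) R₁.≈ ι (head₀ c) R₁.+ X R₁.* X R₁.* (ι k R₁.* (R₁.1# R₁.- X) R₁.* ev (tail₀ c) (w X))
      truncated c = R₁.trans (ev-head-tail c (w X)) (I.truncate (X ∷ ι k ∷ ι (head₀ c) ∷ ev (tail₀ c) (w X) ∷ []) [])

    -- Three zeros of w give three linear conditions on the three lowest coefficients. Value and
    -- slope at the double zero X = 0 yield `λ₀` = 0 and `λ₁` = 0; the value at X = 1 then leaves a
    -- multiple of the lowest coefficient of c.
    form-zero : ∀ a b c → F.form (ev a (w X)) (ev b (w X)) (ev c (w X)) X R₁.≈ R₁.0# →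
      Fℝ.form (head₀ a) (head₀ b) (head₀ c) A.1# A.≈ A.0# →
      head₀ a A.≈ A.0# × head₀ b A.≈ A.0# × head₀ c A.≈ A.0#
    form-zero a b c double simple = a≈0 , b≈0 , c≈0
      where
      rest : Poly C 1 → R₁.Carrier
      rest c = ι k R₁.* (R₁.1# R₁.- X) R₁.* ev (tail₀ c) (w X)
      ha = head₀ a
      hb = head₀ b
      hc = head₀ c
      open RingNotation R₁.rawRing using () renaming (_·_ to _·₁_)

      λ₀-term slope : R₁.Carrier
      λ₀-term = 16 ·₁ (ι p R₁.* ι p R₁.* (ι p R₁.* ι p)) R₁.* F.λ₀ (ι ha) (ι hb) (ι hc)
      slope = F.slope (ι ha) (ι hb) (ι hc) (rest a) (rest b) (rest c) X

      expansion : λ₀-term R₁.+ X R₁.* slope R₁.≈ R₁.0#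
      expansion = R₁.trans (FormExpansion.expand R₁ (ι p) (ι r) X {ev a (w X)} {ev b (w X)} {ev c (w X)} {ι ha} {ι hb} {ι hc} {rest a} {rest b} {rest c}
        (truncated a) (truncated b) (truncated c)) double

      λ₀≈0 : Fℝ.λ₀ ha hb hc A.≈ A.0#
      λ₀≈0 = cancel (>0⇒# (·-pos 15 (*-pos pp>0 pp>0))) (A.trans (A.*-comm _ _) (A.trans (A.sym
        (A.trans (A.+-congˡ (S₁.var-*-zero slope)) (A.trans (A.+-identityʳ _)
          (Transport.push R₁ realRing S₁.constantTerm-homo
            (16 E.· (ν 0F E.* ν 0F E.* (ν 0F E.* ν 0F)) E.* OriginFormulas.λ₀ (exprRing ⊥ 5) (ν 0F) (ν 1F) (ν 2F) (ν 3F) (ν 4F))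
            {ι p ∷ ι r ∷ ι ha ∷ ι hb ∷ ι hc ∷ []} (A.refl ∷ A.refl ∷ A.refl ∷ A.refl ∷ A.refl ∷ [])))))
        (expansion 0)))

      slope≈0 : slope R₁.≈ R₁.0#
      slope≈0 = X*≈0 (R₁.trans (R₁.sym (R₁.trans (R₁.+-congʳ {X R₁.* slope} λ₀-term≈0) (R₁.+-identityˡ _))) expansion)
        where
        λ₀-term≈0 : λ₀-term R₁.≈ R₁.0#
        λ₀-term≈0 = R₁.trans (R₁.*-congˡ {16 ·₁ (ι p R₁.* ι p R₁.* (ι p R₁.* ι p))} (R₁.trans (R₁.sym (Transport.push realRing R₁ S₁.const-homo
            (OriginFormulas.λ₀ (exprRing ⊥ 5) (ν 0F) (ν 1F) (ν 2F) (ν 3F) (ν 4F)) {p ∷ r ∷ ha ∷ hb ∷ hc ∷ []}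
            (R₁.refl ∷ R₁.refl ∷ R₁.refl ∷ R₁.refl ∷ R₁.refl ∷ []))) (const≈0 λ₀≈0)))
          (R₁.zeroʳ (16 ·₁ (ι p R₁.* ι p R₁.* (ι p R₁.* ι p))))

      λ₁≈0 : Fℝ.λ₁ hb hc A.≈ A.0#
      λ₁≈0 = cancel (>0⇒# (·-pos 15 (*-pos (*-pos pp>0 p>0) (*-pos r>0 r>0))))
        (OriginLemmas.negate realRing (16 · (p A.* p A.* p A.* (r A.* r)) ∷ Fℝ.λ₁ hb hc ∷ [])
          (A.trans (A.sym (Iℝ.slope-at-0 (p ∷ r ∷ ha ∷ hb ∷ hc ∷ rest a 0 ∷ rest b 0 ∷ rest c 0 ∷ []) (λ₀≈0 ∷ [])))
            (A.trans (A.sym (Transport.push R₁ realRing S₁.constantTerm-homo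
              (OriginFormulas.slope (exprRing ⊥ 9) (ν 0F) (ν 1F) (ν 2F) (ν 3F) (ν 4F) (ν 5F) (ν 6F) (ν 7F) (ν 8F))
              {ι p ∷ ι r ∷ ι ha ∷ ι hb ∷ ι hc ∷ rest a ∷ rest b ∷ rest c ∷ X ∷ []}
              (A.refl ∷ A.refl ∷ A.refl ∷ A.refl ∷ A.refl ∷ A.refl ∷ A.refl ∷ A.refl ∷ A.refl ∷ []))) (slope≈0 0)) ∷ []))

      c≈0 : hc A.≈ A.0#
      c≈0 = cancel (x#0y#0→xy#0 rr1-p#0 rr1-p#0) (Iℝ.form-at-1 (p ∷ r ∷ ha ∷ hb ∷ hc ∷ []) (simple ∷ λ₀≈0 ∷ λ₁≈0 ∷ []))
        where
        rr1-p#0 : r A.* r A.* (A.1# A.- p) # A.0#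
        rr1-p#0 = x#0y#0→xy#0 (x#0y#0→xy#0 r#0 r#0) 1-p#0

      b≈0 : hb A.≈ A.0#
      b≈0 = cancel (>0⇒# (·-pos 3 p>0)) (Iℝ.solve-λ₁ (p ∷ r ∷ hb ∷ hc ∷ []) (λ₁≈0 ∷ c≈0 ∷ []))

      a≈0 : ha A.≈ A.0#
      a≈0 = cancel (>0⇒# (·-pos 15 pp>0)) (Iℝ.solve-λ₀ (p ∷ r ∷ ha ∷ hb ∷ hc ∷ []) (λ₀≈0 ∷ b≈0 ∷ c≈0 ∷ []))

  Family : Set _
  Family = Vec (Poly C 1) 6

  values : Family → R₁.Carrier → Vec R₁.Carrier 6
  values cs s = Vec.map (λ c → ev c s) cs

  combination : List (Poly C 1) → (Y s : R₁.Carrier) → R₁.Carrier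
  combination cs Y s = eval R₁.rawRing ι {2} cs (Y ∷ s ∷ [])

  combination-cong : ∀ cs {Y s s′} → s R₁.≈ s′ → combination cs Y s R₁.≈ combination cs Y s′
  combination-cong [] s≈ = R₁.refl
  combination-cong (c ∷ cs) {Y} {s} {s′} s≈ = R₁.+-cong (ev-cong c {s} {s′} s≈) (R₁.*-congˡ {Y} (combination-cong cs {Y} {s} {s′} s≈))

  zero-head-tail : ∀ c → head₀ c A.≈ A.0# → Zero 1 (tail₀ c) → Zero 1 c
  zero-head-tail [] _ _ = []
  zero-head-tail (a ∷ c) a≈0 c≈0 = lift a≈0 ∷ c≈0

  combination-tails : ∀ cs Y s → All (λ c → head₀ c A.≈ A.0#) cs →
    combination cs Y s R₁.≈ s R₁.* combination (List.map tail₀ cs) Y s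
  combination-tails [] Y s [] = R₁.sym (R₁.zeroʳ s)
  combination-tails (c ∷ cs) Y s (h ∷ hs) = I.split-head
    (s ∷ Y ∷ ev c s ∷ ev (tail₀ c) s ∷ combination cs Y s ∷ combination (List.map tail₀ cs) Y s ∷ [])
    (R₁.trans (ev-head-tail c s) (R₁.trans (R₁.+-congʳ {s R₁.* ev (tail₀ c) s} (const≈0 h)) (R₁.+-identityˡ (s R₁.* ev (tail₀ c) s)))
      ∷ combination-tails cs Y s hs ∷ [])

  module Independence {ζ Y : R₁.Carrier} (k : C) (ζ₀ : ζ 0 A.≈ A.1#) (ζ-1-regular : Regular (ζ R₁.- R₁.1#))
    (w-regular : Regular (w k ζ))
    (square : Y R₁.* Y R₁.* (F.D ζ R₁.* F.D ζ) R₁.- ι r R₁.* ι r R₁.* F.δ₀ ζ R₁.≈ R₁.0#) where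
    private
      wE : Expr C 1
      wE = κ k ⊗ (ν 0F ⊗ ν 0F ⊗ (𝟙 ⊕ (⊝ ν 0F)))

      wP : Poly C 1
      wP = proj₁ (represent wE)

      -- Polynomials in a single variable, to be evaluated at the series ζ, at the indeterminate X
      -- and at the real number 1.
      composites : Family → Vec (Poly C 1) 7
      composites (c₀ ∷ c₁ ∷ c₂ ∷ c₃ ∷ c₄ ∷ c₅ ∷ []) =
        composeP c₀ wP ∷ composeP c₁ wP ∷ composeP c₂ wP ∷ composeP c₃ wP ∷ composeP c₄ wP ∷ composeP c₅ wP ∷ varP 0F ∷ []

      evenE oddE definiteE : Expr C 7
      evenE = FE.form (ν 0F) (ν 2F) (ν 4F) (ν 6F)
      oddE = FE.form (ν 1F) (ν 3F) (ν 5F) (ν 6F)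
      definiteE = evenE ⊗ evenE ⊗ (FE.D (ν 6F) ⊗ FE.D (ν 6F)) ⊕ oddE ⊗ oddE ⊗ (⊝ (κ r ⊗ κ r ⊗ FE.δ₀ (ν 6F)))

      module Substitution (S : CommutativeRing c ℓ₁) {ιS : C → CommutativeRing.Carrier S}
        (ιS-homo : IsRingHomomorphism A.rawRing (CommutativeRing.rawRing S) ιS) where
        private
          module S = CommutativeRing S
          module VS = Values S ιS-homo
          open VS using () renaming (ev to evS)

        substituted : ∀ e (cs : Family) s {vs : Vec S.Carrier 6} →
          (∀ i → evS (lookup cs i) (evS wP s) S.≈ lookup vs i) →
          evS (substitute e (composites cs)) s S.≈ Evaluation.⟦_⟧ S.rawRing ιS e (vs Vec.∷ʳ s)
        substituted e cs@(c₀ ∷ c₁ ∷ c₂ ∷ c₃ ∷ c₄ ∷ c₅ ∷ []) s {v₀ ∷ v₁ ∷ v₂ ∷ v₃ ∷ v₄ ∷ v₅ ∷ []} vs≈ =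
          S.trans (eval-substitute S ιS-homo e (composites cs) (s ∷ [])) (expr-cong S ιS-homo e λ
            { 0F → S.trans (VS.ev-compose c₀ wP s) (vs≈ 0F)
            ; 1F → S.trans (VS.ev-compose c₁ wP s) (vs≈ 1F)
            ; 2F → S.trans (VS.ev-compose c₂ wP s) (vs≈ 2F)
            ; 3F → S.trans (VS.ev-compose c₃ wP s) (vs≈ 3F)
            ; 4F → S.trans (VS.ev-compose c₄ wP s) (vs≈ 4F)
            ; 5F → S.trans (VS.ev-compose c₅ wP s) (vs≈ 5F)
            ; 6F → eval-var S ιS-homo 0F (s ∷ []) })

      open Substitution R₁ S₁.const-homo using (substituted)
      open Substitution realRing id-homo using () renaming (substituted to substitutedℝ)

      substituted-w : ∀ e (cs : Family) s → ev (substitute e (composites cs)) s R₁.≈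
        Evaluation.⟦_⟧ R₁.rawRing ι e (values cs (w k s) Vec.∷ʳ s)
      substituted-w e cs s = substituted e cs s λ i → R₁.trans
        (ev-cong (lookup cs i) {ev wP s} {w k s} (proj₂ (represent wE) R₁ S₁.const-homo (s ∷ [])))
        (R₁.reflexive (≡.sym (Vec.lookup-map i (λ c → ev c (w k s)) cs)))

      substituted-1 : ∀ e (cs : Family) → ℝ-values.ev (substitute e (composites cs)) A.1# A.≈
        Evaluation.⟦_⟧ A.rawRing id e (Vec.map head₀ cs Vec.∷ʳ A.1#)
      substituted-1 e cs = substitutedℝ e cs A.1# λ i → A.trans (at-zero (lookup cs i))
        (A.reflexive (≡.sym (Vec.lookup-map i head₀ cs)))
        where
        w≈0 : ℝ-values.ev wP A.1# A.≈ A.0#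
        w≈0 = A.trans (proj₂ (represent wE) realRing id-homo (A.1# ∷ [])) (A.trans (A.*-congˡ (A.trans (A.*-congˡ (A.-‿inverseʳ A.1#)) (A.zeroʳ _))) (A.zeroʳ k))
        at-zero : ∀ c → ℝ-values.ev c (ℝ-values.ev wP A.1#) A.≈ head₀ c
        at-zero [] = A.refl
        at-zero (a ∷ c) = A.trans (A.+-congˡ (A.trans (A.*-congʳ w≈0) (A.zeroˡ _))) (A.+-identityʳ a)

    heads-vanish : ∀ (cs : Family) → combination (toList cs) Y (w k ζ) R₁.≈ R₁.0# → All (λ c → head₀ c A.≈ A.0#) (toList cs)
    heads-vanish cs@(c₀ ∷ c₁ ∷ c₂ ∷ c₃ ∷ c₄ ∷ c₅ ∷ []) relation =
      proj₁ evens ∷ proj₁ odds ∷ proj₁ (proj₂ evens) ∷ proj₁ (proj₂ odds) ∷ proj₂ (proj₂ evens) ∷ proj₂ (proj₂ odds) ∷ []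
      where
      C₀ = ev c₀ (w k ζ)
      C₁ = ev c₁ (w k ζ)
      C₂ = ev c₂ (w k ζ)
      C₃ = ev c₃ (w k ζ)
      C₄ = ev c₄ (w k ζ)
      C₅ = ev c₅ (w k ζ)

      at-ζ : ev (substitute definiteE (composites cs)) ζ R₁.≈ R₁.0#
      at-ζ = R₁.trans (substituted-w definiteE cs ζ) (I.norm-form
        (ι p ∷ ι r ∷ ζ ∷ Y ∷ F.form C₀ C₂ C₄ ζ ∷ F.form C₁ C₃ C₅ ζ ∷ [])
        (I.even-odd (ι p ∷ ι r ∷ ζ ∷ Y ∷ C₀ ∷ C₂ ∷ C₄ ∷ C₁ ∷ C₃ ∷ C₅ ∷ []) (relation ∷ square ∷ []) ∷ square ∷ []))

      evenX oddX : R₁.Carrier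
      evenX = F.form (ev c₀ (w k X)) (ev c₂ (w k X)) (ev c₄ (w k X)) X
      oddX = F.form (ev c₁ (w k X)) (ev c₃ (w k X)) (ev c₅ (w k X)) X

      at-X : evenX R₁.* evenX R₁.* (F.D X R₁.* F.D X) R₁.+ oddX R₁.* oddX R₁.* R₁.- (ι r R₁.* ι r R₁.* F.δ₀ X) R₁.≈ R₁.0#
      at-X = R₁.trans (R₁.sym (substituted-w definiteE cs X))
        (transfer {ζ} ζ₀ ζ-1-regular (substitute definiteE (composites cs)) at-ζ)

      -- The two definite factors are (X - 2p)² and - r² δ(X), with the values 4p² and r² p (1 - p)
      -- at X = 0.
      both-zero : ∀ n → evenX n A.≈ A.0# × oddX n A.≈ A.0#
      both-zero n = definite {F.D X R₁.* F.D X} {R₁.- (ι r R₁.* ι r R₁.* F.δ₀ X)}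
        (>0-resp (A.sym (A.trans (push (FE₂.D (ν 2F) E.* FE₂.D (ν 2F)) {ι p ∷ ι r ∷ X ∷ []} (A.refl ∷ A.refl ∷ A.refl ∷ []))
          (Iℝ.D²-at-0 (p ∷ []) []))) (·-pos 3 pp>0))
        (>0-resp (A.sym (A.trans (push (E.- (ν 1F E.* ν 1F E.* FE₂.δ₀ (ν 2F))) {ι p ∷ ι r ∷ X ∷ []} (A.refl ∷ A.refl ∷ A.refl ∷ []))
          (Iℝ.δ-at-0 (p ∷ r ∷ []) []))) (*-pos (*-pos r>0 r>0) (*-pos p>0 1-p>0)))
        n evenX oddX at-X
        where
        open Transport R₁ realRing S₁.constantTerm-homo
        module FE₂ = OriginFormulas (exprRing ⊥ 3) (ν 0F) (ν 1F)

      -- A series in X cannot be evaluated at 1. But a polynomial that vanishes as a series has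
      -- vanishing coefficients, hence the value 0 at 1.
      at-1 : ∀ e → ev (substitute e (composites cs)) X R₁.≈ R₁.0# →
        Evaluation.⟦_⟧ A.rawRing id e (Vec.map head₀ cs Vec.∷ʳ A.1#) A.≈ A.0#
      at-1 e eX≈0 = A.trans (A.sym (substituted-1 e cs))
        (ℝ-values.ev-zero (substitute e (composites cs)) (ev≈0⇒zero A.refl X-regular (substitute e (composites cs)) eX≈0) A.1#)

      evens = form-zero k c₀ c₂ c₄ (λ n → proj₁ (both-zero n)) (at-1 evenE (R₁.trans (substituted-w evenE cs X) (λ n → proj₁ (both-zero n))))
      odds = form-zero k c₁ c₃ c₅ (λ n → proj₂ (both-zero n)) (at-1 oddE (R₁.trans (substituted-w oddE cs X) (λ n → proj₂ (both-zero n))))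

    -- Descent on a bound for the lengths of the six lists: once the lowest coefficients vanish, the
    -- regular factor w can be cancelled from the relation.
    independent : ∀ N (cs : Family) → All (λ c → length c ℕ.≤ N) (toList cs) →
      combination (toList cs) Y (w k ζ) R₁.≈ R₁.0# → All (Zero 1) (toList cs)
    independent zero ([] ∷ [] ∷ [] ∷ [] ∷ [] ∷ [] ∷ []) (z≤n ∷ z≤n ∷ z≤n ∷ z≤n ∷ z≤n ∷ z≤n ∷ []) relation = [] ∷ [] ∷ [] ∷ [] ∷ [] ∷ [] ∷ []
    independent (suc N) cs@(c₀ ∷ c₁ ∷ c₂ ∷ c₃ ∷ c₄ ∷ c₅ ∷ []) bounds relation =
      assemble (toList cs) heads (independent N (Vec.map tail₀ cs) (shorten (toList cs) bounds)
        (w-regular (combination (toList (Vec.map tail₀ cs)) Y (w k ζ))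
          (R₁.trans (R₁.*-comm (combination (toList (Vec.map tail₀ cs)) Y (w k ζ)) (w k ζ))
            (R₁.trans (R₁.sym (combination-tails (toList cs) Y (w k ζ) heads)) relation))))
      where
      heads = heads-vanish cs relation

      shorten : ∀ cs → All (λ c → length c ℕ.≤ suc N) cs → All (λ c → length c ℕ.≤ N) (List.map tail₀ cs)
      shorten [] [] = []
      shorten ([] ∷ cs) (_ ∷ bs) = z≤n ∷ shorten cs bs
      shorten ((_ ∷ _) ∷ cs) (s≤s b ∷ bs) = b ∷ shorten cs bs

      assemble : ∀ cs → All (λ c → head₀ c A.≈ A.0#) cs → All (Zero 1) (List.map tail₀ cs) → All (Zero 1) cs
      assemble [] [] [] = []
      assemble (c ∷ cs) (h ∷ hs) (z ∷ zs) = zero-head-tail c h z ∷ assemble cs hs zs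

-- Splitting by exponents modulo 3

module Trisection {c ℓ₁ ℓ₂ ℓ₃} (ℝ : RealField c ℓ₁ ℓ₂ ℓ₃) where
  open RealFacts ℝ
  open Polynomials ℝ
  open UnivariatePolynomials ℝ
  private
    module A = CommutativeRing realRing
    module R₁ = CommutativeRing R₁
    module S₁ = SeriesRing realRing
    module I = OriginLemmas R₁
    C = A.Carrier
    t u : R₁.Carrier
    t = X
    u = t R₁.* t R₁.* t
    ι : C → R₁.Carrier
    ι = const A.rawRing

  Supported : R₁.Carrier → Set _
  Supported f = ∀ n → ¬ 3 ℕ.∣ n → f n A.≈ A.0#

  private
    conv-zero : ∀ n f g → (∀ k → k ℕ.≤ n → f k A.* g (n ∸ k) A.≈ A.0#) → (f R₁.* g) n A.≈ A.0#
    conv-zero zero f g p = A.trans (A.+-identityʳ _) (p 0 z≤n)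
    conv-zero (suc n) f g p = A.trans (A.+-cong (p 0 z≤n) (conv-zero n (S₁.tail f) g λ k k≤n → p (suc k) (s≤s k≤n))) (A.+-identityˡ _)

    supported-+ : ∀ {f g} → Supported f → Supported g → Supported (f R₁.+ g)
    supported-+ f g n ¬3∣n = A.trans (A.+-cong (f n ¬3∣n) (g n ¬3∣n)) (A.+-identityˡ _)

    supported-* : ∀ {f g} → Supported f → Supported g → Supported (f R₁.* g)
    supported-* {f} {g} f-supported g-supported n ¬3∣n = conv-zero n f g term
      where
      term : ∀ k → k ℕ.≤ n → f k A.* g (n ∸ k) A.≈ A.0#
      term k k≤n with 3 ℕ.∣? k
      ... | no ¬3∣k = A.trans (A.*-congʳ (f-supported k ¬3∣k)) (A.zeroˡ _)
      ... | yes 3∣k = A.trans (A.*-congˡ (g-supported (n ∸ k) λ 3∣n∸k →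
        ¬3∣n (≡.subst (3 ℕ.∣_) (ℕ.m+[n∸m]≡n k≤n) (ℕ.∣m∣n⇒∣m+n 3∣k 3∣n∸k)))) (A.zeroʳ _)

    supported-ι : ∀ a → Supported (ι a)
    supported-ι a zero ¬3∣0 = contradiction (3 ℕ.∣0) ¬3∣0
    supported-ι a (suc n) _ = A.refl

    supported-0 : Supported R₁.0#
    supported-0 n _ = A.refl

    supported-u : Supported u
    supported-u n ¬3∣n = A.trans (OriginLemmas.cube-right R₁ (t ∷ []) [] n) (cases n ¬3∣n)
      where
      cases : ∀ n → ¬ 3 ℕ.∣ n → (t R₁.* (t R₁.* (t R₁.* R₁.1#))) n A.≈ A.0#
      cases 0 _ = S₁.var-*-zero (t R₁.* (t R₁.* R₁.1#))
      cases 1 _ = A.trans (S₁.var-*-suc (t R₁.* (t R₁.* R₁.1#)) 0) (S₁.var-*-zero (t R₁.* R₁.1#))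
      cases 2 _ = A.trans (S₁.var-*-suc (t R₁.* (t R₁.* R₁.1#)) 1) (A.trans (S₁.var-*-suc (t R₁.* R₁.1#) 0) (S₁.var-*-zero R₁.1#))
      cases 3 ¬3∣3 = contradiction ℕ.∣-refl ¬3∣3
      cases (suc (suc (suc (suc n)))) _ = A.trans (S₁.var-*-suc (t R₁.* (t R₁.* R₁.1#)) (suc (suc (suc n))))
        (A.trans (S₁.var-*-suc (t R₁.* R₁.1#) (suc (suc n))) (S₁.var-*-suc R₁.1# (suc n)))

    supported-ev : ∀ c → Supported (ev c u)
    supported-ev [] = supported-0
    supported-ev (a ∷ c) = supported-+ {ι a} {u R₁.* ev c u} (supported-ι a) (supported-* {u} {ev c u} supported-u (supported-ev c))

    -- Supports in the three residue classes are disjoint.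
    residues : ∀ {f g h} → Supported f → Supported g → Supported h →
      f R₁.+ t R₁.* g R₁.+ t R₁.* t R₁.* h R₁.≈ R₁.0# → f R₁.≈ R₁.0# × g R₁.≈ R₁.0# × h R₁.≈ R₁.0#
    residues {f} {g} {h} f-supported g-supported h-supported eq = f≈0 , g≈0 , h≈0
      where
      t² : ∀ n → (t R₁.* t R₁.* h) n A.≈ (t R₁.* (t R₁.* h)) n
      t² = R₁.*-assoc t t h

      vanishes : ∀ {f} → Supported f → (∀ n → 3 ℕ.∣ n → f n A.≈ A.0#) → f R₁.≈ R₁.0#
      vanishes supported zeros n with 3 ℕ.∣? n
      ... | yes 3∣n = zeros n 3∣n
      ... | no ¬3∣n = supported n ¬3∣n

      offset : ∀ {n} m → 3 ℕ.∣ m ℕ.+ n → 3 ℕ.∣ n → 3 ℕ.∣ m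
      offset {n} m 3∣m+n 3∣n = ℕ.∣m+n∣m⇒∣n (≡.subst (3 ℕ.∣_) (ℕ.+-comm m n) 3∣m+n) 3∣n

      ¬3∣1 : ¬ 3 ℕ.∣ 1
      ¬3∣1 p = contradiction (ℕ.∣⇒≤ p) λ { (s≤s ()) }
      ¬3∣2 : ¬ 3 ℕ.∣ 2
      ¬3∣2 p = contradiction (ℕ.∣⇒≤ p) λ { (s≤s (s≤s ())) }

      ¬below : ∀ {n} → 3 ℕ.∣ suc n → ¬ 3 ℕ.∣ n
      ¬below {n} 3∣1+n 3∣n = ¬3∣1 (offset 1 3∣1+n 3∣n)
      ¬below₂ : ∀ {n} → 3 ℕ.∣ suc (suc n) → ¬ 3 ℕ.∣ n
      ¬below₂ {n} 3∣2+n 3∣n = ¬3∣2 (offset 2 3∣2+n 3∣n)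

      tg : ∀ n → 3 ℕ.∣ n → (t R₁.* g) n A.≈ A.0#
      tg zero _ = S₁.var-*-zero g
      tg (suc n) 3∣ = A.trans (S₁.var-*-suc g n) (g-supported n (¬below 3∣))

      tth : ∀ n → 3 ℕ.∣ n → (t R₁.* (t R₁.* h)) n A.≈ A.0#
      tth zero _ = S₁.var-*-zero (t R₁.* h)
      tth (suc zero) 3∣1 = contradiction 3∣1 ¬3∣1
      tth (suc (suc n)) 3∣ = A.trans (S₁.var-*-suc (t R₁.* h) (suc n)) (A.trans (S₁.var-*-suc h n) (h-supported n (¬below₂ 3∣)))

      f≈0 : f R₁.≈ R₁.0#
      f≈0 = vanishes {f} f-supported λ n 3∣n → A.trans (A.sym (A.trans (A.+-cong
        (A.trans (A.+-congˡ (tg n 3∣n)) (A.+-identityʳ _)) (A.trans (t² n) (tth n 3∣n))) (A.+-identityʳ (f n)))) (eq n)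

      th : ∀ n → 3 ℕ.∣ n → (t R₁.* h) n A.≈ A.0#
      th zero _ = S₁.var-*-zero h
      th (suc n) 3∣ = A.trans (S₁.var-*-suc h n) (h-supported n (¬below 3∣))

      g≈0 : g R₁.≈ R₁.0#
      g≈0 = vanishes {g} g-supported λ n 3∣n → A.trans (A.sym (A.trans (A.+-cong
        (A.trans (A.+-congʳ (f≈0 (suc n))) (A.trans (A.+-identityˡ _) (S₁.var-*-suc g n)))
        (A.trans (t² (suc n)) (A.trans (S₁.var-*-suc (t R₁.* h) n) (th n 3∣n)))) (A.+-identityʳ (g n)))) (eq (suc n))

      h≈0 : h R₁.≈ R₁.0#
      h≈0 n = A.trans (A.sym (A.trans (A.+-cong
        (A.trans (A.+-cong (f≈0 (suc (suc n))) (A.trans (S₁.var-*-suc g (suc n)) (g≈0 (suc n)))) (A.+-identityˡ _))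
        (A.trans (t² (suc (suc n))) (A.trans (S₁.var-*-suc (t R₁.* h) (suc n)) (S₁.var-*-suc h n)))) (A.+-identityˡ (h n)))) (eq (suc (suc n)))

  -- The coefficients at the exponents 3k, 3k + 1 and 3k + 2, read as polynomials in t³; removing
  -- the head rotates the three classes.
  part₀ part₁ part₂ : Poly C 1 → Poly C 1
  part₀ [] = []
  part₀ (a ∷ c) = a ∷ part₂ c
  part₁ [] = []
  part₁ (a ∷ c) = part₀ c
  part₂ [] = []
  part₂ (a ∷ c) = part₁ c

  private
    ev-parts : ∀ c → ev c t R₁.≈ ev (part₀ c) u R₁.+ t R₁.* ev (part₁ c) u R₁.+ t R₁.* t R₁.* ev (part₂ c) u
    ev-parts [] = I.zero-parts (t ∷ []) []
    ev-parts (a ∷ c) = R₁.trans (R₁.+-congˡ {ι a} (R₁.*-congˡ {t} (ev-parts c)))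
      (I.split-variable (t ∷ ι a ∷ ev (part₀ c) u ∷ ev (part₁ c) u ∷ ev (part₂ c) u ∷ []) [])

    zero-parts : ∀ c → Zero 1 (part₀ c) → Zero 1 (part₁ c) → Zero 1 (part₂ c) → Zero 1 c
    zero-parts [] _ _ _ = []
    zero-parts (a ∷ c) (z ∷ z₂) z₀ z₁ = z ∷ zero-parts c z₀ z₁ z₂

    Φ : List (Poly C 1) → (V s : R₁.Carrier) → R₁.Carrier
    Φ cs V s = eval R₁.rawRing ι {2} cs (V ∷ s ∷ [])

    Φ-parts : ∀ cs V → Φ cs V t R₁.≈
      Φ (List.map part₀ cs) V u R₁.+ t R₁.* Φ (List.map part₁ cs) V u R₁.+ t R₁.* t R₁.* Φ (List.map part₂ cs) V u
    Φ-parts [] V = I.zero-parts (t ∷ []) []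
    Φ-parts (c ∷ cs) V = I.split-sum
      (t ∷ V ∷ ev c t ∷ ev (part₀ c) u ∷ ev (part₁ c) u ∷ ev (part₂ c) u
        ∷ Φ (List.map part₀ cs) V u ∷ Φ (List.map part₁ cs) V u ∷ Φ (List.map part₂ cs) V u ∷ Φ cs V t ∷ [])
      (ev-parts c ∷ Φ-parts cs V ∷ [])

    Φ-supported : ∀ cs {V} → Supported V → Supported (Φ cs V u)
    Φ-supported [] V = supported-0
    Φ-supported (c ∷ cs) {V} V-supported = supported-+ {ev c u} {V R₁.* Φ cs V u} (supported-ev c)
      (supported-* {V} {Φ cs V u} V-supported (Φ-supported cs V-supported))

  trisect : ∀ {V} → Supported V → ∀ cs → Φ cs V t R₁.≈ R₁.0# →
    (∀ (part : Poly C 1 → Poly C 1) → Φ (List.map part cs) V u R₁.≈ R₁.0# → All (Zero 1) (List.map part cs)) → All (Zero 1) cs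
  trisect {V} V-supported cs eq independent =
    let e₀ , e₁ , e₂ = residues {Φ (List.map part₀ cs) V u} {Φ (List.map part₁ cs) V u} {Φ (List.map part₂ cs) V u}
                         (Φ-supported (List.map part₀ cs) V-supported)
                         (Φ-supported (List.map part₁ cs) V-supported) (Φ-supported (List.map part₂ cs) V-supported)
                         (R₁.trans (R₁.sym (Φ-parts cs V)) eq)
    in assemble cs (independent part₀ e₀) (independent part₁ e₁) (independent part₂ e₂)
    where
    assemble : ∀ cs → All (Zero 1) (List.map part₀ cs) → All (Zero 1) (List.map part₁ cs) → All (Zero 1) (List.map part₂ cs) → All (Zero 1) cs
    assemble [] [] [] [] = []
    assemble (c ∷ cs) (a ∷ as) (b ∷ bs) (d ∷ ds) = zero-parts c a b d ∷ assemble cs as bs ds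

-- The polynomial of degree 6 and its minimality

module DegreeOfOrigin {c ℓ₁ ℓ₂ ℓ₃} (ℝ : RealField c ℓ₁ ℓ₂ ℓ₃) (p r : RealField.Carrier ℝ)
  (p>0 : RealField._<_ ℝ (RealField.0# ℝ) p) (r>0 : RealField._<_ ℝ (RealField.0# ℝ) r)
  (2p+r≈1 : RealField._≈_ ℝ (RealField._+_ ℝ (RealField._+_ ℝ p p) r) (RealField.1# ℝ)) where
  open RealFacts ℝ
  open RealField ℝ using (_#_; +-pos; *-pos)
  open PolynomialArithmetic ℝ
  open Polynomials ℝ
  open UnivariatePolynomials ℝ
  open OriginDegree ℝ p r p>0 r>0 2p+r≈1
  open Trisection ℝ
  open Algebra.Apartness.Properties.HeytingCommutativeRing (RealField.heytingCommutativeRing ℝ) using (#-congʳ; x#0y#0→xy#0)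
  private
    module A = CommutativeRing realRing
    C = A.Carrier
    module R₁ = CommutativeRing R₁
    module S₁ = SeriesRing realRing
    module I = OriginLemmas R₁
    ι : C → R₁.Carrier
    ι = const A.rawRing
    t = X
    module F = OriginFormulas R₁.rawRing (ι p) (ι r)
    module FE {n} = OriginFormulas (exprRing C n) (κ p) (κ r)
    id-homo : IsRingHomomorphism A.rawRing A.rawRing id
    id-homo = identity A.rawRing A.refl
    open RingNotation A.rawRing using (_·_; _^_)

  private
    coefficients : Vec (Expr C 1) 7
    coefficients = FE.coefficient₀ τE ∷ FE.coefficient₁ τE ∷ FE.coefficient₂ τE ∷ FE.coefficient₃ τE ∷
      FE.coefficient₄ τE ∷ FE.coefficient₅ τE ∷ FE.coefficient₆ τE ∷ []
      where
      τE : Expr C 1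
      τE = Formulas.τ (exprRing C 1) (κ p) (κ r) (ν 0F)

    minimal : Vec (Poly C 1) 7
    minimal = Vec.map (λ e → proj₁ (represent e)) coefficients

    -- The norm of Y² (ζ - 2p)² - r² δ(ζ) for ζ³ = ζ² - τ is a cubic polynomial in Y², hence of
    -- degree 6 in V, and its coefficients are polynomials in τ.
    minimal-root : (R : CommutativeRing c ℓ₁) → let module S = CommutativeRing R in
      {h : C → S.Carrier} (h-homo : IsRingHomomorphism A.rawRing S.rawRing h) (t V ζ : S.Carrier) →
      let module G = OriginFormulas S.rawRing (h p) (h r)
          τ = Formulas.τ S.rawRing (h p) (h r) t in
      τ S.≈ ζ S.* ζ S.- ζ S.* ζ S.* ζ →
      (h p S.* V S.+ h r) S.* (h p S.* V S.+ h r) S.* (G.D ζ S.* G.D ζ) S.- h r S.* h r S.* G.δ₀ ζ S.≈ S.0# →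
      eval S.rawRing h {2} (toList minimal) (V ∷ t ∷ []) S.≈ S.0#
    minimal-root R {h} h-homo t V ζ cubic square = OriginLemmas.minimal-polynomial R
      (h p ∷ h r ∷ V ∷ G.n₀ τ ∷ G.n₁ τ ∷ G.n₂ τ ∷ G.n₃ τ
        ∷ value 0F ∷ value 1F ∷ value 2F ∷ value 3F ∷ value 4F ∷ value 5F ∷ value 6F ∷ [])
      (OriginLemmas.norm-of-square R (h p ∷ h r ∷ τ ∷ (h p S.* V S.+ h r) S.* (h p S.* V S.+ h r) ∷ [])
         (NormLemmas.norm-multiple R (ζ ∷ τ ∷ _ ∷ _ ∷ _ ∷ [])
           (OriginLemmas.quadratic-in-ζ R (h p ∷ h r ∷ V ∷ ζ ∷ []) (square ∷ []) ∷
            OriginLemmas.cube R (τ ∷ ζ ∷ []) (cubic ∷ []) ∷ []) ∷ []) ∷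
       represents 0F ∷ represents 1F ∷ represents 2F ∷ represents 3F ∷ represents 4F ∷ represents 5F ∷ represents 6F ∷ [])
      where
      module S = CommutativeRing R
      module G = OriginFormulas S.rawRing (h p) (h r)
      τ = Formulas.τ S.rawRing (h p) (h r) t
      value : Fin 7 → S.Carrier
      value i = eval S.rawRing h {1} (proj₁ (represent (lookup coefficients i))) (t ∷ [])
      represents : ∀ i → value i S.≈ Evaluation.⟦_⟧ S.rawRing h (lookup coefficients i) (t ∷ [])
      represents i = proj₂ (represent (lookup coefficients i)) R h-homo (t ∷ [])

    minimal-leading : Nonzero 1 (last minimal)
    minimal-leading = eval#⇒nonzero 1 (last minimal) (A.0# ∷ []) (#-congʳ
      (A.sym (A.trans (proj₂ (represent (lookup coefficients 6F)) realRing id-homo (A.0# ∷ []))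
        (OriginLemmas.leading-at-0 realRing (p ∷ r ∷ []) (2p+r≈1 ∷ []))))
      (x#0y#0→xy#0 (^-# 5 (>0⇒# p>0)) (>0⇒# (*-pos 4ppr>0 4ppr>0))))
      where
      4ppr>0 : RealField._<_ ℝ A.0# ((p A.+ p) A.* (p A.+ p) A.* r)
      4ppr>0 = *-pos (*-pos (+-pos p>0 p>0) (+-pos p>0 p>0)) r>0

  module _ {ζ V : R₁.Carrier} (ζ₀ : ζ 0 A.≈ A.1#) (V-supported : Supported V)
    (cubic : Formulas.τ R₁.rawRing (ι p) (ι r) t R₁.≈ ζ R₁.* ζ R₁.- ζ R₁.* ζ R₁.* ζ)
    (square : (ι p R₁.* V R₁.+ ι r) R₁.* (ι p R₁.* V R₁.+ ι r) R₁.* (F.D ζ R₁.* F.D ζ) R₁.- ι r R₁.* ι r R₁.* F.δ₀ ζ R₁.≈ R₁.0#)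
    where
    private
      u Y : R₁.Carrier
      u = t R₁.* t R₁.* t
      Y = ι p R₁.* V R₁.+ ι r

      u-regular : Regular u
      u-regular f fu≈0 = X-regular f (X-regular (f R₁.* t) (X-regular (f R₁.* t R₁.* t)
        (R₁.trans (I.cube-assoc (f ∷ t ∷ []) []) fu≈0)))

      4ppr#0 : 4 · (p A.* p A.* r) # A.0#
      4ppr#0 = >0⇒# (·-pos 3 (*-pos (*-pos p>0 p>0) r>0))

      -- k = 1/(4p²r), so that t³ = k ζ² (1 - ζ).
      k : C
      k = proj₁ (#⇒unit 4ppr#0)

      scale : let open RingNotation R₁.rawRing renaming (_·_ to _·₁_) using () in 4 ·₁ (ι p R₁.* ι p R₁.* ι r) R₁.* ι k R₁.≈ R₁.1#
      scale = R₁.trans (R₁.sym (Transport.push realRing R₁ S₁.const-homo (4 E.· (ν 0F E.* ν 0F E.* ν 1F) E.* ν 2F) {p ∷ r ∷ k ∷ []} (R₁.refl ∷ R₁.refl ∷ R₁.refl ∷ [])))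
        (R₁.trans (IsRingHomomorphism.⟦⟧-cong S₁.const-homo (proj₂ (#⇒unit 4ppr#0))) (IsRingHomomorphism.1#-homo S₁.const-homo))

      u≈w : u R₁.≈ w k ζ
      u≈w = I.cube-scale (ι k ∷ ι p ∷ ι r ∷ t ∷ ζ ∷ []) (scale ∷ cubic ∷ [])

      ζ-1-regular : Regular (ζ R₁.- R₁.1#)
      ζ-1-regular f f[ζ-1]≈0 = u-regular f (I.η-regular (ι p ∷ ι r ∷ t ∷ ζ ∷ ι k ∷ f ∷ []) (cubic ∷ f[ζ-1]≈0 ∷ scale ∷ []))

      w-regular : Regular (w k ζ)
      w-regular f fw≈0 = u-regular f (R₁.trans (R₁.*-congˡ {f} u≈w) fw≈0)

      open Independence {ζ} {Y} k ζ₀ ζ-1-regular w-regular square using (independent)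

      length-bound : ∀ cs → ∃ λ N → All (λ c → length {A = C} c ℕ.≤ N) cs
      length-bound [] = 0 , []
      length-bound (c ∷ cs) = let N , bounds = length-bound cs in
        length c ℕ.⊔ N , ℕ.m≤m⊔n (length c) N ∷ All.map (λ b → ℕ.≤-trans b (ℕ.m≤n⊔m (length c) N)) bounds

      shiftE : Vec (Expr C 6) 6
      shiftE = G FE.g₀ ∷ G FE.g₁ ∷ G FE.g₂ ∷ G FE.g₃ ∷ G FE.g₄ ∷ G FE.g₅ ∷ []
        where
        G : ((c₀ c₁ c₂ c₃ c₄ c₅ : Expr C 6) → Expr C 6) → Expr C 6
        G g = g (ν 0F) (ν 1F) (ν 2F) (ν 3F) (ν 4F) (ν 5F)

      shifted : Family → Family
      shifted cs = Vec.map (λ e → substitute e cs) shiftE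

      ev-shifted : ∀ e cs s → ev (substitute e cs) s R₁.≈ Evaluation.⟦_⟧ R₁.rawRing ι e (values cs s)
      ev-shifted e cs s = eval-substitute R₁ S₁.const-homo e cs (s ∷ [])

      shifted-relation : ∀ cs → combination (toList cs) V u R₁.≈ R₁.0# → combination (toList (shifted cs)) Y (w k ζ) R₁.≈ R₁.0#
      shifted-relation cs@(c₀ ∷ c₁ ∷ c₂ ∷ c₃ ∷ c₄ ∷ c₅ ∷ []) relation =
        R₁.trans (R₁.sym (combination-cong (toList (shifted cs)) {Y} {u} {w k ζ} u≈w))
          (R₁.trans (evaluate shiftE)
            (I.shift-unknown (ι p ∷ ι r ∷ V ∷ ev c₀ u ∷ ev c₁ u ∷ ev c₂ u ∷ ev c₃ u ∷ ev c₄ u ∷ ev c₅ u ∷ []) (relation ∷ [])))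
        where
        horner : ∀ {n} → Vec (Expr C 6) n → R₁.Carrier
        horner [] = R₁.0#
        horner (e ∷ es) = Evaluation.⟦_⟧ R₁.rawRing ι e (values cs u) R₁.+ Y R₁.* horner es

        evaluate : ∀ {n} (es : Vec (Expr C 6) n) → combination (toList (Vec.map (λ e → substitute e cs) es)) Y u R₁.≈ horner es
        evaluate [] = R₁.refl
        evaluate (e ∷ es) = R₁.+-cong (ev-shifted e cs u) (R₁.*-congˡ {Y} (evaluate es))

      -- The substitution Y = pV + r acts on coefficients by a triangular matrix with powers of p on
      -- the diagonal, so it is undone from the top coefficient downwards.
      unshifted : ∀ cs → All (Zero 1) (toList (shifted cs)) → All (Zero 1) (toList cs)
      unshifted cs@(c₀ ∷ c₁ ∷ c₂ ∷ c₃ ∷ c₄ ∷ c₅ ∷ []) (z₀ ∷ z₁ ∷ z₂ ∷ z₃ ∷ z₄ ∷ z₅ ∷ []) =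
        to-zero c₀ d₀ ∷ to-zero c₁ d₁ ∷ to-zero c₂ d₂ ∷ to-zero c₃ d₃ ∷ to-zero c₄ d₄ ∷ to-zero c₅ d₅ ∷ []
        where
        to-zero : ∀ c → ev c X R₁.≈ R₁.0# → Zero 1 c
        to-zero c = ev≈0⇒zero A.refl X-regular c

        g≈0 : ∀ e → Zero 1 (substitute e cs) → Evaluation.⟦_⟧ R₁.rawRing ι e (values cs X) R₁.≈ R₁.0#
        g≈0 e z = R₁.trans (R₁.sym (ev-shifted e cs X)) (ev-zero (substitute e cs) z X)

        D₀ = ev c₀ X
        D₁ = ev c₁ X
        D₂ = ev c₂ X
        D₃ = ev c₃ X
        D₄ = ev c₄ X
        D₅ = ev c₅ X
        vars = ι p ∷ ι r ∷ D₀ ∷ D₁ ∷ D₂ ∷ D₃ ∷ D₄ ∷ D₅ ∷ []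

        d₅ : D₅ R₁.≈ R₁.0#
        d₅ = g≈0 (lookup shiftE 5F) z₅
        d₄ : D₄ R₁.≈ R₁.0#
        d₄ = ιp-regular D₄ (I.solve-g₄ vars (g≈0 (lookup shiftE 4F) z₄ ∷ d₅ ∷ []))
        d₃ : D₃ R₁.≈ R₁.0#
        d₃ = ιp-regular D₃ (ιp-regular (D₃ R₁.* ι p) (I.solve-g₃ vars (g≈0 (lookup shiftE 3F) z₃ ∷ d₅ ∷ d₄ ∷ [])))
        d₂ : D₂ R₁.≈ R₁.0#
        d₂ = ιp-regular D₂ (ιp-regular (D₂ R₁.* ι p) (ιp-regular (D₂ R₁.* ι p R₁.* ι p)
          (I.solve-g₂ vars (g≈0 (lookup shiftE 2F) z₂ ∷ d₅ ∷ d₄ ∷ d₃ ∷ []))))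
        d₁ : D₁ R₁.≈ R₁.0#
        d₁ = ιp-regular D₁ (ιp-regular (D₁ R₁.* ι p) (ιp-regular (D₁ R₁.* ι p R₁.* ι p) (ιp-regular (D₁ R₁.* ι p R₁.* ι p R₁.* ι p)
          (I.solve-g₁ vars (g≈0 (lookup shiftE 1F) z₁ ∷ d₅ ∷ d₄ ∷ d₃ ∷ d₂ ∷ [])))))
        d₀ : D₀ R₁.≈ R₁.0#
        d₀ = ιp-regular D₀ (ιp-regular (D₀ R₁.* ι p) (ιp-regular (D₀ R₁.* ι p R₁.* ι p) (ιp-regular (D₀ R₁.* ι p R₁.* ι p R₁.* ι p)
          (ιp-regular (D₀ R₁.* ι p R₁.* ι p R₁.* ι p R₁.* ι p)
            (I.solve-g₀ vars (g≈0 (lookup shiftE 0F) z₀ ∷ d₅ ∷ d₄ ∷ d₃ ∷ d₂ ∷ d₁ ∷ []))))))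

      independent-u : ∀ cs → combination (toList cs) V u R₁.≈ R₁.0# → All (Zero 1) (toList cs)
      independent-u cs relation = let N , bounds = length-bound (toList (shifted cs)) in
        unshifted cs (independent N (shifted cs) bounds (shifted-relation cs relation))

    degree-6 : HasDegree 6 V
    degree-6 = (minimal , minimal-leading , minimal-root R₁ S₁.const-homo t V ζ cubic square) , λ P root →
      trisect {V} V-supported (toList P) root λ part relation →
        ≡.subst (All (Zero 1)) (Vec.toList-map part P) (independent-u (Vec.map part P)
          (≡.subst (λ cs → combination cs V u R₁.≈ R₁.0#) (≡.sym (Vec.toList-map part P)) relation))

module OriginSeriesDegree {c ℓ₁ ℓ₂ ℓ₃} (ℝ : RealField c ℓ₁ ℓ₂ ℓ₃) (p q r : RealField.Carrier ℝ)
  (p>0 : RealField._<_ ℝ (RealField.0# ℝ) p)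
  (q>0 : RealField._<_ ℝ (RealField.0# ℝ) q)
  (r>0 : RealField._<_ ℝ (RealField.0# ℝ) r)
  (total : RealField._≈_ ℝ (RealField._+_ ℝ (RealField._+_ ℝ p q) r) (RealField.1# ℝ))
  (p≈q : RealField._≈_ ℝ p q) where
  open RealFacts ℝ
  open Walk ℝ p q r p>0 q>0 r>0
  open WalkFacts ℝ p q r p>0 q>0 r>0 using (P₀₀-support)
  open WalkSeries ℝ p q r p>0 q>0 r>0 total p≈q
  open Conclusion ℝ p q r p>0 q>0 r>0 total p≈q
  open DegreeOfOrigin ℝ p r p>0 r>0 2p+r
  private
    Z = proj₁ Z-exists-unique
    isZ = proj₁ (proj₂ Z-exists-unique)
    √Δ₊ = proj₁ (√Δ₊-exists-unique Z isZ)
    is√₊ = proj₁ (proj₂ (√Δ₊-exists-unique Z isZ))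
    module M = KernelMethod (model Z isZ √Δ₊ is√₊)

    ζ₀ : ζ Z isZ 0 A.≈ A.1#
    ζ₀ = A.trans (A.sym (A.*-identityʳ _)) (A.trans (A.*-congˡ (A.sym (Z₀ Z isZ)))
      (A.trans (A.sym (SeriesRing.*-zero-coeff realRing (ζ Z isZ) Z)) (ζZ Z isZ 0)))

  P₀₀-degree : Polynomials.HasDegree ℝ 6 T.P₀₀
  P₀₀-degree = degree-6 {ζ Z isZ} {T.P₀₀} ζ₀ P₀₀-support M.τ-reciprocal M.origin-square

theorem11 : ∀ {c ℓ₁ ℓ₂ ℓ₃} (ℝ : RealField c ℓ₁ ℓ₂ ℓ₃) →
    let open RealField ℝ in
    (p q r : Carrier) (p>0 : 0# < p) (q>0 : 0# < q) (r>0 : 0# < r) →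
    p + q + r ≈ 1# →
    p ≈ q →
    let open Walk ℝ p q r p>0 q>0 r>0 in
    XYT.IsAlgebraic XYT.P ×
    Polynomials.HasDegree ℝ 6 T.P₀₀ ×
    T.P₀₀ T.≈ T.P₀₀-multiplesOf3 ×
    ∃! T._≈_ T.IsZ ×
    (∀ Z → T.IsZ Z →
      ∃! T._≈_ (T.Is√Δ₋[p/t] Z) ×
      ∃! XT._≈_ (XT.Is√Δ₊ Z) ×
      (∀ √Δ₋ √Δ₊ → T.Is√Δ₋[p/t] Z √Δ₋ → XT.Is√Δ₊ Z √Δ₊ →
        XYT.IsExpressibleIn Z √Δ₋ √Δ₊ XYT.P ×
        Σ (T.Invertible T.1# T._*_ (T.1-2pZ Z)) λ D⁻¹ →
        Σ (XT.Invertible XT.1# XT._*_ (XT.Z[1-2pZ] Z)) λ E⁻¹ →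
          T.P₀₀ T.≈ T.originFormula √Δ₋ (proj₁ D⁻¹) ×
          XT.axisFactor XT.* XT.Q[px,0] XT.≈ XT.axisFormula Z √Δ₋ √Δ₊ (proj₁ E⁻¹) ×
          -- setting x = 0 turns the last identity into t times the previous one
          XT.atX=0 XT.axisFactor T.≈ T.t ×
          XT.atX=0 XT.Q[px,0] T.≈ T.P₀₀ ×
          XT.atX=0 (XT.axisFormula Z √Δ₋ √Δ₊ (proj₁ E⁻¹))
            T.≈ T.t T.* T.originFormula √Δ₋ (proj₁ D⁻¹)))
theorem11 ℝ p q r p>0 q>0 r>0 total p≈q =
  C.P-isAlgebraic , OriginSeriesDegree.P₀₀-degree ℝ p q r p>0 q>0 r>0 total p≈q , F.P₀₀≈multiplesOf3 , C.Z-exists-unique , λ Z isZ →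
    C.√Δ₋-exists-unique Z isZ , C.√Δ₊-exists-unique Z isZ , λ √Δ₋ √Δ₊ is√₋ is√₊ →
      C.P-expressible Z isZ √Δ₋ √Δ₊ is√₋ is√₊ ,
      C.D-invertible Z isZ √Δ₋ √Δ₊ is√₋ is√₊ ,
      C.E-invertible Z isZ √Δ₋ √Δ₊ is√₋ is√₊ ,
      C.origin-formula Z isZ √Δ₋ √Δ₊ is√₋ is√₊ ,
      C.axis-formula Z isZ √Δ₋ √Δ₊ is√₋ is√₊ ,
      C.axisFactor-at-0 Z isZ √Δ₋ √Δ₊ is√₋ is√₊ ,
      C.Q-at-0 Z isZ √Δ₋ √Δ₊ is√₋ is√₊ ,
      C.axisFormula-at-0 Z isZ √Δ₋ √Δ₊ is√₋ is√₊
  where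
  module C = Conclusion ℝ p q r p>0 q>0 r>0 total p≈q
  module F = WalkFacts ℝ p q r p>0 q>0 r>0
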